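{- Let $\lambda$ and $\lambda'$ be partitions with at most $n$ parts, let $\beta\in U_\lambda(n)$ and $\pi\in S_n^{\lambda'}$, and suppose $s_\lambda(\beta;x)=d_{\lambda'}(\pi;x)$ as polynomials. Then $Q_\lambda(\beta)=Y_{\lambda'}(\pi)$. Hence $\lambda=\lambda'$ and $\Delta_\lambda(\beta)=\Psi_\lambda(\pi)$. Moreover $\pi$ is $\lambda$-312-avoiding and $\Delta_\lambda(\beta)\in UG_\lambda(n)$ (so $\beta\in UGC_\lambda(n)$); consequently the only row bound sums that equal Demazure polynomials are those identical to flag Schur polynomials. Furthermore $s_\lambda(\beta;x)\equiv d_{\lambda'}(\pi;x)$, and $s_\lambda(\beta;x)$ is identical to the flag Schur polynomial $s_\lambda(\Phi_\lambda[\Delta_\lambda(\beta)];x)$.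
   Context: Fix $n\ge1$, $[n]=\{1,\dots,n\}$, variables $x_1,\dots,x_n$. A partition $\lambda=(\lambda_1\ge\dots\ge\lambda_n\ge0)$; box $(j,i)$ of its shape is in column $j$, row $i$. $R_\lambda\subseteq[n-1]$ is the set of distinct column lengths of $\lambda$ less than $n$, written $q_1<\dots<q_r$, $q_0:=0$, $q_{r+1}:=n$; carrels are $(q_{h-1},q_h]$, $h\in[r+1]$. $\lambda$-tuples: $n$-tuples with entries in $[n]$; upper if $\beta_i\ge i$. $U_\lambda(n)$ upper ones; $UF_\lambda(n)$ weakly increasing upper ones; $UI_\lambda(n)$ upper ones strictly increasing on each carrel. Critical indices of $\beta$: in carrel $h$ put $x_1:=q_h$; recursively $x_u$ is the largest index with $q_{h-1}<x_u<x_{u-1}$ and $\beta_{x_{u-1}}-\beta_{x_u}>x_{u-1}-x_u$, stopping when none exists. $\Delta_\lambda(\beta)_i:=\beta_x-(x-i)$, $x$ the smallest critical index $\ge i$ in the carrel of $i$. $UGC_\lambda(n)$: $\beta$ whose critical entries, listed by increasing critical index, weakly increase; $UG_\lambda(n):=UGC_\lambda(n)\cap UI_\lambda(n)$. $\Phi_\lambda(\gamma)$ for $\gamma\in UG_\lambda(n)$: $\tau_x=\gamma_x$ at critical indices; for non-critical $i$, with $x$ the smallest critical index $\ge i$ in its carrel, $\tau_i:=\max\{\gamma_{q_h},\gamma_x-(x-i)\}$ if $i$ is in carrel $h+1$ ($h\in[r]$) and $x$ is the smallest critical index of that carrel, else $\tau_i:=\gamma_x-(x-i)$; this is an upper flag.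 $S_n^\lambda$: permutations $\pi$ of $[n]$ increasing on each carrel; $B_h:=\{\pi_1,\dots,\pi_{q_h}\}$. $\pi$ is $\lambda$-312-avoiding if there are no $h\in[r-1]$ and $a\le q_h<b\le q_{h+1}<c$ with $\pi_a>\pi_c>\pi_b$. $\Psi_\lambda(\pi)=\psi$: for $i$ in carrel $h$, $\psi_i$ is the $(q_h-i+1)$-th largest element of $B_h$. $\mathcal{T}_\lambda$: semistandard tableaux of shape $\lambda$ with entries in $[n]$, ordered entrywise; content $\Theta(T)$; weight $x^{\Theta(T)}=\prod x_i^{\theta_i}$. $\mathcal{S}_\lambda(\beta):=\{T:T_j(i)\le\beta_i\ \forall (j,i)\}$; row bound sum $s_\lambda(\beta;x):=\sum_{T\in\mathcal{S}_\lambda(\beta)}x^{\Theta(T)}$ (flag Schur polynomial when $\beta\in UF_\lambda(n)$). $Q_\lambda(\beta)$: entrywise maximum of $\mathcal{S}_\lambda(\beta)$. $Y_\lambda(\pi)$: tableau of shape $\lambda$ whose columns of length $q_h$ have entry set $B_h$ and columns of length $n$ have entry set $[n]$. $\mathcal{D}_\lambda(\pi):=\{T:K_+(T)\le Y_\lambda(\pi)\}$ with $K_+(T)$ the Lascoux–Schützenberger right key; $d_\lambda(\pi;x):=\sum_{T\in\mathcal{D}_\lambda(\pi)}x^{\Theta(T)}$. Identical ($\equiv$) means equal underlying tableau sets. -}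

module Defs where

open import Data.Nat using (ℕ; zero; suc; _+_; _∸_; _≤_; _<_; _⊔_; _⊓_; _≤ᵇ_; _<ᵇ_; _≡ᵇ_)
open import Data.Bool using (Bool; true; false; _∧_; _∨_; not; if_then_else_)
open import Data.List using (List; []; _∷_; _++_; map; length; foldr; foldl; concat;
  concatMap; reverse; zipWith; upTo) renaming (filterᵇ to filter)
open import Data.Bool.ListAction using (and; any; all)
open import Data.Vec using (Vec; []; _∷_; tabulate; toList)
open import Data.Fin using (Fin; toℕ)
open import Data.Product using (_×_; ∃-syntax)
open import Data.Empty using (⊥)
open import Data.List.Relation.Unary.Linked using (Linked)
open import Relation.Binary.PropositionalEquality using (_≡_)

-- Generic helpers (indices are 1-based natural numbers throughout)

-- 1-based lookup in an n-tuple; out-of-range indices give 0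
_!_ : ∀ {n} → Vec ℕ n → ℕ → ℕ
[] ! _ = 0
(x ∷ xs) ! zero = 0
(x ∷ xs) ! suc zero = x
(x ∷ xs) ! suc (suc i) = xs ! suc i

-- 1-based lookup in a list; out-of-range indices give 0
_‼_ : List ℕ → ℕ → ℕ
[] ‼ _ = 0
(x ∷ xs) ‼ zero = 0
(x ∷ xs) ‼ suc zero = x
(x ∷ xs) ‼ suc (suc i) = xs ‼ suc i

range : ℕ → ℕ → List ℕ
range a b = map (a +_) (upTo (suc b ∸ a))

_∈ᵇ_ : ℕ → List ℕ → Bool
k ∈ᵇ xs = any (_≡ᵇ k) xs

sortedSet : ℕ → List ℕ → List ℕ
sortedSet n xs = filter (λ k → k ∈ᵇ xs) (range 1 n)

IsPartition : ∀ {n} → Vec ℕ n → Set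
IsPartition {n} lam = ∀ i j → 1 ≤ i → i ≤ j → j ≤ n → lam ! j ≤ lam ! i

colLen : ∀ {n} → Vec ℕ n → ℕ → ℕ
colLen {n} lam j = length (filter (λ i → j ≤ᵇ lam ! i) (range 1 n))

colLens : ∀ {n} → Vec ℕ n → List ℕ
colLens lam = map (colLen lam) (range 1 (lam ! 1))

Rlam : ∀ {n} → Vec ℕ n → List ℕ
Rlam {n} lam = filter (λ c → c ∈ᵇ colLens lam) (range 1 (n ∸ 1))

rOf : ∀ {n} → Vec ℕ n → ℕ
rOf lam = length (Rlam lam)

q : ∀ {n} → Vec ℕ n → ℕ → ℕ
q lam zero = 0
q {n} lam (suc h) = (Rlam lam ++ (n ∷ [])) ‼ suc h

-- the index h of the carrel (q_{h-1}, q_h] containing i (for 1 ≤ i ≤ n)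
carrel : ∀ {n} → Vec ℕ n → ℕ → ℕ
carrel lam i = length (filter (λ x → x <ᵇ i) (0 ∷ Rlam lam))

IsUpper : ∀ {n} → Vec ℕ n → Set
IsUpper {n} β = ∀ i → 1 ≤ i → i ≤ n → (i ≤ β ! i) × (β ! i ≤ n)

IsUpperFlag : ∀ {n} → Vec ℕ n → Set
IsUpperFlag {n} β = IsUpper β × (∀ i → 1 ≤ i → i < n → β ! i ≤ β ! suc i)

InUI : ∀ {n} → Vec ℕ n → Vec ℕ n → Set
InUI {n} lam β = IsUpper β ×
  (∀ i j → 1 ≤ i → i < j → j ≤ n → carrel lam i ≡ carrel lam j → β ! i < β ! j)

-- Critical indices.  Given the previous critical index p, scan the
-- candidates x = k, k-1, ..., lo+1 (lo = q_{h-1}) and take the largest x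
-- with β_p - β_x > p - x  (i.e. β_x + p < β_p + x); then recurse from x.
critScan : ∀ {n} → Vec ℕ n → ℕ → ℕ → ℕ → List ℕ
critScan β lo p zero = []
critScan β lo p (suc k) =
  if lo <ᵇ suc k
  then (if (β ! suc k) + p <ᵇ (β ! p) + suc k
        then suc k ∷ critScan β lo (suc k) k
        else critScan β lo p k)
  else []

crits : ∀ {n} → Vec ℕ n → Vec ℕ n → ℕ → List ℕ
crits lam β h = q lam h ∷ critScan β (q lam (h ∸ 1)) (q lam h) (q lam h ∸ 1)

allCrits : ∀ {n} → Vec ℕ n → Vec ℕ n → List ℕ
allCrits lam β = concatMap (λ h → reverse (crits lam β h)) (range 1 (suc (rOf lam)))

critAbove : ∀ {n} → Vec ℕ n → Vec ℕ n → ℕ → ℕ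
critAbove lam β i =
  foldr _⊓_ (q lam (carrel lam i)) (filter (λ x → i ≤ᵇ x) (crits lam β (carrel lam i)))

Δ : ∀ {n} → Vec ℕ n → Vec ℕ n → Vec ℕ n
Δ lam β = tabulate (λ k → let i = suc (toℕ k) ; x = critAbove lam β i in (β ! x) ∸ (x ∸ i))

InUGC : ∀ {n} → Vec ℕ n → Vec ℕ n → Set
InUGC lam β = IsUpper β × Linked _≤_ (map (β !_) (allCrits lam β))

InUG : ∀ {n} → Vec ℕ n → Vec ℕ n → Set
InUG lam β = InUGC lam β × InUI lam β

Φ : ∀ {n} → Vec ℕ n → Vec ℕ n → Vec ℕ n
Φ lam γ = tabulate τ
  where
  τ : _ → ℕ
  τ k =
    let i  = suc (toℕ k)
        h  = carrel lam i
        cs = crits lam γ h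
        x  = critAbove lam γ i
        v  = (γ ! x) ∸ (x ∸ i)
    in if i ∈ᵇ cs then γ ! i
       else (if (2 ≤ᵇ h) ∧ (x ≡ᵇ foldr _⊓_ (q lam h) cs)
             then (γ ! q lam (h ∸ 1)) ⊔ v
             else v)

InSnλ : ∀ {n} → Vec ℕ n → Vec ℕ n → Set
InSnλ {n} lam π =
  (∀ i → 1 ≤ i → i ≤ n → (1 ≤ π ! i) × (π ! i ≤ n)) ×
  (∀ i j → 1 ≤ i → i ≤ n → 1 ≤ j → j ≤ n → π ! i ≡ π ! j → i ≡ j) ×
  (∀ i j → 1 ≤ i → i < j → j ≤ n → carrel lam i ≡ carrel lam j → π ! i < π ! j)

Bset : ∀ {n} → Vec ℕ n → Vec ℕ n → ℕ → List ℕ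
Bset lam π h = map (π !_) (range 1 (q lam h))

Avoids312 : ∀ {n} → Vec ℕ n → Vec ℕ n → Set
Avoids312 {n} lam π =
  ∀ h a b c → 1 ≤ h → h ≤ rOf lam ∸ 1 →
  1 ≤ a → a ≤ q lam h → q lam h < b → b ≤ q lam (suc h) → q lam (suc h) < c → c ≤ n →
  π ! c < π ! a → π ! b < π ! c → ⊥

Ψ : ∀ {n} → Vec ℕ n → Vec ℕ n → Vec ℕ n
Ψ {n} lam π = tabulate (λ k →
  let i = suc (toℕ k) ; h = carrel lam i in
  reverse (sortedSet n (Bset lam π h)) ‼ (suc (q lam h) ∸ i))

-- Tableaux: a tableau is its list of columns (left to right), each
-- column listed top to bottom; T_j(i) = i-th entry of the j-th column.

Tableau : Set
Tableau = List (List ℕ)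

strictIncr : List ℕ → Bool
strictIncr [] = true
strictIncr (x ∷ []) = true
strictIncr (x ∷ y ∷ xs) = (x <ᵇ y) ∧ strictIncr (y ∷ xs)

rowsOK : Tableau → Bool
rowsOK [] = true
rowsOK (C ∷ []) = true
rowsOK (C ∷ D ∷ Ts) = and (zipWith _≤ᵇ_ C D) ∧ rowsOK (D ∷ Ts)

listEq : List ℕ → List ℕ → Bool
listEq [] [] = true
listEq [] (_ ∷ _) = false
listEq (_ ∷ _) [] = false
listEq (x ∷ xs) (y ∷ ys) = (x ≡ᵇ y) ∧ listEq xs ys

isSSYT : ∀ {n} → Vec ℕ n → Tableau → Bool
isSSYT {n} lam T =
  listEq (map length T) (colLens lam) ∧
  all (all (λ x → (1 ≤ᵇ x) ∧ (x ≤ᵇ n))) T ∧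
  all strictIncr T ∧
  rowsOK T

inS : ∀ {n} → Vec ℕ n → Vec ℕ n → Tableau → Bool
inS lam β T = isSSYT lam T ∧ all (λ C → and (zipWith _≤ᵇ_ C (toList β))) T

content : (n : ℕ) → Tableau → Vec ℕ n
content n T = tabulate (λ k → length (filter (_≡ᵇ suc (toℕ k)) (concat T)))

vecEq : ∀ {n} → Vec ℕ n → Vec ℕ n → Bool
vecEq u v = listEq (toList u) (toList v)

-- all fillings of the shape λ with entries in [n] (a finite enumeration
-- containing 𝒯_λ)
words : ℕ → ℕ → List (List ℕ)
words n zero = [] ∷ []
words n (suc c) = concatMap (λ x → map (x ∷_) (words n c)) (range 1 n)

fillings : ∀ {n} → Vec ℕ n → List Tableau
fillings {n} lam =
  foldr (λ c acc → concatMap (λ col → map (col ∷_) acc) (words n c)) ([] ∷ []) (colLens lam)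

-- coefficient of x^θ in Σ_{T ∈ 𝒯_λ, P T} x^{Θ(T)}
coeff : ∀ {n} → Vec ℕ n → (Tableau → Bool) → Vec ℕ n → ℕ
coeff {n} lam P θ = length (filter (λ T → P T ∧ vecEq (content n T) θ) (fillings lam))

-- Right key K_+(T) (Lascoux–Schützenberger), computed by jeu de taquin
-- column exchanges: the j-th column of K_+(T) is obtained by moving column
-- j of T to the right past columns j+1, j+2, ... by two-column jeu de
-- taquin exchanges and taking the resulting rightmost column.
-- Two-column exchange of a left column A with a right column B
-- (|A| ≥ |B|): match each b ∈ B (increasingly) with the largest still
-- unmatched a ∈ A with a ≤ b; the new right column (length |A|) is
-- B ∪ {unmatched elements of A}.

-- remove the largest element ≤ b from an increasing list
dropLastLE : ℕ → List ℕ → List ℕ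
dropLastLE b [] = []
dropLastLE b (x ∷ xs) =
  if (x ≤ᵇ b) ∧ not (any (_≤ᵇ b) xs) then xs else x ∷ dropLastLE b xs

exchangeRight : ℕ → List ℕ → List ℕ → List ℕ
exchangeRight n A B = sortedSet n (B ++ foldl (λ un b → dropLastLE b un) A B)

Kplus : ℕ → Tableau → Tableau
Kplus n [] = []
Kplus n (C ∷ Cs) = foldl (exchangeRight n) C Cs ∷ Kplus n Cs

Y : ∀ {n} → Vec ℕ n → Vec ℕ n → Tableau
Y {n} lam π =
  map (λ c → if c ≡ᵇ n then range 1 n else sortedSet n (map (π !_) (range 1 c))) (colLens lam)

leqTab : Tableau → Tableau → Bool
leqTab K L = listEq (map length K) (map length L) ∧ and (zipWith (λ C D → and (zipWith _≤ᵇ_ C D)) K L)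

inD : ∀ {n} → Vec ℕ n → Vec ℕ n → Tableau → Bool
inD {n} lam π T = isSSYT lam T ∧ leqTab (Kplus n T) (Y lam π)

maxTab : Tableau → Tableau → Tableau
maxTab = zipWith (zipWith _⊔_)

Q : ∀ {n} → Vec ℕ n → Vec ℕ n → Tableau
Q lam β =
  foldr maxTab (map (λ c → map (λ _ → 0) (range 1 c)) (colLens lam)) (filter (inS lam β) (fillings lam))

SamePoly : ∀ {n} → Vec ℕ n → Vec ℕ n → Vec ℕ n → Vec ℕ n → Set
SamePoly {n} lam β lam' π = ∀ (θ : Vec ℕ n) → coeff lam (inS lam β) θ ≡ coeff lam' (inD lam' π) θ

{-# OPTIONS --safe #-}
module Submission where

-- Both tableau sets have a largest element: Q for the row bounds β, and the key Y for π, since a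
-- tableau lies below its right key and keys are their own right keys.  The content of a tableau
-- counts its entries ≤ k, and these counts reverse the entrywise order.  Hence the common
-- polynomial determines the shape (from the smallest tableau) and forces Q and Y to have the same
-- content; a key is the only tableau of its shape and content, so Q = Y.  Then the Demazure set
-- lies inside the row bound set, and equal coefficients make them equal: the Demazure set is the
-- whole ideal below Y.  A 312 pattern in π would give a tableau below Y whose right key is not
-- below Y, so π avoids 312.  Finally, the columns of Q are the running minima of β_k − (k − i),
-- which the critical indices record; avoidance makes the critical entries weakly increase, and
-- row bounds matter only at critical indices.

open import Defs
open import Data.Bool using (Bool; true; false; _∧_; not; if_then_else_; T)
open import Data.Bool.ListAction using (and; any; all)
open import Data.Bool.Properties using (T-∧; ∧-zeroʳ)
open import Data.Empty using (⊥; ⊥-elim)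
open import Data.Fin using (Fin; toℕ; fromℕ<)
open import Data.Fin.Properties using (toℕ-fromℕ<)
open import Data.List using (List; []; _∷_; _++_; map; length; foldr; foldl; concat; concatMap;
  reverse; zipWith; upTo; applyUpTo; filterᵇ)
import Data.List as L
open import Data.List.Membership.Propositional using (_∈_; _∉_)
open import Data.List.Membership.Propositional.Properties
open import Data.List.Membership.Propositional.Properties.WithK using (unique∧set⇒bag)
open import Data.List.Properties using (∷-injective; unfold-reverse; length-reverse; filter-++;
  length-++; length-applyUpTo; map-upTo; map-∘; map-cong)
open import Data.List.Relation.Binary.BagAndSetEquality using (∼bag⇒↭)
open import Data.List.Relation.Binary.Permutation.Propositional using (_↭_; prep; swap; ↭-trans; ↭-sym; ↭-refl)
open import Data.List.Relation.Binary.Permutation.Propositional.Properties using (↭-length; filter-↭; shift)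
open import Data.List.Relation.Binary.Pointwise as PW using (Pointwise; []; _∷_)
open import Data.List.Relation.Unary.All as All using (All; []; _∷_)
import Data.List.Relation.Unary.All.Properties as Allₚ
open import Data.List.Relation.Unary.AllPairs as AllPairs using (AllPairs; []; _∷_)
import Data.List.Relation.Unary.AllPairs.Properties as AllPairsₚ
open import Data.List.Relation.Unary.Any using (Any; here; there)
import Data.List.Relation.Unary.Any.Properties as Anyₚ
open import Data.List.Relation.Unary.Linked using (Linked; []; [-]; _∷_)
open import Data.List.Relation.Unary.Linked.Properties using (Linked⇒AllPairs; AllPairs⇒Linked)
open import Data.List.Relation.Unary.Unique.Propositional using (Unique)
import Data.List.Relation.Unary.Unique.Propositional.Properties as Uniqueₚ
open import Data.Nat using (ℕ; zero; suc; _+_; _∸_; _≤_; _<_; _≥_; _>_; z≤n; s≤s; _⊔_; _⊓_;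
  _≤ᵇ_; _<ᵇ_; _≡ᵇ_; _≤?_; _<?_)
open import Data.Nat.Properties
open import Data.Nat.Tactic.RingSolver using (solve)
open import Data.Product using (_×_; _,_; proj₁; proj₂; ∃; ∃-syntax)
open import Data.Sum using (_⊎_; inj₁; inj₂)
open import Data.Unit using (tt)
open import Data.Vec using (Vec; tabulate; toList; lookup) renaming ([] to []ᵥ; _∷_ to _∷ᵥ_)
open import Data.Vec.Properties using (lookup∘tabulate; tabulate-cong)
open import Function using (_∘_; id; mk⇔; Equivalence)
open import Relation.Binary.Definitions using (tri<; tri≈; tri>)
open import Relation.Binary.PropositionalEquality using (_≡_; _≢_; refl; sym; trans; cong; cong₂;
  subst; subst₂; module ≡-Reasoning)
open import Relation.Nullary using (¬_; Dec; yes; no)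
open import Relation.Nullary.Decidable using (T?)

-- Counting

-- Equal polynomials match tableaux only up to content, so individual tableaux of the two sets
-- cannot be compared directly. The column order is therefore encoded by counts at every threshold:
-- such counts add up over the columns of a tableau, and the sum depends on the content alone. The
-- same device yields rigidity: when no column can lose and the totals agree, no column has gained.
-- Right keys enter only through the column exchanges, and the decisive property is a converse one:
-- a column that has not grown after passing all columns to its right must contain them. On the side
-- of row bounds, the recursive description of critical indices is replaced by a minimality property
-- of b_k - k, which interacts directly with the minima that make up the largest column.

private variable
  A B : Set

∧⁻ : ∀ {a b} → T (a ∧ b) → T a × T b
∧⁻ = Equivalence.to T-∧

∧⁺ : ∀ {a b} → T a → T b → T (a ∧ b)
∧⁺ p q = Equivalence.from T-∧ (p , q)

T-ext : ∀ {a b} → (T a → T b) → (T b → T a) → a ≡ b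
T-ext {false} {false} f g = refl
T-ext {false} {true}  f g = ⊥-elim (g tt)
T-ext {true}  {false} f g = ⊥-elim (f tt)
T-ext {true}  {true}  f g = refl

T⇒≡ : ∀ {a} → T a → a ≡ true
T⇒≡ {true} _ = refl

≡⇒T : ∀ {a} → a ≡ true → T a
≡⇒T refl = tt

-- Farkas certificates: a linear consequence of A ≤ B reduces to a semiring identity with slack c.
linear : ∀ {A B a b} c → A ≤ B → a + B + c ≡ b + A → a ≤ b
linear {A} {B} {a} {b} c p e = +-cancelʳ-≤ B a b
  (≤-trans (m≤m+n (a + B) c) (≤-trans (≤-reflexive e) (+-monoʳ-≤ b p)))

ind : Bool → ℕ
ind true  = 1
ind false = 0

# : (A → Bool) → List A → ℕ
# p xs = length (filterᵇ p xs)

#-cons : ∀ (p : A → Bool) x xs → # p (x ∷ xs) ≡ ind (p x) + # p xs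
#-cons p x xs with p x
... | true  = refl
... | false = refl

ind-mono : ∀ {a b} → (T a → T b) → ind a ≤ ind b
ind-mono {false} f = z≤n
ind-mono {true} {false} f = ⊥-elim (f tt)
ind-mono {true} {true} f = ≤-refl

ind-true : ∀ {a} → T a → ind a ≡ 1
ind-true {true} _ = refl

ind-false : ∀ {a} → ¬ T a → ind a ≡ 0
ind-false {true} f = ⊥-elim (f tt)
ind-false {false} f = refl

ind-inj : ∀ {a b} → ind b ≤ ind a → T b → T a
ind-inj {true} _ _ = tt
ind-inj {false} {true} () _

#-++ : ∀ (p : A → Bool) xs ys → # p (xs ++ ys) ≡ # p xs + # p ys
#-++ p xs ys = trans (cong length (filter-++ (T? ∘ p) xs ys)) (length-++ (filterᵇ p xs))

#-mono : ∀ (p q : A → Bool) xs → (∀ {x} → x ∈ xs → T (p x) → T (q x)) → # p xs ≤ # q xs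
#-mono p q []       f = z≤n
#-mono p q (x ∷ xs) f rewrite #-cons p x xs | #-cons q x xs =
  +-mono-≤ (ind-mono (f (here refl))) (#-mono p q xs (f ∘ there))

#-cong : ∀ (p q : A → Bool) xs → (∀ {x} → x ∈ xs → p x ≡ q x) → # p xs ≡ # q xs
#-cong p q xs f = ≤-antisym
  (#-mono p q xs (λ m → subst T (f m))) (#-mono q p xs (λ m → subst T (sym (f m))))

+-≤-splitˡ : ∀ {a b c d} → a ≤ c → b ≤ d → c + d ≤ a + b → c ≤ a
+-≤-splitˡ {a} {b} {c} {d} _ q r = +-cancelʳ-≤ d c a (≤-trans r (+-monoʳ-≤ a q))

+-≤-splitʳ : ∀ {a b c d} → a ≤ c → b ≤ d → c + d ≤ a + b → d ≤ b
+-≤-splitʳ {a} {b} {c} {d} p _ r = +-cancelˡ-≤ c d b (≤-trans r (+-monoˡ-≤ b p))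

-- No element can contribute more to the smaller count, so equal totals force equality element by
-- element. This turns equal lengths, and later equal coefficients, into equal sets.
#-saturated : ∀ (p q : A → Bool) xs → (∀ {x} → x ∈ xs → T (p x) → T (q x)) → # q xs ≤ # p xs →
  ∀ {x} → x ∈ xs → T (q x) → T (p x)
#-saturated p q (x ∷ xs) f le m rewrite #-cons p x xs | #-cons q x xs
  with +-≤-splitˡ (ind-mono (f (here refl))) (#-mono p q xs (f ∘ there)) le
     | +-≤-splitʳ (ind-mono (f (here refl))) (#-mono p q xs (f ∘ there)) le
... | hd | tl with m
... | here refl = ind-inj hd
... | there m′  = #-saturated p q xs (f ∘ there) tl m′

-- A pigeonhole principle with an explicit element, used to produce the smallest entry of a 312
-- pattern.
#-witness : ∀ (p q : A → Bool) xs → # q xs < # p xs → ∃[ x ] (x ∈ xs × T (p x) × ¬ T (q x))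
#-witness p q (x ∷ xs) lt rewrite #-cons p x xs | #-cons q x xs with T? (p x) | T? (q x)
... | yes a | no b = x , here refl , a , b
... | yes a | yes b rewrite ind-true a | ind-true b with #-witness p q xs (≤-pred lt)
...   | y , m , r = y , there m , r
#-witness p q (x ∷ xs) lt | no a | _ rewrite ind-false a
  with #-witness p q xs (≤-<-trans (m≤n+m (# q xs) (ind (q x))) lt)
... | y , m , r = y , there m , r

#-pos : ∀ (p : A → Bool) xs → 1 ≤ # p xs → ∃[ x ] (x ∈ xs × T (p x))
#-pos p xs le with filterᵇ p xs in eq
... | y ∷ ys = y , ∈-filter⁻ (T? ∘ p) (subst (y ∈_) (sym eq) (here refl))

#-pos⁺ : ∀ (p : A → Bool) {x xs} → x ∈ xs → T (p x) → 1 ≤ # p xs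
#-pos⁺ p {xs = xs} m t with filterᵇ p xs | ∈-filter⁺ (T? ∘ p) m t
... | _ ∷ _ | _ = s≤s z≤n

#-true : ∀ (xs : List A) → # (λ _ → true) xs ≡ length xs
#-true []       = refl
#-true (x ∷ xs) = cong suc (#-true xs)

#-none : ∀ (p : A → Bool) xs → (∀ {x} → x ∈ xs → ¬ T (p x)) → # p xs ≡ 0
#-none p []       f = refl
#-none p (x ∷ xs) f rewrite #-cons p x xs | ind-false (f (here refl)) = #-none p xs (f ∘ there)

#-all : ∀ (p : A → Bool) xs → (∀ {x} → x ∈ xs → T (p x)) → # p xs ≡ length xs
#-all p xs f = trans (#-cong p (λ _ → true) xs (λ m → T⇒≡ (f m))) (#-true xs)

#≤length : ∀ (p : A → Bool) xs → # p xs ≤ length xs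
#≤length p xs = subst (# p xs ≤_) (#-true xs) (#-mono p (λ _ → true) xs (λ _ _ → tt))

#-full : ∀ (p : A → Bool) xs → length xs ≤ # p xs → ∀ {x} → x ∈ xs → T (p x)
#-full p xs le m =
  #-saturated p (λ _ → true) xs (λ _ _ → tt) (subst (_≤ # p xs) (sym (#-true xs)) le) m tt

#-filter : ∀ (p r : A → Bool) xs → # p (filterᵇ r xs) ≡ # (λ x → r x ∧ p x) xs
#-filter p r [] = refl
#-filter p r (x ∷ xs) with r x
... | false = #-filter p r xs
... | true with p x
...   | true  = cong suc (#-filter p r xs)
...   | false = #-filter p r xs

#-map : ∀ (p : B → Bool) (f : A → B) xs → # p (map f xs) ≡ # (p ∘ f) xs
#-map p f []       = refl
#-map p f (x ∷ xs) rewrite #-cons p (f x) (map f xs) | #-cons (p ∘ f) x xs = cong (ind (p (f x)) +_) (#-map p f xs)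

#-↭ : ∀ (p : A → Bool) {xs ys} → xs ↭ ys → # p xs ≡ # p ys
#-↭ p r = ↭-length (filter-↭ (T? ∘ p) r)

filterᵇ-cong : ∀ (p q : A → Bool) xs → (∀ {x} → x ∈ xs → p x ≡ q x) → filterᵇ p xs ≡ filterᵇ q xs
filterᵇ-cong p q []       f = refl
filterᵇ-cong p q (x ∷ xs) f with p x | q x | f (here refl)
... | true  | _ | refl = cong (x ∷_) (filterᵇ-cong p q xs (f ∘ there))
... | false | _ | refl = filterᵇ-cong p q xs (f ∘ there)

-- Equal multiplicities make the lists permutations of each other. The freedom in `p` matters:
-- content is used both for thresholds and for membership in a key column.
#-determined : ∀ xs ys → (∀ v → # (_≡ᵇ v) xs ≡ # (_≡ᵇ v) ys) → ∀ p → # p xs ≡ # p ys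
#-determined xs ys f p = #-↭ p (perm xs ys f)
  where
  perm : ∀ xs ys → (∀ v → # (_≡ᵇ v) xs ≡ # (_≡ᵇ v) ys) → xs ↭ ys
  perm [] [] f = ↭-refl
  perm [] (y ∷ ys) f with () ← subst (1 ≤_) (sym (f y)) (#-pos⁺ (_≡ᵇ y) {xs = y ∷ ys} (here refl) (≡⇒≡ᵇ y y refl))
  perm (x ∷ xs) ys f
    with #-pos (_≡ᵇ x) ys (subst (1 ≤_) (f x) (#-pos⁺ (_≡ᵇ x) {xs = x ∷ xs} (here refl) (≡⇒≡ᵇ x x refl)))
  ... | y , m , t with ≡ᵇ⇒≡ y x t
  ... | refl with ∈-∃++ m
  ... | as , bs , refl = ↭-trans (prep x (perm xs (as ++ bs) g)) (↭-sym (shift x as bs))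
    where
    g : ∀ v → # (_≡ᵇ v) xs ≡ # (_≡ᵇ v) (as ++ bs)
    g v = +-cancelˡ-≡ (ind (x ≡ᵇ v)) _ _
      (trans (sym (#-cons (_≡ᵇ v) x xs)) (trans (f v)
        (trans (#-↭ (_≡ᵇ v) (shift x as bs)) (#-cons (_≡ᵇ v) x (as ++ bs)))))

#≤-suc : ∀ k xs → # (_≤ᵇ suc k) xs ≡ # (_≤ᵇ k) xs + # (_≡ᵇ suc k) xs
#≤-suc k [] = refl
#≤-suc k (x ∷ xs) rewrite #-cons (_≤ᵇ suc k) x xs | #-cons (_≤ᵇ k) x xs | #-cons (_≡ᵇ suc k) x xs | #≤-suc k xs
  = trans (cong (_+ (# (_≤ᵇ k) xs + # (_≡ᵇ suc k) xs)) step) (assoc (ind (x ≤ᵇ k)) (ind (x ≡ᵇ suc k)) (# (_≤ᵇ k) xs) (# (_≡ᵇ suc k) xs))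
  where
  assoc : ∀ a b c d → a + b + (c + d) ≡ a + c + (b + d)
  assoc a b c d = solve (a L.∷ b L.∷ c L.∷ d L.∷ L.[])
  step : ind (x ≤ᵇ suc k) ≡ ind (x ≤ᵇ k) + ind (x ≡ᵇ suc k)
  step with <-cmp x (suc k)
  ... | tri< lt ne _ rewrite ind-true (≤⇒≤ᵇ (<⇒≤ lt)) | ind-true (≤⇒≤ᵇ (≤-pred lt)) | ind-false (ne ∘ ≡ᵇ⇒≡ x (suc k)) = refl
  ... | tri≈ _ refl _ rewrite ind-true (≤⇒≤ᵇ (≤-refl {suc k})) | ind-false {suc k ≤ᵇ k} (1+n≰n ∘ ≤ᵇ⇒≤ (suc k) k) | ind-true (≡⇒≡ᵇ k k refl) = refl
  ... | tri> _ ne gt rewrite ind-false {x ≤ᵇ suc k} (<⇒≱ gt ∘ ≤ᵇ⇒≤ x (suc k)) | ind-false {x ≤ᵇ k} (<⇒≱ (<-trans (n<1+n k) gt) ∘ ≤ᵇ⇒≤ x k) | ind-false (ne ∘ ≡ᵇ⇒≡ x (suc k)) = refl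

#≤-determines-#≡ : ∀ xs ys → (∀ k → # (_≤ᵇ k) xs ≡ # (_≤ᵇ k) ys) → ∀ v → # (_≡ᵇ v) xs ≡ # (_≡ᵇ v) ys
#≤-determines-#≡ xs ys f zero = trans (zero≡ xs) (trans (f 0) (sym (zero≡ ys)))
  where
  zero≡ : ∀ xs → # (_≡ᵇ 0) xs ≡ # (_≤ᵇ 0) xs
  zero≡ xs = #-cong (_≡ᵇ 0) (_≤ᵇ 0) xs (λ { {zero} _ → refl ; {suc x} _ → refl })
#≤-determines-#≡ xs ys f (suc k) = +-cancelˡ-≡ (# (_≤ᵇ k) xs) _ _
  (trans (sym (#≤-suc k xs)) (trans (f (suc k)) (trans (#≤-suc k ys) (cong (_+ # (_≡ᵇ suc k) ys) (sym (f k))))))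

-- Columns and column exchange

Sorted : List ℕ → Set
Sorted = AllPairs _<_

record Column (n : ℕ) (C : List ℕ) : Set where
  constructor column
  field
    sorted : Sorted C
    within : ∀ {x} → x ∈ C → 1 ≤ x × x ≤ n
open Column

sorted⇒unique : ∀ {xs} → Sorted xs → Unique xs
sorted⇒unique = AllPairs.map <⇒≢

∈-range⁺ : ∀ {n x} → 1 ≤ x → x ≤ n → x ∈ range 1 n
∈-range⁺ {x = suc x} _ le = ∈-map⁺ suc (∈-upTo⁺ le)

∈-range⁻ : ∀ {n x} → x ∈ range 1 n → 1 ≤ x × x ≤ n
∈-range⁻ m with ∈-map⁻ suc m
... | y , m′ , refl = s≤s z≤n , ∈-upTo⁻ m′

map-range : ∀ {A : Set} (f : ℕ → A) n → map f (range 1 n) ≡ applyUpTo (f ∘ suc) n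
map-range f n = trans (sym (map-∘ (upTo n))) (map-upTo (f ∘ suc) n)

length-map-range : ∀ {A : Set} (f : ℕ → A) n → length (map f (range 1 n)) ≡ n
length-map-range f n = trans (cong length (map-range f n)) (length-applyUpTo (f ∘ suc) n)

sorted-map-range : ∀ (f : ℕ → ℕ) n → (∀ i j → 1 ≤ i → i < j → j ≤ n → f i < f j) → Sorted (map f (range 1 n))
sorted-map-range f n g = subst Sorted (sym (map-range f n))
  (AllPairsₚ.applyUpTo⁺₁ (f ∘ suc) n (λ i<j j<n → g _ _ (s≤s z≤n) (s≤s i<j) j<n))

range≡applyUpTo : ∀ n → range 1 n ≡ applyUpTo suc n
range≡applyUpTo n = map-upTo suc n

sorted-range : ∀ n → Sorted (range 1 n)
sorted-range n = subst Sorted (sym (range≡applyUpTo n))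
  (AllPairsₚ.applyUpTo⁺₁ suc n (λ i<j _ → s≤s i<j))

length-range : ∀ n → length (range 1 n) ≡ n
length-range n = trans (cong length (range≡applyUpTo n)) (length-applyUpTo suc n)

range-column : ∀ {n c} → c ≤ n → Column n (range 1 c)
range-column le = column (sorted-range _) (λ m → proj₁ (∈-range⁻ m) , ≤-trans (proj₂ (∈-range⁻ m)) le)

∈ᵇ⇒∈ : ∀ {k xs} → T (k ∈ᵇ xs) → k ∈ xs
∈ᵇ⇒∈ {k} {xs} t = All⇒ (Anyₚ.any⁻ (_≡ᵇ k) xs t)
  where
  All⇒ : ∀ {xs} → Any (T ∘ (_≡ᵇ k)) xs → k ∈ xs
  All⇒ (here p)  = here (sym (≡ᵇ⇒≡ _ k p))
  All⇒ (there p) = there (All⇒ p)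

∈⇒∈ᵇ : ∀ {k xs} → k ∈ xs → T (k ∈ᵇ xs)
∈⇒∈ᵇ {k} m = Anyₚ.any⁺ (_≡ᵇ k) (⇒Any m)
  where
  ⇒Any : ∀ {xs} → k ∈ xs → Any (T ∘ (_≡ᵇ k)) xs
  ⇒Any (here refl) = here (≡⇒≡ᵇ k k refl)
  ⇒Any (there m)   = there (⇒Any m)

∈-sortedSet⁺ : ∀ {n v xs} → 1 ≤ v → v ≤ n → v ∈ xs → v ∈ sortedSet n xs
∈-sortedSet⁺ p q m = ∈-filter⁺ (T? ∘ _) (∈-range⁺ p q) (∈⇒∈ᵇ m)

∈-sortedSet⁻ : ∀ {n v xs} → v ∈ sortedSet n xs → v ∈ xs
∈-sortedSet⁻ {n} {v} {xs} m = ∈ᵇ⇒∈ (proj₂ (∈-filter⁻ (T? ∘ (λ k → k ∈ᵇ xs)) {xs = range 1 n} m))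

sortedSet-column : ∀ n xs → Column n (sortedSet n xs)
sortedSet-column n xs = column (AllPairsₚ.filter⁺ (T? ∘ (_∈ᵇ xs)) (sorted-range n))
  (λ m → ∈-range⁻ (proj₁ (∈-filter⁻ (T? ∘ (_∈ᵇ xs)) {xs = range 1 n} m)))

-- Duplicate-free lists with the same members are permutations of each other, so counts in a sorted
-- column can be computed on any list of its members.
sortedSet-↭ : ∀ {n xs} → Unique xs → (∀ {x} → x ∈ xs → 1 ≤ x × x ≤ n) → sortedSet n xs ↭ xs
sortedSet-↭ {n} {xs} u w = ∼bag⇒↭ (unique∧set⇒bag (sorted⇒unique (sorted (sortedSet-column n xs))) u
  (mk⇔ (∈-sortedSet⁻ {n}) (λ m → ∈-sortedSet⁺ (proj₁ (w m)) (proj₂ (w m)) m)))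

-- For strictly increasing columns, _⊒_ says that A is at least as long as B and A ≤ B row by row.
infix 4 _⊒_
record _⊒_ (A B : List ℕ) : Set where
  constructor ⊒⁺
  field count≤ : ∀ v → # (_≤ᵇ v) B ≤ # (_≤ᵇ v) A
open _⊒_

⊒-refl : ∀ {A} → A ⊒ A
⊒-refl = ⊒⁺ λ _ → ≤-refl

⊒-trans : ∀ {A B C} → A ⊒ B → B ⊒ C → A ⊒ C
⊒-trans p q = ⊒⁺ λ v → ≤-trans (count≤ q v) (count≤ p v)

zip⇒⊒ : ∀ A B → length B ≤ length A → T (and (zipWith _≤ᵇ_ A B)) → A ⊒ B
zip⇒⊒ A [] _ _ = ⊒⁺ λ _ → z≤n
zip⇒⊒ (a ∷ A) (b ∷ B) le t = ⊒⁺ λ v → subst₂ _≤_ (sym (#-cons (_≤ᵇ v) b B)) (sym (#-cons (_≤ᵇ v) a A))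
  (+-mono-≤ (ind-mono (λ b≤v → ≤⇒≤ᵇ (≤-trans (≤ᵇ⇒≤ a b (proj₁ (∧⁻ t))) (≤ᵇ⇒≤ b v b≤v))))
            (count≤ (zip⇒⊒ A B (≤-pred le) (proj₂ (∧⁻ {a ≤ᵇ b} t))) v))

#≤-below : ∀ {x xs v} → All (x <_) xs → v ≤ x → # (_≤ᵇ v) xs ≡ 0
#≤-below {xs = xs} {v} a le = #-none (_≤ᵇ v) xs (λ m t → <⇒≱ (All.lookup a m) (≤-trans (≤ᵇ⇒≤ _ v t) le))

-- The threshold b forces the smallest entry on the left down to b. For the tails, both sides lose
-- one at thresholds from b on, and below b the right tail counts nothing.
⊒-uncons : ∀ {a A b B} → Sorted (a ∷ A) → Sorted (b ∷ B) → a ∷ A ⊒ b ∷ B → a ≤ b × A ⊒ B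
⊒-uncons {a} {A} {b} {B} (sa ∷ _) (sb ∷ _) d = a≤b , tl
  where
  a≤b : a ≤ b
  a≤b with a ≤? b
  ... | yes p = p
  ... | no ¬p = ⊥-elim (1+n≰n (≤-trans (#-pos⁺ (_≤ᵇ b) {xs = b ∷ B} (here refl) (≤⇒≤ᵇ (≤-refl {b})))
      (≤-trans (count≤ d b) (≤-reflexive (#-none (_≤ᵇ b) (a ∷ A) none)))))
    where
    none : ∀ {x} → x ∈ a ∷ A → ¬ T (x ≤ᵇ b)
    none (here refl) t = ¬p (≤ᵇ⇒≤ a b t)
    none (there m)   t = ¬p (≤-trans (<⇒≤ (All.lookup sa m)) (≤ᵇ⇒≤ _ b t))
  tl : A ⊒ B
  count≤ tl v with b ≤? v
  ... | no ¬p = subst (_≤ _) (sym (#≤-below sb (<⇒≤ (≰⇒> ¬p)))) z≤n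
  ... | yes p = +-cancelˡ-≤ 1 _ _ (subst₂ _≤_ (step b B p) (step a A (≤-trans a≤b p)) (count≤ d v))
    where
    step : ∀ x xs → x ≤ v → # (_≤ᵇ v) (x ∷ xs) ≡ 1 + # (_≤ᵇ v) xs
    step x xs le = trans (#-cons (_≤ᵇ v) x xs) (cong (_+ _) (ind-true (≤⇒≤ᵇ le)))

[]⊒-impossible : ∀ {b B} → ¬ [] ⊒ b ∷ B
[]⊒-impossible {b} {B} d = 1+n≰n (≤-trans (#-pos⁺ (_≤ᵇ b) {xs = b ∷ B} (here refl) (≤⇒≤ᵇ (≤-refl {b}))) (count≤ d b))

⊒⇒zip : ∀ {A B} → Sorted A → Sorted B → A ⊒ B → T (and (zipWith _≤ᵇ_ A B))
⊒⇒zip {[]} _ _ _ = tt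
⊒⇒zip {_ ∷ _} {[]} _ _ _ = tt
⊒⇒zip {a ∷ A} {b ∷ B} sa sb d with ⊒-uncons sa sb d | sa | sb
... | le , d′ | _ ∷ sa′ | _ ∷ sb′ = ∧⁺ (≤⇒≤ᵇ le) (⊒⇒zip sa′ sb′ d′)

⊒-antisym : ∀ {A B} → Sorted A → Sorted B → A ⊒ B → B ⊒ A → A ≡ B
⊒-antisym {[]} {[]} _ _ _ _ = refl
⊒-antisym {[]} {b ∷ B} _ _ d _ = ⊥-elim ([]⊒-impossible d)
⊒-antisym {a ∷ A} {[]} _ _ _ e = ⊥-elim ([]⊒-impossible e)
⊒-antisym {a ∷ A} {b ∷ B} sa sb d e with ⊒-uncons sa sb d | ⊒-uncons sb sa e | sa | sb
... | le , d′ | ge , e′ | _ ∷ sa′ | _ ∷ sb′ = cong₂ _∷_ (≤-antisym le ge) (⊒-antisym sa′ sb′ d′ e′)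

sortedSet-id : ∀ {n C} → Column n C → sortedSet n C ≡ C
sortedSet-id {n} {C} c = ⊒-antisym (sorted (sortedSet-column n C)) (sorted c)
  (⊒⁺ λ v → ≤-reflexive (sym (eq v))) (⊒⁺ λ v → ≤-reflexive (eq v))
  where
  eq : ∀ v → # (_≤ᵇ v) (sortedSet n C) ≡ # (_≤ᵇ v) C
  eq v = #-↭ (_≤ᵇ v) (sortedSet-↭ (sorted⇒unique (sorted c)) (within c))

⊆-column-≡ : ∀ {n A B} → Column n A → Column n B → (∀ {x} → x ∈ A → x ∈ B) → length B ≤ length A → A ≡ B
⊆-column-≡ {n} {A} {B} a b sub le =
  trans (sym (sortedSet-id a)) (trans (filterᵇ-cong (_∈ᵇ A) (_∈ᵇ B) (range 1 n) same) (sortedSet-id b))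
  where
  le′ : # (_∈ᵇ B) (range 1 n) ≤ # (_∈ᵇ A) (range 1 n)
  le′ = subst₂ _≤_ (sym (cong length (sortedSet-id b))) (sym (cong length (sortedSet-id a))) le
  incl : ∀ {x} → x ∈ range 1 n → T (x ∈ᵇ A) → T (x ∈ᵇ B)
  incl _ t = ∈⇒∈ᵇ (sub (∈ᵇ⇒∈ t))
  same : ∀ {x} → x ∈ range 1 n → (x ∈ᵇ A) ≡ (x ∈ᵇ B)
  same m = T-ext (incl m) (#-saturated (_∈ᵇ A) (_∈ᵇ B) (range 1 n) incl le′ m)

full-column : ∀ {n C} → Column n C → length C ≡ n → C ≡ range 1 n
full-column {n} c e = ⊆-column-≡ c (range-column ≤-refl) (λ m → ∈-range⁺ (proj₁ (within c m)) (proj₂ (within c m)))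
  (≤-reflexive (trans (length-range n) (sym e)))

any-none : ∀ {b xs} → any (_≤ᵇ b) xs ≡ false → ∀ {x} → x ∈ xs → b < x
any-none {b} {xs} e {x} m with x ≤? b
... | no ¬p = ≰⇒> ¬p
... | yes p = ⊥-elim (subst T e (Anyₚ.any⁺ (_≤ᵇ b) (go m)))
  where
  go : ∀ {ys} → x ∈ ys → Any (T ∘ (_≤ᵇ b)) ys
  go (here refl) = here (≤⇒≤ᵇ p)
  go (there m)   = there (go m)

any-some : ∀ {b xs} → any (_≤ᵇ b) xs ≡ true → ∃[ y ] (y ∈ xs × y ≤ b)
any-some {b} {xs} e = go (Anyₚ.any⁻ (_≤ᵇ b) xs (≡⇒T e))
  where
  go : ∀ {ys} → Any (T ∘ (_≤ᵇ b)) ys → ∃[ y ] (y ∈ ys × y ≤ b)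
  go (here t) = _ , here refl , ≤ᵇ⇒≤ _ b t
  go (there a) with go a
  ... | y , m , le = y , there m , le

-- `a` is the element dropped. `b∉` holds because the largest element at most b is dropped, so b
-- itself if it occurs; this keeps the exchanged column free of repetitions.
record Dropped (b : ℕ) (xs ys : List ℕ) : Set where
  field
    a      : ℕ
    a≤b    : a ≤ b
    perm   : xs ↭ a ∷ ys
    sub    : ∀ {x} → x ∈ ys → x ∈ xs
    sorted : Sorted ys
    b∉     : b ∉ ys

dropLastLE-spec : ∀ b {xs} → Sorted xs → (∃[ y ] (y ∈ xs × y ≤ b)) → Dropped b xs (dropLastLE b xs)
dropLastLE-spec b {[]} _ (_ , () , _)
dropLastLE-spec b {x ∷ xs} (sx ∷ s) (y , m , y≤b) with any (_≤ᵇ b) xs in e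
-- A later element is still at most b, so the test on x fails and x stays.
... | true rewrite ∧-zeroʳ (x ≤ᵇ b) = record
  { a = D.a ; a≤b = D.a≤b
  ; perm = ↭-trans (prep x D.perm) (swap x D.a ↭-refl)
  ; sub = λ { (here p) → here p ; (there m) → there (D.sub m) }
  ; sorted = All.tabulate (λ m → All.lookup sx (D.sub m)) ∷ D.sorted
  ; b∉ = λ { (here refl) → <⇒≱ (All.lookup sx (proj₁ (proj₂ z))) (proj₂ (proj₂ z)) ; (there m) → D.b∉ m } }
  where
  z = any-some {b} {xs} e
  module D = Dropped (dropLastLE-spec b s z)
... | false with x ≤ᵇ b in e′
...   | true = record { a = x ; a≤b = ≤ᵇ⇒≤ x b (≡⇒T e′) ; perm = ↭-refl ; sub = there ; sorted = s
                      ; b∉ = λ m → <-irrefl refl (any-none e m) }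
...   | false with m
...     | here refl = ⊥-elim (subst T e′ (≤⇒≤ᵇ y≤b))
...     | there m′  = ⊥-elim (<⇒≱ (any-none e m′) y≤b)

-- `dominate` is the matching seen through counts: each element of A that was matched lies weakly
-- below its partner in B, so replacing it by the partner cannot raise any count.
record Unmatched (A B U : List ℕ) : Set where
  field
    sub      : ∀ {x} → x ∈ U → x ∈ A
    sorted   : Sorted U
    len      : length U + length B ≡ length A
    dominate : ∀ v → # (_≤ᵇ v) U + # (_≤ᵇ v) B ≤ # (_≤ᵇ v) A
    disjoint : ∀ {x} → x ∈ U → x ∉ B

-- Treating B in increasing order makes the greedy choice safe: below b the rest of B counts
-- nothing, and from b on both sides lose exactly one, so domination survives each removal and a
-- partner always exists.
unmatched-spec : ∀ {A B} → Sorted A → Sorted B → A ⊒ B → Unmatched A B (foldl (λ un b → dropLastLE b un) A B)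
unmatched-spec {A} {[]} sa _ d = record
  { sub = id ; sorted = sa ; len = +-identityʳ _ ; dominate = λ v → ≤-reflexive (+-identityʳ _) ; disjoint = λ _ () }
unmatched-spec {A} {b ∷ B} sa (sb ∷ sB) d = record
  { sub = D.sub ∘ U.sub ; sorted = U.sorted
  ; len = trans (+-suc _ _) (trans (cong suc U.len) (sym (↭-length D.perm)))
  ; dominate = dom
  ; disjoint = λ { m (here refl) → D.b∉ (U.sub m) ; m (there m′) → U.disjoint m m′ } }
  where
  first : ∃[ y ] (y ∈ A × T (y ≤ᵇ b)) → ∃[ y ] (y ∈ A × y ≤ b)
  first (y , m , t) = y , m , ≤ᵇ⇒≤ y b t
  module D = Dropped (dropLastLE-spec b sa (first (#-pos (_≤ᵇ b) A
      (≤-trans (#-pos⁺ (_≤ᵇ b) {xs = b ∷ B} (here refl) (≤⇒≤ᵇ (≤-refl {b}))) (count≤ d b)))))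
  A₁ = dropLastLE b A
  count : ∀ v → # (_≤ᵇ v) A ≡ ind (D.a ≤ᵇ v) + # (_≤ᵇ v) A₁
  count v = trans (#-↭ (_≤ᵇ v) D.perm) (#-cons (_≤ᵇ v) D.a A₁)
  d₁ : A₁ ⊒ B
  count≤ d₁ v with b ≤? v
  ... | no ¬p = subst (_≤ _) (sym (#≤-below sb (<⇒≤ (≰⇒> ¬p)))) z≤n
  ... | yes p = +-cancelˡ-≤ 1 _ _ (subst₂ _≤_ (trans (#-cons (_≤ᵇ v) b B) (cong (_+ _) (ind-true (≤⇒≤ᵇ p))))
      (trans (count v) (cong (_+ _) (ind-true (≤⇒≤ᵇ (≤-trans D.a≤b p))))) (count≤ d v))
  module U = Unmatched (unmatched-spec D.sorted sB d₁)
  Uₗ = foldl (λ un b → dropLastLE b un) A₁ B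
  dom : ∀ v → # (_≤ᵇ v) Uₗ + # (_≤ᵇ v) (b ∷ B) ≤ # (_≤ᵇ v) A
  dom v rewrite #-cons (_≤ᵇ v) b B | count v = subst (_≤ ind (D.a ≤ᵇ v) + # (_≤ᵇ v) A₁)
    (swap-+ (ind (b ≤ᵇ v)) (# (_≤ᵇ v) Uₗ) (# (_≤ᵇ v) B))
    (+-mono-≤ (ind-mono (λ t → ≤⇒≤ᵇ (≤-trans D.a≤b (≤ᵇ⇒≤ b v t)))) (U.dominate v))
    where
    swap-+ : ∀ x y z → x + (y + z) ≡ y + (x + z)
    swap-+ x y z = solve (x L.∷ y L.∷ z L.∷ L.[])

record Exchanged (n : ℕ) (A B E : List ℕ) : Set where
  field
    col    : Column n E
    len    : length E ≡ length A
    above  : A ⊒ E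
    below  : E ⊒ B
    ⊇right : ∀ {x} → x ∈ B → x ∈ E
    ⊆union : ∀ {x} → x ∈ E → x ∈ A ⊎ x ∈ B

exchange-spec : ∀ {n A B} → Column n A → Column n B → A ⊒ B → Exchanged n A B (exchangeRight n A B)
exchange-spec {n} {A} {B} ca cb d = record
  { col = sortedSet-column n (B ++ Uₗ)
  ; len = trans (↭-length perm) (trans (length-++ B) (trans (+-comm (length B) _) U.len))
  ; above = ⊒⁺ λ v → subst (_≤ # (_≤ᵇ v) A) (sym (count v)) (subst (_≤ # (_≤ᵇ v) A) (+-comm (# (_≤ᵇ v) Uₗ) _) (U.dominate v))
  ; below = ⊒⁺ λ v → subst (# (_≤ᵇ v) B ≤_) (sym (count v)) (m≤m+n _ _)
  ; ⊇right = λ m → ∈-sortedSet⁺ (proj₁ (within cb m)) (proj₂ (within cb m)) (∈-++⁺ˡ m)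
  ; ⊆union = λ m → union (∈-++⁻ B (∈-sortedSet⁻ {n} m)) }
  where
  module U = Unmatched (unmatched-spec (sorted ca) (sorted cb) d)
  Uₗ = foldl (λ un b → dropLastLE b un) A B
  union : ∀ {x} → x ∈ B ⊎ x ∈ Uₗ → x ∈ A ⊎ x ∈ B
  union (inj₁ m) = inj₂ m
  union (inj₂ m) = inj₁ (U.sub m)
  win : ∀ {x} → x ∈ B ++ Uₗ → 1 ≤ x × x ≤ n
  win m with ∈-++⁻ B m
  ... | inj₁ m′ = within cb m′
  ... | inj₂ m′ = within ca (U.sub m′)
  perm : sortedSet n (B ++ Uₗ) ↭ B ++ Uₗ
  perm = sortedSet-↭ (Uniqueₚ.++⁺ (sorted⇒unique (sorted cb)) (sorted⇒unique U.sorted) (λ (m , m′) → U.disjoint m′ m)) win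
  count : ∀ v → # (_≤ᵇ v) (sortedSet n (B ++ Uₗ)) ≡ # (_≤ᵇ v) B + # (_≤ᵇ v) Uₗ
  count v = trans (#-↭ (_≤ᵇ v) perm) (#-++ (_≤ᵇ v) B Uₗ)

-- The exchanged column lies in the union of the two and keeps the length of A.
exchange-⊆ : ∀ {n A B} → Column n A → Column n B → A ⊒ B → (∀ {x} → x ∈ B → x ∈ A) → exchangeRight n A B ≡ A
exchange-⊆ {n} {A} {B} ca cb d sub = ⊆-column-≡ E.col ca incl (≤-reflexive (sym E.len))
  where
  module E = Exchanged (exchange-spec ca cb d)
  incl : ∀ {x} → x ∈ exchangeRight n A B → x ∈ A
  incl m with E.⊆union m
  ... | inj₁ m′ = m′
  ... | inj₂ m′ = sub m′

-- Tableaux and right keys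

listEq⇒≡ : ∀ xs ys → T (listEq xs ys) → xs ≡ ys
listEq⇒≡ [] [] _ = refl
listEq⇒≡ (x ∷ xs) (y ∷ ys) t = cong₂ _∷_ (≡ᵇ⇒≡ x y (proj₁ (∧⁻ t))) (listEq⇒≡ xs ys (proj₂ (∧⁻ {x ≡ᵇ y} t)))

listEq-refl : ∀ xs → T (listEq xs xs)
listEq-refl [] = tt
listEq-refl (x ∷ xs) = ∧⁺ (≡⇒≡ᵇ x x refl) (listEq-refl xs)

≡⇒listEq : ∀ {xs ys} → xs ≡ ys → T (listEq xs ys)
≡⇒listEq {xs} refl = listEq-refl xs

strictIncr⇒sorted : ∀ C → T (strictIncr C) → Sorted C
strictIncr⇒sorted C t = Linked⇒AllPairs <-trans (go C t)
  where
  go : ∀ C → T (strictIncr C) → Linked _<_ C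
  go [] _ = []
  go (x ∷ []) _ = [-]
  go (x ∷ y ∷ C) t = <ᵇ⇒< x y (proj₁ (∧⁻ t)) ∷ go (y ∷ C) (proj₂ (∧⁻ {x <ᵇ y} t))

sorted⇒strictIncr : ∀ {C} → Sorted C → T (strictIncr C)
sorted⇒strictIncr [] = tt
sorted⇒strictIncr {_ ∷ []} (_ ∷ _) = tt
sorted⇒strictIncr {_ ∷ _ ∷ _} ((lt ∷ _) ∷ s) = ∧⁺ (<⇒<ᵇ lt) (sorted⇒strictIncr s)

-- The row condition is kept for all pairs of columns, not only neighbours, because a column travels
-- past everything to its right.
record SSYT (n : ℕ) (cs : List ℕ) (S : Tableau) : Set where
  constructor ssyt
  field
    lens  : map length S ≡ cs
    cols  : All (Column n) S
    chain : AllPairs _⊒_ S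

colLen-antitone : ∀ {n} (lam : Vec ℕ n) {i j} → i ≤ j → colLen lam j ≤ colLen lam i
colLen-antitone {n} lam {i} {j} le =
  #-mono (λ k → j ≤ᵇ lam ! k) (λ k → i ≤ᵇ lam ! k) (range 1 n)
    (λ {k} _ t → ≤⇒≤ᵇ (≤-trans le (≤ᵇ⇒≤ j (lam ! k) t)))

colLens-decreasing : ∀ {n} (lam : Vec ℕ n) → AllPairs _≥_ (colLens lam)
colLens-decreasing lam = subst (AllPairs _≥_) (sym (map-range (colLen lam) (lam ! 1)))
  (AllPairsₚ.applyUpTo⁺₁ _ (lam ! 1) (λ i<j _ → colLen-antitone lam (s≤s (<⇒≤ i<j))))

rowsOK⇒chain : ∀ S → AllPairs _≥_ (map length S) → T (rowsOK S) → AllPairs _⊒_ S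
rowsOK⇒chain S d t = Linked⇒AllPairs ⊒-trans (go S d t)
  where
  go : ∀ S → AllPairs _≥_ (map length S) → T (rowsOK S) → Linked _⊒_ S
  go [] _ _ = []
  go (_ ∷ []) _ _ = [-]
  go (C ∷ D ∷ S) ((ge ∷ _) ∷ d) t =
    zip⇒⊒ C D ge (proj₁ (∧⁻ t)) ∷ go (D ∷ S) d (proj₂ (∧⁻ {and (zipWith _≤ᵇ_ C D)} t))

chain⇒rowsOK : ∀ {n S} → All (Column n) S → AllPairs _⊒_ S → T (rowsOK S)
chain⇒rowsOK {S = []} _ _ = tt
chain⇒rowsOK {S = _ ∷ []} _ _ = tt
chain⇒rowsOK {S = _ ∷ _ ∷ _} (c ∷ d ∷ cs) ((le ∷ _) ∷ ch) =
  ∧⁺ (⊒⇒zip (sorted c) (sorted d) le) (chain⇒rowsOK (d ∷ cs) ch)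

isSSYT⇒SSYT : ∀ {n} (lam : Vec ℕ n) S → T (isSSYT lam S) → SSYT n (colLens lam) S
isSSYT⇒SSYT {n} lam S t = ssyt lens (All.zipWith mk (Allₚ.all⁺ _ S (proj₁ t₂) , Allₚ.all⁺ strictIncr S (proj₁ t₃)))
    (rowsOK⇒chain S (subst (AllPairs _≥_) (sym lens) (colLens-decreasing lam)) (proj₂ t₃))
  where
  t₁ = ∧⁻ {listEq (map length S) (colLens lam)} t
  t₂ = ∧⁻ {all (all (λ x → (1 ≤ᵇ x) ∧ (x ≤ᵇ n))) S} (proj₂ t₁)
  t₃ = ∧⁻ {all strictIncr S} (proj₂ t₂)
  lens = listEq⇒≡ _ _ (proj₁ t₁)
  mk : ∀ {C} → T (all (λ x → (1 ≤ᵇ x) ∧ (x ≤ᵇ n)) C) × T (strictIncr C) → Column n C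
  mk {C} (a , s) = column (strictIncr⇒sorted C s) (λ {x} m → bounds (All.lookup (Allₚ.all⁺ _ C a) m))
    where
    bounds : ∀ {x} → T ((1 ≤ᵇ x) ∧ (x ≤ᵇ n)) → 1 ≤ x × x ≤ n
    bounds {x} u = ≤ᵇ⇒≤ 1 x (proj₁ (∧⁻ {1 ≤ᵇ x} u)) , ≤ᵇ⇒≤ x n (proj₂ (∧⁻ {1 ≤ᵇ x} u))

SSYT⇒isSSYT : ∀ {n} (lam : Vec ℕ n) {S} → SSYT n (colLens lam) S → T (isSSYT lam S)
SSYT⇒isSSYT {n} lam {S} (ssyt l c ch) = ∧⁺ (≡⇒listEq l) (∧⁺ (Allₚ.all⁻ _ (All.map rng c))
    (∧⁺ (Allₚ.all⁻ strictIncr (All.map (sorted⇒strictIncr ∘ sorted) c)) (chain⇒rowsOK c ch)))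
  where
  rng : ∀ {C} → Column n C → T (all (λ x → (1 ≤ᵇ x) ∧ (x ≤ᵇ n)) C)
  rng cl = Allₚ.all⁻ _ (All.tabulate (λ m → ∧⁺ (≤⇒≤ᵇ (proj₁ (within cl m))) (≤⇒≤ᵇ (proj₂ (within cl m)))))

leqTab⇒⊒ : ∀ K L → T (leqTab K L) → Pointwise _⊒_ K L
leqTab⇒⊒ K L t = go K L (listEq⇒≡ _ _ (proj₁ (∧⁻ t))) (proj₂ (∧⁻ {listEq (map length K) (map length L)} t))
  where
  go : ∀ K L → map length K ≡ map length L → T (and (zipWith (λ C D → and (zipWith _≤ᵇ_ C D)) K L)) → Pointwise _⊒_ K L
  go [] [] _ _ = []
  go (C ∷ K) (D ∷ L) e t = zip⇒⊒ C D (≤-reflexive (sym (proj₁ (∷-injective e)))) (proj₁ (∧⁻ t))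
    ∷ go K L (proj₂ (∷-injective e)) (proj₂ (∧⁻ {and (zipWith _≤ᵇ_ C D)} t))

⊒⇒leqTab : ∀ {n K L} → map length K ≡ map length L → All (Column n) K → All (Column n) L →
  Pointwise _⊒_ K L → T (leqTab K L)
⊒⇒leqTab e ck cl pw = ∧⁺ (≡⇒listEq e) (go ck cl pw)
  where
  go : ∀ {n K L} → All (Column n) K → All (Column n) L → Pointwise _⊒_ K L →
    T (and (zipWith (λ C D → and (zipWith _≤ᵇ_ C D)) K L))
  go _ _ [] = tt
  go (c ∷ cs) (d ∷ ds) (p ∷ ps) = ∧⁺ (⊒⇒zip (sorted c) (sorted d) p) (go cs ds ps)

record Pushed (n : ℕ) (A : List ℕ) (Cs : Tableau) (R : List ℕ) : Set where
  field
    col    : Column n R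
    len    : length R ≡ length A
    above  : A ⊒ R
    absorb : R ⊒ A → ∀ {C x} → C ∈ Cs → x ∈ C → x ∈ A

-- Entries of the travelling column only grow. If it ends no larger than A, every intermediate
-- column is squeezed to A, and each of them contains the column just passed; hence `absorb`.
push-spec : ∀ {n A Cs} → Column n A → All (Column n) Cs → All (A ⊒_) Cs → AllPairs _⊒_ Cs →
  Pushed n A Cs (foldl (exchangeRight n) A Cs)
push-spec {Cs = []} ca _ _ _ = record { col = ca ; len = refl ; above = ⊒-refl ; absorb = λ { _ () } }
push-spec {n} {A} {B ∷ Cs} ca (cb ∷ cs) (d ∷ _) (dB ∷ ch) = record
  { col = R.col ; len = trans R.len E.len ; above = ⊒-trans E.above R.above ; absorb = abs }
  where
  module E = Exchanged (exchange-spec ca cb d)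
  module R = Pushed (push-spec E.col cs (All.map (⊒-trans E.below) dB) ch)
  abs : foldl (exchangeRight n) A (B ∷ Cs) ⊒ A → ∀ {C x} → C ∈ B ∷ Cs → x ∈ C → x ∈ A
  abs r {C} {x} m mx = subst (x ∈_) E≡A (member m)
    where
    E≡A : exchangeRight n A B ≡ A
    E≡A = ⊒-antisym (sorted E.col) (sorted ca) (⊒-trans R.above r) E.above
    member : C ∈ B ∷ Cs → x ∈ exchangeRight n A B
    member (here refl) = E.⊇right mx
    member (there m′)  = R.absorb (⊒-trans r E.above) m′ mx

record KeyAbove (n : ℕ) (S : Tableau) : Set where
  field
    cols  : All (Column n) (Kplus n S)
    lens  : map length (Kplus n S) ≡ map length S
    above : Pointwise _⊒_ S (Kplus n S)

Kplus-spec : ∀ {n S} → All (Column n) S → AllPairs _⊒_ S → KeyAbove n S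
Kplus-spec [] [] = record { cols = [] ; lens = refl ; above = [] }
Kplus-spec (c ∷ cs) (d ∷ ch) = record
  { cols = P.col ∷ K.cols ; lens = cong₂ _∷_ P.len K.lens ; above = P.above ∷ K.above }
  where
  module P = Pushed (push-spec c cs d ch)
  module K = KeyAbove (Kplus-spec cs ch)

push-nested : ∀ {n A Cs} → Column n A → All (Column n) Cs → All (A ⊒_) Cs →
  All (λ C → ∀ {x} → x ∈ C → x ∈ A) Cs → foldl (exchangeRight n) A Cs ≡ A
push-nested _ [] [] [] = refl
push-nested {n} {A} {B ∷ Cs} ca (cb ∷ cs) (d ∷ ds) (s ∷ ss) =
  trans (cong (λ E → foldl (exchangeRight n) E Cs) (exchange-⊆ ca cb d s)) (push-nested ca cs ds ss)

Kplus-nested : ∀ {n S} → All (Column n) S → AllPairs _⊒_ S →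
  AllPairs (λ A B → ∀ {x} → x ∈ B → x ∈ A) S → Kplus n S ≡ S
Kplus-nested [] [] [] = refl
Kplus-nested (c ∷ cs) (d ∷ ch) (s ∷ ss) = cong₂ _∷_ (push-nested c cs d s) (Kplus-nested cs ch ss)

-- If K₊ does not exceed the column F c of the tableau map F cs, then that column has absorbed
-- every entry of the columns to its right.
Kplus-absorb : ∀ {n} (F G : ℕ → List ℕ) cs → AllPairs _≥_ cs → All (Column n) (map F cs) → AllPairs _⊒_ (map F cs) →
  Pointwise _⊒_ (Kplus n (map F cs)) (map G cs) →
  ∀ {c d x} → c ∈ cs → d ∈ cs → d < c → F c ≡ G c → x ∈ F d → x ∈ F c
Kplus-absorb F G (c ∷ cs) (_ ∷ dec) (cl ∷ cls) (ch ∷ chs) (p ∷ ps) (here refl) (here refl) lt e mx = mx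
Kplus-absorb F G (c ∷ cs) (_ ∷ dec) (cl ∷ cls) (ch ∷ chs) (p ∷ ps) (here refl) (there md) lt e mx =
  Pushed.absorb (push-spec cl cls ch chs) (subst (_ ⊒_) (sym e) p) (∈-map⁺ F md) mx
Kplus-absorb F G (_ ∷ cs) (ge ∷ dec) (cl ∷ cls) (ch ∷ chs) (p ∷ ps) (there mc) (here refl) lt e mx =
  ⊥-elim (<⇒≱ lt (All.lookup ge mc))
Kplus-absorb F G (_ ∷ cs) (ge ∷ dec) (cl ∷ cls) (ch ∷ chs) (p ∷ ps) (there mc) (there md) lt e mx =
  Kplus-absorb F G cs dec cls chs ps mc md lt e mx

-- Contents and coefficients

#-concat-mono : ∀ {A : Set} (p : A → Bool) {S S′} → Pointwise (λ C D → # p C ≤ # p D) S S′ →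
  # p (concat S) ≤ # p (concat S′)
#-concat-mono p [] = z≤n
#-concat-mono p {C ∷ S} {D ∷ S′} (le ∷ les) = subst₂ _≤_ (sym (#-++ p C (concat S))) (sym (#-++ p D (concat S′)))
  (+-mono-≤ le (#-concat-mono p les))

#-concat-tight : ∀ {A : Set} (p : A → Bool) {S S′} → Pointwise (λ C D → # p C ≤ # p D) S S′ →
  # p (concat S′) ≤ # p (concat S) → Pointwise (λ C D → # p D ≤ # p C) S S′
#-concat-tight p [] _ = []
#-concat-tight p {C ∷ S} {D ∷ S′} (le ∷ les) ge =
  +-≤-splitˡ le (#-concat-mono p les) ge′ ∷ #-concat-tight p les (+-≤-splitʳ le (#-concat-mono p les) ge′)
  where
  ge′ = subst₂ _≤_ (#-++ p D (concat S′)) (#-++ p C (concat S)) ge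

⊒-count : ∀ {S S′} → Pointwise _⊒_ S S′ → ∀ k → # (_≤ᵇ k) (concat S′) ≤ # (_≤ᵇ k) (concat S)
⊒-count pw k = #-concat-mono (_≤ᵇ k) (PW.symmetric (λ d → count≤ d k) pw)

entries-within : ∀ {n S x} → All (Column n) S → x ∈ concat S → 1 ≤ x × x ≤ n
entries-within {S = S} cs m with ∈-concat⁻′ S m
... | C , mx , mC = within (All.lookup cs mC) mx

-- A content vector sees only the values 1 to n; all entries lie there, so every other multiplicity
-- is zero on both sides.
content⇒# : ∀ {n S S′} → All (Column n) S → All (Column n) S′ → content n S ≡ content n S′ →
  ∀ p → # p (concat S) ≡ # p (concat S′)
content⇒# {n} {S} {S′} cs cs′ e = #-determined (concat S) (concat S′) eq
  where
  none : ∀ {R} v → All (Column n) R → ¬ (1 ≤ v × v ≤ n) → # (_≡ᵇ v) (concat R) ≡ 0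
  none {R} v cr ne = #-none (_≡ᵇ v) (concat R)
    (λ {x} m t → ne (subst (λ y → 1 ≤ y × y ≤ n) (≡ᵇ⇒≡ x v t) (entries-within cr m)))
  eq : ∀ v → # (_≡ᵇ v) (concat S) ≡ # (_≡ᵇ v) (concat S′)
  eq zero = trans (none 0 cs (λ ())) (sym (none 0 cs′ (λ ())))
  eq (suc v) with v <? n
  ... | no ¬p = trans (none (suc v) cs (¬p ∘ proj₂)) (sym (none (suc v) cs′ (¬p ∘ proj₂)))
  ... | yes p = subst (λ w → # (_≡ᵇ suc w) (concat S) ≡ # (_≡ᵇ suc w) (concat S′)) (toℕ-fromℕ< p)
      (trans (sym (lookup∘tabulate _ (fromℕ< p))) (trans (cong (λ u → lookup u (fromℕ< p)) e) (lookup∘tabulate _ (fromℕ< p))))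

#⇒content : ∀ n {S S′} → (∀ v → # (_≡ᵇ v) (concat S) ≡ # (_≡ᵇ v) (concat S′)) → content n S ≡ content n S′
#⇒content n f = tabulate-cong (λ k → f (suc (toℕ k)))

∈-words : ∀ {n} C → (∀ {x} → x ∈ C → 1 ≤ x × x ≤ n) → C ∈ words n (length C)
∈-words [] w = here refl
∈-words {n} (x ∷ C) w = ∈-concat⁺′ (∈-map⁺ (x ∷_) (∈-words C (w ∘ there)))
  (∈-map⁺ (λ x → map (x ∷_) (words n (length C))) (∈-range⁺ (proj₁ (w (here refl))) (proj₂ (w (here refl)))))

∈-fillings : ∀ {n} (lam : Vec ℕ n) {S} → SSYT n (colLens lam) S → S ∈ fillings lam
∈-fillings {n} lam {S} (ssyt l c _) = go S (colLens lam) l c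
  where
  go : ∀ S cs → map length S ≡ cs → All (Column n) S →
    S ∈ foldr (λ c acc → concatMap (λ col → map (col ∷_) acc) (words n c)) ([] ∷ []) cs
  go [] [] _ _ = here refl
  go (C ∷ S) (_ ∷ cs) refl (c ∷ cl) = ∈-concat⁺′ (∈-map⁺ (C ∷_) (go S cs refl cl))
    (∈-map⁺ (λ col → map (col ∷_) _) (∈-words C (within c)))

vecEq⇒≡ : ∀ {n} (u v : Vec ℕ n) → T (vecEq u v) → u ≡ v
vecEq⇒≡ u v t = toList-inj u v (listEq⇒≡ (toList u) (toList v) t)
  where
  toList-inj : ∀ {n} (u v : Vec ℕ n) → toList u ≡ toList v → u ≡ v
  toList-inj []ᵥ []ᵥ _ = refl
  toList-inj (x ∷ᵥ u) (y ∷ᵥ v) e = cong₂ _∷ᵥ_ (proj₁ (∷-injective e)) (toList-inj u v (proj₂ (∷-injective e)))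

-- S makes the coefficient at its own content positive, hence also the coefficient of the other
-- polynomial. This extracts tableaux from the hypothesis even while the shapes may differ.
coeff-transfer : ∀ {n} (lam lam′ : Vec ℕ n) (P P′ : Tableau → Bool) → (∀ θ → coeff lam P θ ≡ coeff lam′ P′ θ) →
  ∀ {S} → SSYT n (colLens lam) S → T (P S) → ∃[ S′ ] (T (P′ S′) × content n S′ ≡ content n S)
coeff-transfer {n} lam lam′ P P′ same {S} s t
  with #-pos (λ R → P′ R ∧ vecEq (content n R) (content n S)) (fillings lam′)
         (subst (1 ≤_) (same (content n S)) (#-pos⁺ (λ R → P R ∧ vecEq (content n R) (content n S)) (∈-fillings lam s)
           (∧⁺ t (listEq-refl (toList (content n S))))))
... | S′ , _ , u = S′ , proj₁ (∧⁻ u) , vecEq⇒≡ _ _ (proj₂ (∧⁻ {P′ S′} u))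

-- Among the fillings with the content of S, one set contains the other and both have the same size.
coeff-saturated : ∀ {n} (lam : Vec ℕ n) (P P′ : Tableau → Bool) → (∀ θ → coeff lam P θ ≡ coeff lam P′ θ) →
  (∀ S → T (P′ S) → T (P S)) → ∀ {S} → SSYT n (colLens lam) S → T (P S) → T (P′ S)
coeff-saturated {n} lam P P′ same sub {S} s t = proj₁ (∧⁻
  (#-saturated (λ R → P′ R ∧ vecEq (content n R) θ) (λ R → P R ∧ vecEq (content n R) θ) (fillings lam)
    (λ {R} _ u → ∧⁺ (sub R (proj₁ (∧⁻ u))) (proj₂ (∧⁻ {P′ R} u)))
    (≤-reflexive (same θ)) (∈-fillings lam s) (∧⁺ t (listEq-refl (toList θ)))))
  where
  θ = content n S

-- Keys of permutations and the shape

‼-applyUpTo : ∀ (f : ℕ → ℕ) c {i} → i < c → applyUpTo f c ‼ suc i ≡ f i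
‼-applyUpTo f (suc c) {zero} _ = refl
‼-applyUpTo f (suc c) {suc i} lt = ‼-applyUpTo (f ∘ suc) c (≤-pred lt)

‼-map-range : ∀ (f : ℕ → ℕ) c {i} → i < c → map f (range 1 c) ‼ suc i ≡ f (suc i)
‼-map-range f c lt = trans (cong (_‼ _) (map-range f c)) (‼-applyUpTo (f ∘ suc) c lt)

‼-toList : ∀ {n} (v : Vec ℕ n) i → toList v ‼ i ≡ v ! i
‼-toList []ᵥ i = refl
‼-toList (x ∷ᵥ v) zero = refl
‼-toList (x ∷ᵥ v) (suc zero) = refl
‼-toList (x ∷ᵥ v) (suc (suc i)) = ‼-toList v (suc i)

!-tabulate : ∀ {n} (f : Fin n → ℕ) (k : Fin n) → tabulate f ! suc (toℕ k) ≡ f k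
!-tabulate f Fin.zero = refl
!-tabulate f (Fin.suc k) = !-tabulate (f ∘ Fin.suc) k

!-ext : ∀ {n} (u v : Vec ℕ n) → (∀ i → i < n → u ! suc i ≡ v ! suc i) → u ≡ v
!-ext []ᵥ []ᵥ _ = refl
!-ext (x ∷ᵥ u) (y ∷ᵥ v) f = cong₂ _∷ᵥ_ (f 0 (s≤s z≤n)) (!-ext u v (λ i lt → f (suc i) (s≤s lt)))

zip≤⇒‼ : ∀ A B → length A ≤ length B → T (and (zipWith _≤ᵇ_ A B)) → ∀ i → i < length A → A ‼ suc i ≤ B ‼ suc i
zip≤⇒‼ (a ∷ A) (b ∷ B) _ t zero _ = ≤ᵇ⇒≤ a b (proj₁ (∧⁻ t))
zip≤⇒‼ (a ∷ A) (b ∷ B) le t (suc i) lt = zip≤⇒‼ A B (≤-pred le) (proj₂ (∧⁻ {a ≤ᵇ b} t)) i (≤-pred lt)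

‼⇒zip≤ : ∀ A B → (∀ i → i < length A → i < length B → A ‼ suc i ≤ B ‼ suc i) → T (and (zipWith _≤ᵇ_ A B))
‼⇒zip≤ [] B f = tt
‼⇒zip≤ (a ∷ A) [] f = tt
‼⇒zip≤ (a ∷ A) (b ∷ B) f = ∧⁺ (≤⇒≤ᵇ (f 0 (s≤s z≤n) (s≤s z≤n))) (‼⇒zip≤ A B (λ i lt lt′ → f (suc i) (s≤s lt) (s≤s lt′)))

‼⇒Pointwise : ∀ A B → length A ≡ length B → (∀ i → i < length A → A ‼ suc i ≤ B ‼ suc i) → Pointwise _≤_ A B
‼⇒Pointwise [] [] _ _ = []
‼⇒Pointwise (a ∷ A) (b ∷ B) e f = f 0 (s≤s z≤n) ∷ ‼⇒Pointwise A B (suc-injective e) (λ i lt → f (suc i) (s≤s lt))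

Pointwise⇒⊒ : ∀ {A B} → Pointwise _≤_ A B → A ⊒ B
Pointwise⇒⊒ pw = zip⇒⊒ _ _ (≤-reflexive (sym (PW.Pointwise-length pw))) (go pw)
  where
  go : ∀ {A B} → Pointwise _≤_ A B → T (and (zipWith _≤ᵇ_ A B))
  go [] = tt
  go (p ∷ ps) = ∧⁺ (≤⇒≤ᵇ p) (go ps)

‼-∈ : ∀ C {i} → i < length C → C ‼ suc i ∈ C
‼-∈ (x ∷ C) {zero} _ = here refl
‼-∈ (x ∷ C) {suc i} lt = there (‼-∈ C (≤-pred lt))

∈-‼ : ∀ {C x} → x ∈ C → ∃[ i ] (i < length C × C ‼ suc i ≡ x)
∈-‼ (here refl) = 0 , s≤s z≤n , refl
∈-‼ (there m) with ∈-‼ m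
... | i , lt , e = suc i , s≤s lt , e

sorted-‼-suc : ∀ {C} → Sorted C → ∀ i → suc i < length C → C ‼ suc i < C ‼ suc (suc i)
sorted-‼-suc {x ∷ C} (a ∷ s) zero lt = All.lookup a (‼-∈ C (≤-pred lt))
sorted-‼-suc {x ∷ C} (a ∷ s) (suc i) lt = sorted-‼-suc s i (≤-pred lt)

sorted-‼-gap : ∀ {C} → Sorted C → ∀ i d → i + d < length C → C ‼ suc i + d ≤ C ‼ suc (i + d)
sorted-‼-gap {C} s i zero lt = ≤-reflexive (trans (+-identityʳ _) (cong (λ j → C ‼ suc j) (sym (+-identityʳ i))))
sorted-‼-gap {C} s i (suc d) lt = ≤-trans (≤-reflexive (+-suc _ d)) (≤-trans
  (s≤s (sorted-‼-gap s i d (≤-trans (s≤s (+-monoʳ-≤ i (n≤1+n d))) lt)))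
  (subst (λ j → C ‼ suc (i + d) < C ‼ suc j) (sym (+-suc i d))
    (sorted-‼-suc s (i + d) (subst (_< length C) (+-suc i d) lt))))

sorted-‼-mono : ∀ {C} → Sorted C → ∀ {i j} → i ≤ j → j < length C → C ‼ suc i ≤ C ‼ suc j
sorted-‼-mono {C} s {i} {j} le lt = ≤-trans (m≤m+n _ (j ∸ i))
  (subst (λ k → C ‼ suc i + (j ∸ i) ≤ C ‼ suc k) (m+[n∸m]≡n le)
    (sorted-‼-gap s i (j ∸ i) (subst (_< length C) (sym (m+[n∸m]≡n le)) lt)))

column-‼-≥ : ∀ {n C} → Column n C → ∀ i → i < length C → suc i ≤ C ‼ suc i
column-‼-≥ {C = C} c i lt = ≤-trans (+-monoˡ-≤ i (proj₁ (within c (‼-∈ C {0} (≤-trans (s≤s z≤n) lt)))))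
  (sorted-‼-gap (sorted c) 0 i lt)

range⊒ : ∀ {n C} → Column n C → range 1 (length C) ⊒ C
range⊒ {C = C} c = Pointwise⇒⊒ (‼⇒Pointwise (range 1 (length C)) C (length-range _) f)
  where
  f : ∀ i → i < length (range 1 (length C)) → range 1 (length C) ‼ suc i ≤ C ‼ suc i
  f i lt = let lt′ = subst (i <_) (length-range (length C)) lt in
    subst (_≤ C ‼ suc i) (sym (trans (cong (_‼ suc i) (range≡applyUpTo (length C))) (‼-applyUpTo suc (length C) lt′)))
      (column-‼-≥ c i lt′)

-- Both columns are filters of the same list 1, ..., n, so inclusion of sets compares their counts
-- at every threshold.
⊇⇒⊒ : ∀ {n A B} → Column n A → Column n B → (∀ {x} → x ∈ B → x ∈ A) → A ⊒ B
⊇⇒⊒ {n} {A} {B} ca cb sub = ⊒⁺ λ v → subst₂ _≤_ (count v cb) (count v ca)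
  (#-mono (λ x → (x ∈ᵇ B) ∧ (x ≤ᵇ v)) (λ x → (x ∈ᵇ A) ∧ (x ≤ᵇ v)) (range 1 n)
    (λ {x} _ t → ∧⁺ (∈⇒∈ᵇ (sub (∈ᵇ⇒∈ {x} {B} (proj₁ (∧⁻ t))))) (proj₂ (∧⁻ {x ∈ᵇ B} t))))
  where
  count : ∀ v {C} → Column n C → # (λ x → (x ∈ᵇ C) ∧ (x ≤ᵇ v)) (range 1 n) ≡ # (_≤ᵇ v) C
  count v {C} c = trans (sym (#-filter (_≤ᵇ v) (_∈ᵇ C) (range 1 n))) (cong (# (_≤ᵇ v)) (sortedSet-id c))

AllPairs-∈ : ∀ {A : Set} {R Q : A → A → Set} {xs} → (∀ {x y} → x ∈ xs → y ∈ xs → R x y → Q x y) → AllPairs R xs → AllPairs Q xs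
AllPairs-∈ f [] = []
AllPairs-∈ f (a ∷ p) = All.tabulate (λ m → f (here refl) (there m) (All.lookup a m))
  ∷ AllPairs-∈ (λ m m′ → f (there m) (there m′)) p

map-SSYT : ∀ {n cs} (F : ℕ → List ℕ) → AllPairs _≥_ cs → (∀ {c} → c ∈ cs → Column n (F c)) →
  (∀ {c} → c ∈ cs → length (F c) ≡ c) → (∀ {c d} → c ∈ cs → d ∈ cs → d ≤ c → F c ⊒ F d) → SSYT n cs (map F cs)
map-SSYT {n} {cs} F dec col len dom = ssyt
  (trans (sym (map-∘ cs)) (map-id-∈ cs len))
  (Allₚ.map⁺ (All.tabulate col))
  (AllPairsₚ.map⁺ (AllPairs-∈ dom dec))
  where
  map-id-∈ : ∀ {f : ℕ → ℕ} xs → (∀ {x} → x ∈ xs → f x ≡ x) → map f xs ≡ xs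
  map-id-∈ [] f = refl
  map-id-∈ (x ∷ xs) f = cong₂ _∷_ (f (here refl)) (map-id-∈ xs (f ∘ there))

colLen≤n : ∀ {n} (lam : Vec ℕ n) j → colLen lam j ≤ n
colLen≤n {n} lam j = ≤-trans (#≤length _ (range 1 n)) (≤-reflexive (length-range n))

∈colLens⇒≤n : ∀ {n} (lam : Vec ℕ n) {c} → c ∈ colLens lam → c ≤ n
∈colLens⇒≤n lam m with ∈-map⁻ (colLen lam) m
... | j , _ , refl = colLen≤n lam j

-- The least tableau of its shape: row i is filled with i.
initial : List ℕ → Tableau
initial = map (range 1)

range-⊇ : ∀ {c d x} → d ≤ c → x ∈ range 1 d → x ∈ range 1 c
range-⊇ le m = ∈-range⁺ (proj₁ (∈-range⁻ m)) (≤-trans (proj₂ (∈-range⁻ m)) le)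

initial-SSYT : ∀ {n} (lam : Vec ℕ n) → SSYT n (colLens lam) (initial (colLens lam))
initial-SSYT lam = map-SSYT (range 1) (colLens-decreasing lam) (range-column ∘ ∈colLens⇒≤n lam) (λ _ → length-range _)
  (λ mc md le → ⊇⇒⊒ (range-column (∈colLens⇒≤n lam mc)) (range-column (∈colLens⇒≤n lam md)) (range-⊇ le))

initial-⊒ : ∀ {n cs S} → SSYT n cs S → Pointwise _⊒_ (initial cs) S
initial-⊒ {S = S} (ssyt refl cols _) = go cols
  where
  go : ∀ {n S} → All (Column n) S → Pointwise _⊒_ (initial (map length S)) S
  go [] = []
  go (c ∷ cs) = range⊒ c ∷ go cs

module Permutation {n} (π : Vec ℕ n)
  (bound : ∀ i → 1 ≤ i → i ≤ n → (1 ≤ π ! i) × (π ! i ≤ n))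
  (inj : ∀ i j → 1 ≤ i → i ≤ n → 1 ≤ j → j ≤ n → π ! i ≡ π ! j → i ≡ j) where

  Bcol : ℕ → List ℕ
  Bcol c = sortedSet n (map (π !_) (range 1 c))

  Bcol-column : ∀ c → Column n (Bcol c)
  Bcol-column c = sortedSet-column n (map (π !_) (range 1 c))

  Bcol-↭ : ∀ {c} → c ≤ n → Bcol c ↭ map (π !_) (range 1 c)
  Bcol-↭ {c} le = sortedSet-↭ unique win
    where
    unique : Unique (map (π !_) (range 1 c))
    unique = subst Unique (sym (map-range (π !_) c)) (Uniqueₚ.applyUpTo⁺₁ _ c
      (λ i<j j<c e → <-irrefl (suc-injective (inj _ _ (s≤s z≤n) (≤-trans (s≤s (<⇒≤ i<j)) (≤-trans j<c le)) (s≤s z≤n) (≤-trans j<c le) e)) i<j))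
    win : ∀ {x} → x ∈ map (π !_) (range 1 c) → 1 ≤ x × x ≤ n
    win m with ∈-map⁻ (π !_) m
    ... | i , mi , refl = bound i (proj₁ (∈-range⁻ mi)) (≤-trans (proj₂ (∈-range⁻ mi)) le)

  Bcol-length : ∀ {c} → c ≤ n → length (Bcol c) ≡ c
  Bcol-length {c} le = trans (↭-length (Bcol-↭ le)) (length-map-range (π !_) c)

  ∈-Bcol⁻ : ∀ c {x} → x ∈ Bcol c → ∃[ i ] (1 ≤ i × i ≤ c × x ≡ π ! i)
  ∈-Bcol⁻ c m with ∈-map⁻ (π !_) (∈-sortedSet⁻ {n} {xs = map (π !_) (range 1 c)} m)
  ... | i , mi , e = i , proj₁ (∈-range⁻ mi) , proj₂ (∈-range⁻ mi) , e

  ∈-Bcol⁺ : ∀ {c i} → c ≤ n → 1 ≤ i → i ≤ c → π ! i ∈ Bcol c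
  ∈-Bcol⁺ {c} {i} c≤n p q = let b = bound i p (≤-trans q c≤n) in
    ∈-sortedSet⁺ (proj₁ b) (proj₂ b) (∈-map⁺ (π !_) (∈-range⁺ p q))

  ∈-Bcol-position : ∀ {c i} → 1 ≤ i → i ≤ n → c ≤ n → π ! i ∈ Bcol c → i ≤ c
  ∈-Bcol-position {c} {i} p q le m with ∈-Bcol⁻ c m
  ... | j , pj , qj , e = subst (_≤ c) (sym (inj i j p q pj (≤-trans qj le) e)) qj

  Bcol-mono : ∀ c d {x} → d ≤ c → c ≤ n → x ∈ Bcol d → x ∈ Bcol c
  Bcol-mono c d le c≤n m with ∈-Bcol⁻ d m
  ... | i , p , q , refl = ∈-Bcol⁺ c≤n p (≤-trans q le)

  Bcol-⊒ : ∀ {c d} → d ≤ c → c ≤ n → Bcol c ⊒ Bcol d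
  Bcol-⊒ {c} {d} le c≤n = ⊇⇒⊒ (Bcol-column c) (Bcol-column d) (Bcol-mono c d le c≤n)

  Bcol-n : Bcol n ≡ range 1 n
  Bcol-n = full-column (Bcol-column n) (Bcol-length ≤-refl)

  ∈-Bcol-n : ∀ {v} → 1 ≤ v → v ≤ n → ∃[ i ] (1 ≤ i × i ≤ n × v ≡ π ! i)
  ∈-Bcol-n p q = ∈-Bcol⁻ n (subst (_ ∈_) (sym Bcol-n) (∈-range⁺ p q))

  -- The separate case for columns of length n agrees with the general one, since n distinct values
  -- in [n] exhaust it.
  Y≡ : ∀ (lam : Vec ℕ n) → Y lam π ≡ map Bcol (colLens lam)
  Y≡ lam = map-cong col (colLens lam)
    where
    col : ∀ c → (if c ≡ᵇ n then range 1 n else sortedSet n (map (π !_) (range 1 c))) ≡ Bcol c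
    col c with c ≡ᵇ n in e
    ... | false = refl
    ... | true with ≡ᵇ⇒≡ c n (≡⇒T e)
    ...   | refl = sym Bcol-n

  module _ (lam : Vec ℕ n) where
    private cs = colLens lam

    key-SSYT : SSYT n cs (map Bcol cs)
    key-SSYT = map-SSYT Bcol (colLens-decreasing lam) (λ {c} _ → Bcol-column c) (Bcol-length ∘ ∈colLens⇒≤n lam)
      (λ mc _ le → Bcol-⊒ le (∈colLens⇒≤n lam mc))

    inD⁻ : ∀ S → T (inD lam π S) → SSYT n cs S × Pointwise _⊒_ (Kplus n S) (map Bcol cs)
    inD⁻ S t = isSSYT⇒SSYT lam S (proj₁ (∧⁻ t))
      , subst (Pointwise _⊒_ (Kplus n S)) (Y≡ lam) (leqTab⇒⊒ _ _ (proj₂ (∧⁻ {isSSYT lam S} t)))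

    inD⁺ : ∀ {S} → SSYT n cs S → Pointwise _⊒_ (Kplus n S) (map Bcol cs) → T (inD lam π S)
    inD⁺ {S} s pw = ∧⁺ (SSYT⇒isSSYT lam s) (subst (T ∘ leqTab (Kplus n S)) (sym (Y≡ lam))
      (⊒⇒leqTab (trans K.lens (trans (SSYT.lens s) (sym (SSYT.lens key-SSYT)))) K.cols (SSYT.cols key-SSYT) pw))
      where module K = KeyAbove (Kplus-spec (SSYT.cols s) (SSYT.chain s))

    inD-below : ∀ S → T (inD lam π S) → Pointwise _⊒_ S (map Bcol cs)
    inD-below S t with inD⁻ S t
    ... | s , pw = PW.transitive ⊒-trans (KeyAbove.above (Kplus-spec (SSYT.cols s) (SSYT.chain s))) pw

    nested-inD : ∀ {S} → SSYT n cs S → AllPairs (λ A B → ∀ {x} → x ∈ B → x ∈ A) S →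
      Pointwise _⊒_ S (map Bcol cs) → T (inD lam π S)
    nested-inD s nest pw = inD⁺ s (subst (λ K → Pointwise _⊒_ K (map Bcol cs))
      (sym (Kplus-nested (SSYT.cols s) (SSYT.chain s) nest)) pw)

    key-inD : T (inD lam π (map Bcol cs))
    key-inD = nested-inD key-SSYT
      (AllPairsₚ.map⁺ (AllPairs-∈ (λ {c} {d} mc _ ge m → Bcol-mono c d ge (∈colLens⇒≤n lam mc) m) (colLens-decreasing lam)))
      (PW.refl ⊒-refl)

    initial-inD : T (inD lam π (initial cs))
    initial-inD = nested-inD (initial-SSYT lam)
      (AllPairsₚ.map⁺ (AllPairs-∈ (λ _ _ ge m → range-⊇ ge m) (colLens-decreasing lam))) (initial-⊒ key-SSYT)

    -- A key is the only tableau of its shape and content: a column of length c has at most c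
    -- entries among π₁,…,π_c, and equality must hold for every column.
    key-unique : ∀ {S} → SSYT n cs S → content n S ≡ content n (map Bcol cs) → S ≡ map Bcol cs
    key-unique {S} s e = go S cs (SSYT.lens s) (SSYT.cols s) (∈colLens⇒≤n lam)
        (λ c≤n → #-concat-tight _ (count≤col c≤n S cs (SSYT.lens s) (SSYT.cols s) (∈colLens⇒≤n lam))
          (≤-reflexive (sym (content⇒# (SSYT.cols s) (SSYT.cols key-SSYT) e _))))
      where
      open ≤-Reasoning
      bound-col : ∀ {c C} → c ≤ n → Column n C → length C ≤ n → # (_∈ᵇ Bcol c) C ≤ # (_∈ᵇ Bcol c) (Bcol (length C))
      -- A column no longer than c has at most its length many entries in B_c, and its key column
      -- attains this by lying in B_c. A longer one has at most all of B_c, and its key column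
      -- attains this by containing B_c.
      bound-col {c} {C} c≤n col le with ≤-total (length C) c
      ... | inj₁ le′ = begin
        # (_∈ᵇ Bcol c) C ≤⟨ #≤length _ C ⟩
        length C ≡⟨ Bcol-length le ⟨
        length (Bcol (length C)) ≡⟨ #-all (_∈ᵇ Bcol c) (Bcol (length C)) (λ m → ∈⇒∈ᵇ (Bcol-mono c (length C) le′ c≤n m)) ⟨
        # (_∈ᵇ Bcol c) (Bcol (length C)) ∎
      ... | inj₂ ge = begin
        # (_∈ᵇ Bcol c) C ≡⟨ cong (# (_∈ᵇ Bcol c)) (sortedSet-id col) ⟨
        # (_∈ᵇ Bcol c) (sortedSet n C) ≡⟨ #-filter (_∈ᵇ Bcol c) (_∈ᵇ C) (range 1 n) ⟩
        # (λ x → (x ∈ᵇ C) ∧ (x ∈ᵇ Bcol c)) (range 1 n)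
          ≤⟨ #-mono _ (λ x → (x ∈ᵇ Bcol (length C)) ∧ (x ∈ᵇ Bcol c)) (range 1 n)
               (λ {x} _ t → let m = proj₂ (∧⁻ {x ∈ᵇ C} t) in ∧⁺ (∈⇒∈ᵇ (Bcol-mono (length C) c ge le (∈ᵇ⇒∈ {x} {Bcol c} m))) m) ⟩
        # (λ x → (x ∈ᵇ Bcol (length C)) ∧ (x ∈ᵇ Bcol c)) (range 1 n) ≡⟨ #-filter (_∈ᵇ Bcol c) (_∈ᵇ Bcol (length C)) (range 1 n) ⟨
        # (_∈ᵇ Bcol c) (sortedSet n (Bcol (length C))) ≡⟨ cong (# (_∈ᵇ Bcol c)) (sortedSet-id (Bcol-column (length C))) ⟩
        # (_∈ᵇ Bcol c) (Bcol (length C)) ∎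
      count≤col : ∀ {c} → c ≤ n → ∀ S cs → map length S ≡ cs → All (Column n) S → (∀ {d} → d ∈ cs → d ≤ n) →
        Pointwise (λ C D → # (_∈ᵇ Bcol c) C ≤ # (_∈ᵇ Bcol c) D) S (map Bcol cs)
      count≤col c≤n [] [] _ _ _ = []
      count≤col c≤n (C ∷ S) (_ ∷ cs) refl (col ∷ cols) le =
        bound-col c≤n col (le (here refl)) ∷ count≤col c≤n S cs refl cols (le ∘ there)
      go : ∀ S cs → map length S ≡ cs → All (Column n) S → (∀ {d} → d ∈ cs → d ≤ n) →
        (∀ {c} → c ≤ n → Pointwise (λ C D → # (_∈ᵇ Bcol c) D ≤ # (_∈ᵇ Bcol c) C) S (map Bcol cs)) →
        S ≡ map Bcol cs
      go [] [] _ _ _ _ = refl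
      go (C ∷ S) (_ ∷ cs) refl (col ∷ cols) le f =
        cong₂ _∷_ (⊆-column-≡ col (Bcol-column c) sub (≤-reflexive (Bcol-length c≤n)))
          (go S cs refl cols (le ∘ there) (PW.tail ∘ f))
        where
        c = length C
        c≤n = le (here refl)
        sub : ∀ {x} → x ∈ C → x ∈ Bcol c
        -- With the prefix chosen as long as the column itself, tightness says that all entries of C
        -- lie in B_c.
        sub m = ∈ᵇ⇒∈ {xs = Bcol c} (#-full (_∈ᵇ Bcol c) C (begin
          length C ≡⟨ Bcol-length c≤n ⟨
          length (Bcol c) ≡⟨ #-all (_∈ᵇ Bcol c) (Bcol c) ∈⇒∈ᵇ ⟨
          # (_∈ᵇ Bcol c) (Bcol c) ≤⟨ PW.head (f c≤n) ⟩
          # (_∈ᵇ Bcol c) C ∎) m)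

-- Recovering the shape from the least tableau

#≤-range : ∀ {v m} → v ≤ m → # (_≤ᵇ v) (range 1 m) ≡ v
#≤-range {v} {m} le = trans (↭-length (∼bag⇒↭ (unique∧set⇒bag
    (sorted⇒unique (AllPairsₚ.filter⁺ (T? ∘ (_≤ᵇ v)) (sorted-range m))) (sorted⇒unique (sorted-range v)) (mk⇔ to from))))
  (length-range v)
  where
  to : ∀ {x} → x ∈ filterᵇ (_≤ᵇ v) (range 1 m) → x ∈ range 1 v
  to {x} p with ∈-filter⁻ (T? ∘ (_≤ᵇ v)) {xs = range 1 m} p
  ... | a , b = ∈-range⁺ (proj₁ (∈-range⁻ a)) (≤ᵇ⇒≤ x v b)
  from : ∀ {x} → x ∈ range 1 v → x ∈ filterᵇ (_≤ᵇ v) (range 1 m)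
  from p = ∈-filter⁺ (T? ∘ (_≤ᵇ v)) (range-⊇ le p) (≤⇒≤ᵇ (proj₂ (∈-range⁻ p)))

-- Conjugation of partitions: the parts decrease, so the rows that reach column j form an initial
-- segment and their number tells which they are.
colLen-conjugate : ∀ {n} (lam : Vec ℕ n) → IsPartition lam → ∀ {k j} → 1 ≤ k → k ≤ n → (k ≤ᵇ colLen lam j) ≡ (j ≤ᵇ lam ! k)
colLen-conjugate {n} lam part {suc k} {j} 1≤k k≤n = T-ext to from
  where
  to : T (suc k ≤ᵇ colLen lam j) → T (j ≤ᵇ lam ! suc k)
  to t with j ≤? lam ! suc k
  ... | yes p = ≤⇒≤ᵇ p
  ... | no ¬p = ⊥-elim (1+n≰n (≤-trans (≤ᵇ⇒≤ (suc k) _ t) (≤-trans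
      (#-mono (λ i → j ≤ᵇ lam ! i) (_≤ᵇ k) (range 1 n) small) (≤-reflexive (#≤-range (<⇒≤ k≤n))))))
    where
    small : ∀ {x} → x ∈ range 1 n → T (j ≤ᵇ lam ! x) → T (x ≤ᵇ k)
    small {x} m u with x ≤? k
    ... | yes q = ≤⇒≤ᵇ q
    ... | no ¬q = ⊥-elim (¬p (≤-trans (≤ᵇ⇒≤ j _ u) (part (suc k) x (s≤s z≤n) (≰⇒> ¬q) (proj₂ (∈-range⁻ m)))))
  from : T (j ≤ᵇ lam ! suc k) → T (suc k ≤ᵇ colLen lam j)
  from t = ≤⇒≤ᵇ (≤-trans (≤-reflexive (sym (#≤-range k≤n))) (#-mono (_≤ᵇ suc k) (λ i → j ≤ᵇ lam ! i) (range 1 n)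
    (λ {x} m u → ≤⇒≤ᵇ (≤-trans (≤ᵇ⇒≤ j _ t) (part x (suc k) (proj₁ (∈-range⁻ m)) (≤ᵇ⇒≤ x (suc k) u) k≤n)))))

#≡-range : ∀ {k} → 1 ≤ k → ∀ c → # (_≡ᵇ k) (range 1 c) ≡ ind (k ≤ᵇ c)
#≡-range {suc k} _ c with suc k ≤? c
... | yes p = trans (+-cancelˡ-≡ k _ 1 (begin
    k + # (_≡ᵇ suc k) (range 1 c) ≡⟨ cong (_+ # (_≡ᵇ suc k) (range 1 c)) (#≤-range (<⇒≤ p)) ⟨
    # (_≤ᵇ k) (range 1 c) + # (_≡ᵇ suc k) (range 1 c) ≡⟨ #≤-suc k (range 1 c) ⟨
    # (_≤ᵇ suc k) (range 1 c) ≡⟨ #≤-range p ⟩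
    suc k ≡⟨ +-comm 1 k ⟩
    k + 1 ∎)) (sym (ind-true (≤⇒≤ᵇ p)))
  where open ≡-Reasoning
... | no ¬p = trans (#-none (_≡ᵇ suc k) (range 1 c) (λ {x} m t → ¬p (subst (_≤ c) (≡ᵇ⇒≡ x (suc k) t) (proj₂ (∈-range⁻ m)))))
  (sym (ind-false (¬p ∘ ≤ᵇ⇒≤ (suc k) c)))

-- A value occurs once in each column long enough to contain its row, and the number of those
-- columns is the part of that row.
initial-content : ∀ {n} (lam : Vec ℕ n) → IsPartition lam → ∀ k → k < n →
  # (_≡ᵇ suc k) (concat (initial (colLens lam))) ≡ lam ! suc k
initial-content {n} lam part k lt = begin
  # (_≡ᵇ suc k) (concat (initial (colLens lam))) ≡⟨ go (colLens lam) ⟩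
  # (suc k ≤ᵇ_) (colLens lam) ≡⟨ #-map (suc k ≤ᵇ_) (colLen lam) (range 1 (lam ! 1)) ⟩
  # (λ j → suc k ≤ᵇ colLen lam j) (range 1 (lam ! 1)) ≡⟨ #-cong _ (_≤ᵇ lam ! suc k) (range 1 (lam ! 1)) (λ {j} _ → colLen-conjugate lam part {suc k} {j} (s≤s z≤n) lt) ⟩
  # (_≤ᵇ lam ! suc k) (range 1 (lam ! 1)) ≡⟨ #≤-range (part 1 (suc k) (s≤s z≤n) (s≤s z≤n) lt) ⟩
  lam ! suc k ∎
  where
  open ≡-Reasoning
  go : ∀ cs → # (_≡ᵇ suc k) (concat (initial cs)) ≡ # (suc k ≤ᵇ_) cs
  go [] = refl
  go (c ∷ cs) = trans (#-++ (_≡ᵇ suc k) (range 1 c) _)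
    (trans (cong₂ _+_ (#≡-range (s≤s z≤n) c) (go cs)) (sym (#-cons (suc k ≤ᵇ_) c cs)))

-- The initial tableau has the dominance-largest content of its shape, so the shape can be read off.
shape-determined : ∀ {n} (lam lam′ : Vec ℕ n) → IsPartition lam → IsPartition lam′ →
  (∃[ S ] (SSYT n (colLens lam′) S × content n S ≡ content n (initial (colLens lam)))) →
  (∃[ S ] (SSYT n (colLens lam) S × content n S ≡ content n (initial (colLens lam′)))) → lam ≡ lam′
shape-determined {n} lam lam′ part part′ (S , s , e) (S′ , s′ , e′) = !-ext lam lam′ (λ k lt →
  trans (sym (initial-content lam part k lt)) (trans (#≤-determines-#≡ (concat (initial (colLens lam))) (concat (initial (colLens lam′))) eq (suc k)) (initial-content lam′ part′ k lt)))
  where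
  half : ∀ (lam lam′ : Vec ℕ n) {S} → SSYT n (colLens lam′) S → content n S ≡ content n (initial (colLens lam)) → ∀ k →
    # (_≤ᵇ k) (concat (initial (colLens lam))) ≤ # (_≤ᵇ k) (concat (initial (colLens lam′)))
  half lam lam′ s e k = ≤-trans (≤-reflexive (sym (content⇒# (SSYT.cols s) (SSYT.cols (initial-SSYT lam)) e (_≤ᵇ k))))
    (⊒-count (initial-⊒ s) k)
  eq : ∀ k → # (_≤ᵇ k) (concat (initial (colLens lam))) ≡ # (_≤ᵇ k) (concat (initial (colLens lam′)))
  eq k = ≤-antisym (half lam lam′ s e k) (half lam′ lam s′ e′ k)

-- The largest tableau for a row bound

Upper : ℕ → (ℕ → ℕ) → Set
Upper n b = ∀ i → 1 ≤ i → i ≤ n → (i ≤ b i) × (b i ≤ n)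

-- M b c i = min { b k − (k − i) : i ≤ k ≤ c }, the largest possible i-th entry of a strictly
-- increasing column of length c bounded by b.  Inequalities about it are stated additively, to
-- avoid truncated subtraction.
minFrom : (ℕ → ℕ) → ℕ → ℕ → ℕ
minFrom b i zero    = b i
minFrom b i (suc d) = b i ⊓ (minFrom b (suc i) d ∸ 1)

minFrom-greatest : ∀ b {v} i d → (∀ k → i ≤ k → k ≤ i + d → v + k ≤ b k + i) → v ≤ minFrom b i d
minFrom-greatest b i zero f = +-cancelʳ-≤ i _ _ (f i ≤-refl (m≤m+n i 0))
minFrom-greatest b {v} i (suc d) f = ⊓-glb (+-cancelʳ-≤ i _ _ (f i ≤-refl (m≤m+n i (suc d))))
  (∸-monoˡ-≤ 1 (minFrom-greatest b {suc v} (suc i) d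
    (λ k lo hi → subst (suc v + k ≤_) (sym (+-suc (b k) i))
      (s≤s (f k (<⇒≤ lo) (subst (k ≤_) (sym (+-suc i d)) hi))))))

-- The hypothesis k ≤ b k keeps the inner minimum positive, so that `∸ 1` in the recursion is a true
-- subtraction.
minFrom-≤ : ∀ b i d → (∀ k → i ≤ k → k ≤ i + d → k ≤ b k) → ∀ k → i ≤ k → k ≤ i + d → minFrom b i d + k ≤ b k + i
minFrom-≤ b i zero f k lo hi with ≤-antisym lo (subst (k ≤_) (+-identityʳ i) hi)
... | refl = ≤-refl
minFrom-≤ b i (suc d) f k lo hi with m≤n⇒m<n∨m≡n lo
... | inj₂ refl = +-monoˡ-≤ i (m⊓n≤m (b i) _)
... | inj₁ i<k = linear 0 (+-mono-≤ (m⊓n≤n (b i) (m ∸ 1)) rec) (shape (b i ⊓ (m ∸ 1)) k (m ∸ 1) (b k) i)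
  where
  m = minFrom b (suc i) d
  hi′ = subst (k ≤_) (+-suc i d) hi
  upper : ∀ k → suc i ≤ k → k ≤ suc i + d → k ≤ b k
  upper k lo hi = f k (<⇒≤ lo) (subst (k ≤_) (sym (+-suc i d)) hi)
  1≤m : 1 ≤ m
  1≤m = ≤-trans (s≤s z≤n) (minFrom-greatest b {suc i} (suc i) d
    (λ k lo hi → ≤-trans (≤-reflexive (+-comm (suc i) k)) (+-monoˡ-≤ (suc i) (upper k lo hi))))
  rec : (m ∸ 1 + 1) + k ≤ b k + suc i
  rec = subst (λ x → x + k ≤ b k + suc i) (sym (m∸n+n≡m 1≤m)) (minFrom-≤ b (suc i) d upper k i<k hi′)
  shape : ∀ p k m bk i → p + k + (m + (bk + suc i)) + 0 ≡ bk + i + (p + (m + 1 + k))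
  shape p k m bk i = solve (p L.∷ k L.∷ m L.∷ bk L.∷ i L.∷ L.[])

M : (ℕ → ℕ) → ℕ → ℕ → ℕ
M b c i = minFrom b i (c ∸ i)

M-greatest : ∀ b {v c i} → i ≤ c → (∀ k → i ≤ k → k ≤ c → v + k ≤ b k + i) → v ≤ M b c i
M-greatest b {c = c} {i} le f = minFrom-greatest b i (c ∸ i) (λ k lo hi → f k lo (subst (k ≤_) (m+[n∸m]≡n le) hi))

module _ {n} {b : ℕ → ℕ} (up : Upper n b) where

  M-≤ : ∀ {c i} → 1 ≤ i → c ≤ n → ∀ k → i ≤ k → k ≤ c → M b c i + k ≤ b k + i
  M-≤ {c} {i} 1≤i c≤n k lo hi = minFrom-≤ b i (c ∸ i)
      (λ k lo hi → proj₁ (up k (≤-trans 1≤i lo) (≤-trans (subst (k ≤_) i+ hi) c≤n))) k lo (subst (k ≤_) (sym i+) hi)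
    where
    i+ : i + (c ∸ i) ≡ c
    i+ = m+[n∸m]≡n (≤-trans lo hi)

  M≤ : ∀ {c i} → 1 ≤ i → i ≤ c → c ≤ n → M b c i ≤ b i
  M≤ {c} {i} p q r = +-cancelʳ-≤ i _ _ (M-≤ p r i ≤-refl q)

  -- Every k that limits position j also limits position i, and more tightly by j - i.
  M-strict : ∀ {c i j} → 1 ≤ i → i < j → j ≤ c → c ≤ n → M b c i < M b c j
  M-strict {c} {i} {j} p lt q r = M-greatest b q (λ k lo hi →
      linear 0 (+-mono-≤ (M-≤ p r k (≤-trans (<⇒≤ lt) lo) hi) lt) (shape (M b c i) k (b k) i j))
    where
    shape : ∀ m k bk i j → suc m + k + (bk + i + j) + 0 ≡ bk + j + (m + k + suc i)
    shape m k bk i j = solve (m L.∷ k L.∷ bk L.∷ i L.∷ j L.∷ L.[])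

  M-antitone : ∀ {c d i} → 1 ≤ i → i ≤ d → d ≤ c → c ≤ n → M b c i ≤ M b d i
  M-antitone p q le r = M-greatest b q (λ k lo hi → M-≤ p r k lo (≤-trans hi le))

  i≤M : ∀ {c i} → 1 ≤ i → i ≤ c → c ≤ n → i ≤ M b c i
  i≤M {c} {i} p q r = M-greatest b q (λ k lo hi →
    ≤-trans (≤-reflexive (+-comm i k)) (+-monoˡ-≤ i (proj₁ (up k (≤-trans p lo) (≤-trans hi r)))))

Mcol : (ℕ → ℕ) → ℕ → List ℕ
Mcol b c = map (M b c) (range 1 c)

Mcol-length : ∀ b c → length (Mcol b c) ≡ c
Mcol-length b c = length-map-range (M b c) c

Mcol-‼ : ∀ b c {i} → 1 ≤ i → i ≤ c → Mcol b c ‼ i ≡ M b c i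
Mcol-‼ b c {suc i} _ le = ‼-map-range (M b c) c le

Mcol-column : ∀ {n b} → Upper n b → ∀ {c} → c ≤ n → Column n (Mcol b c)
Mcol-column {n} {b} up {c} c≤n = column (sorted-map-range (M b c) c (λ i j p lt q → M-strict up p lt q c≤n)) win
  where
  win : ∀ {x} → x ∈ Mcol b c → 1 ≤ x × x ≤ n
  win m with ∈-map⁻ (M b c) m
  ... | i , mi , refl = let p , q = ∈-range⁻ mi in
    ≤-trans p (i≤M up p q c≤n) , ≤-trans (M≤ up p q c≤n) (proj₂ (up i p (≤-trans q c≤n)))

-- An entry must leave room for the strict climb to every later row k: C_i + (k - i) ≤ C_k ≤ b k.
≤Mcol : ∀ {n C} b → Column n C → (∀ i → i < length C → C ‼ suc i ≤ b (suc i)) → Pointwise _≤_ C (Mcol b (length C))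
≤Mcol {C = C} b col f = ‼⇒Pointwise C (Mcol b c) (sym (Mcol-length b c))
    (λ i lt → subst (C ‼ suc i ≤_) (sym (Mcol-‼ b c (s≤s z≤n) lt)) (M-greatest b lt (λ k lo hi → bnd i k lo hi)))
  where
  c = length C
  bnd : ∀ i k → suc i ≤ k → k ≤ c → C ‼ suc i + k ≤ b k + suc i
  bnd i (suc k) (s≤s lo) hi with m≤n⇒∃[o]m+o≡n lo
  ... | d , refl = linear 0 (≤-trans (sorted-‼-gap (sorted col) i d hi) (f (i + d) hi))
      (shape (C ‼ suc i) d i (b (suc (i + d))))
    where
    shape : ∀ x d i y → x + suc (i + d) + y + 0 ≡ y + suc i + (x + d)
    shape x d i y = solve (x L.∷ d L.∷ i L.∷ y L.∷ L.[])

record BoundedBy {n} (β : Vec ℕ n) (cs : List ℕ) (S : Tableau) : Set where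
  constructor bounded
  field
    tableau : SSYT n cs S
    bounds : All (λ C → ∀ i → i < length C → C ‼ suc i ≤ β ! suc i) S

length-toList : ∀ {n} (v : Vec ℕ n) → length (toList v) ≡ n
length-toList []ᵥ = refl
length-toList (x ∷ᵥ v) = cong suc (length-toList v)

lengths≤ : ∀ {n cs S} → (∀ {c} → c ∈ cs → c ≤ n) → SSYT n cs S → All (λ C → length C ≤ n) S
lengths≤ le s = All.tabulate (λ m → le (subst (_ ∈_) (SSYT.lens s) (∈-map⁺ length m)))

inS⁻ : ∀ {n} (lam β : Vec ℕ n) S → T (inS lam β S) → BoundedBy β (colLens lam) S
inS⁻ {n} lam β S t = bounded s (All.zipWith (λ {C} → conv C) (lengths≤ (∈colLens⇒≤n lam) s , Allₚ.all⁺ _ S (proj₂ (∧⁻ {isSSYT lam S} t))))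
  where
  s = isSSYT⇒SSYT lam S (proj₁ (∧⁻ t))
  conv : ∀ C → length C ≤ n × T (and (zipWith _≤ᵇ_ C (toList β))) → ∀ i → i < length C → C ‼ suc i ≤ β ! suc i
  conv C (le , u) i lt = subst (C ‼ suc i ≤_) (‼-toList β (suc i))
    (zip≤⇒‼ C (toList β) (subst (length C ≤_) (sym (length-toList β)) le) u i lt)

inS⁺ : ∀ {n} (lam β : Vec ℕ n) {S} → BoundedBy β (colLens lam) S → T (inS lam β S)
inS⁺ lam β (bounded s bs) = ∧⁺ (SSYT⇒isSSYT lam s) (Allₚ.all⁻ _ (All.map (λ {C} → conv C) bs))
  where
  conv : ∀ C → (∀ i → i < length C → C ‼ suc i ≤ β ! suc i) → T (and (zipWith _≤ᵇ_ C (toList β)))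
  conv C f = ‼⇒zip≤ C (toList β) (λ i lt _ → subst (C ‼ suc i ≤_) (sym (‼-toList β (suc i))) (f i lt))

-- Entrywise maxima of tableaux

Entrywise≤ : Tableau → Tableau → Set
Entrywise≤ = Pointwise (Pointwise _≤_)

zipWith-⊔-lub : ∀ {A B C} → Pointwise _≤_ A C → Pointwise _≤_ B C → Pointwise _≤_ (zipWith _⊔_ A B) C
zipWith-⊔-lub [] [] = []
zipWith-⊔-lub (p ∷ ps) (q ∷ qs) = ⊔-lub p q ∷ zipWith-⊔-lub ps qs

zipWith-⊔-left : ∀ {A B} → length A ≡ length B → Pointwise _≤_ A (zipWith _⊔_ A B)
zipWith-⊔-left {[]} {[]} _ = []
zipWith-⊔-left {a ∷ A} {b ∷ B} e = m≤m⊔n a b ∷ zipWith-⊔-left (suc-injective e)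

zipWith-⊔-right : ∀ {A B} → length A ≡ length B → Pointwise _≤_ B (zipWith _⊔_ A B)
zipWith-⊔-right {[]} {[]} _ = []
zipWith-⊔-right {a ∷ A} {b ∷ B} e = m≤n⊔m a b ∷ zipWith-⊔-right (suc-injective e)

maxTab-lub : ∀ {A B C} → Entrywise≤ A C → Entrywise≤ B C → Entrywise≤ (maxTab A B) C
maxTab-lub [] [] = []
maxTab-lub (p ∷ ps) (q ∷ qs) = zipWith-⊔-lub p q ∷ maxTab-lub ps qs

maxTab-left : ∀ {A B} → map length A ≡ map length B → Entrywise≤ A (maxTab A B)
maxTab-left {[]} {[]} _ = []
maxTab-left {a ∷ A} {b ∷ B} e = zipWith-⊔-left (proj₁ (∷-injective e)) ∷ maxTab-left (proj₂ (∷-injective e))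

maxTab-right : ∀ {A B} → map length A ≡ map length B → Entrywise≤ B (maxTab A B)
maxTab-right {[]} {[]} _ = []
maxTab-right {a ∷ A} {b ∷ B} e = zipWith-⊔-right (proj₁ (∷-injective e)) ∷ maxTab-right (proj₂ (∷-injective e))

Entrywise≤-shape : ∀ {A B} → Entrywise≤ A B → map length A ≡ map length B
Entrywise≤-shape [] = refl
Entrywise≤-shape (p ∷ ps) = cong₂ _∷_ (PW.Pointwise-length p) (Entrywise≤-shape ps)

Entrywise≤-antisym : ∀ {A B} → Entrywise≤ A B → Entrywise≤ B A → A ≡ B
Entrywise≤-antisym [] [] = refl
Entrywise≤-antisym (p ∷ ps) (q ∷ qs) = cong₂ _∷_ (col p q) (Entrywise≤-antisym ps qs)
  where
  col : ∀ {A B} → Pointwise _≤_ A B → Pointwise _≤_ B A → A ≡ B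
  col [] [] = refl
  col (p ∷ ps) (q ∷ qs) = cong₂ _∷_ (≤-antisym p q) (col ps qs)

-- `Q` is defined as a join over an enumeration, started from a tableau of zeros; a join whose upper
-- bound is one of its members equals that member.
foldr-maxTab : ∀ Z L Ss → Entrywise≤ Z L → (∀ {S} → S ∈ Ss → Entrywise≤ S L) → L ∈ Ss → foldr maxTab Z Ss ≡ L
foldr-maxTab Z L Ss z f m = Entrywise≤-antisym (below Ss f) (above Ss f m)
  where
  below : ∀ Ss → (∀ {S} → S ∈ Ss → Entrywise≤ S L) → Entrywise≤ (foldr maxTab Z Ss) L
  below [] f = z
  below (S ∷ Ss) f = maxTab-lub (f (here refl)) (below Ss (f ∘ there))
  -- `zipWith` truncates to the shorter argument, so a join is above its arguments only when their
  -- shapes agree.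
  same : ∀ S Ss → (∀ {R} → R ∈ S ∷ Ss → Entrywise≤ R L) → map length S ≡ map length (foldr maxTab Z Ss)
  same S Ss f = trans (Entrywise≤-shape (f (here refl))) (sym (Entrywise≤-shape (below Ss (f ∘ there))))
  above : ∀ Ss → (∀ {S} → S ∈ Ss → Entrywise≤ S L) → L ∈ Ss → Entrywise≤ L (foldr maxTab Z Ss)
  above (S ∷ Ss) f (here refl) = maxTab-left (same S Ss f)
  above (S ∷ Ss) f (there m) = PW.transitive (PW.transitive ≤-trans) (above Ss (f ∘ there) m) (maxTab-right (same S Ss f))

module RowBound {n} (lam β : Vec ℕ n) (up : IsUpper β) where
  private
    b  = β !_
    cs = colLens lam

  Mtab : Tableau
  Mtab = map (Mcol b) cs

  Mtab-bounded : BoundedBy β cs Mtab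
  Mtab-bounded = bounded
    (map-SSYT (Mcol b) (colLens-decreasing lam) (Mcol-column up ∘ ∈colLens⇒≤n lam) (λ {c} _ → Mcol-length b c) dom)
    (Allₚ.map⁺ (All.tabulate bnd))
    where
    bnd : ∀ {c} → c ∈ cs → ∀ i → i < length (Mcol b c) → Mcol b c ‼ suc i ≤ β ! suc i
    bnd {c} m i lt = let lt′ = subst (i <_) (Mcol-length b c) lt in
      subst (_≤ β ! suc i) (sym (Mcol-‼ b c (s≤s z≤n) lt′)) (M≤ up (s≤s z≤n) lt′ (∈colLens⇒≤n lam m))
    dom : ∀ {c d} → c ∈ cs → d ∈ cs → d ≤ c → Mcol b c ⊒ Mcol b d
    dom {c} {d} mc _ le = zip⇒⊒ (Mcol b c) (Mcol b d) (subst₂ _≤_ (sym (Mcol-length b d)) (sym (Mcol-length b c)) le)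
        (‼⇒zip≤ (Mcol b c) (Mcol b d) (λ i _ lt → row i (subst (i <_) (Mcol-length b d) lt)))
      where
      row : ∀ i → i < d → Mcol b c ‼ suc i ≤ Mcol b d ‼ suc i
      row i lt = subst₂ _≤_ (sym (Mcol-‼ b c (s≤s z≤n) (≤-trans lt le))) (sym (Mcol-‼ b d (s≤s z≤n) lt))
        (M-antitone up (s≤s z≤n) lt le (∈colLens⇒≤n lam mc))

  inS-below : ∀ S → T (inS lam β S) → Entrywise≤ S Mtab
  inS-below S t = go S cs (SSYT.lens s) (SSYT.cols s) bnds
    where
    open BoundedBy (inS⁻ lam β S t) renaming (tableau to s; bounds to bnds)
    go : ∀ S cs → map length S ≡ cs → All (Column n) S → All (λ C → ∀ i → i < length C → C ‼ suc i ≤ b (suc i)) S →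
      Entrywise≤ S (map (Mcol b) cs)
    go [] [] _ _ _ = []
    go (C ∷ S) (_ ∷ cs) refl (c ∷ cl) (f ∷ fs) = ≤Mcol b c f ∷ go S cs refl cl fs

  Mtab-inS : T (inS lam β Mtab)
  Mtab-inS = inS⁺ lam β Mtab-bounded

  Q≡Mtab : Q lam β ≡ Mtab
  Q≡Mtab = foldr-maxTab _ Mtab _ zeros
      (λ {S} m → inS-below S (proj₂ (∈-filter⁻ (T? ∘ inS lam β) {xs = fillings lam} m)))
      (∈-filter⁺ (T? ∘ inS lam β) (∈-fillings lam (BoundedBy.tableau Mtab-bounded)) Mtab-inS)
    where
    zero-col : ∀ c → Pointwise _≤_ (map (λ _ → 0) (range 1 c)) (Mcol b c)
    zero-col c = go (range 1 c)
      where
      go : ∀ xs → Pointwise _≤_ (map (λ _ → 0) xs) (map (M b c) xs)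
      go [] = []
      go (x ∷ xs) = z≤n ∷ go xs
    zeros : Entrywise≤ (map (λ c → map (λ _ → 0) (range 1 c)) cs) Mtab
    zeros = go cs
      where
      go : ∀ cs → Entrywise≤ (map (λ c → map (λ _ → 0) (range 1 c)) cs) (map (Mcol b) cs)
      go [] = []
      go (c ∷ cs) = zero-col c ∷ go cs

  -- Together with `inS-below`, this makes the row bound set the whole principal ideal below `Mtab`.
  -- A Demazure set need not be such an ideal, and 312-avoidance comes from this difference.
  inS⇔below : ∀ {S} → SSYT n cs S → Pointwise _⊒_ S Mtab → T (inS lam β S)
  inS⇔below {S} s pw = inS⁺ lam β (bounded s (go S cs (SSYT.lens s) (SSYT.cols s) (∈colLens⇒≤n lam) pw))
    where
    go : ∀ S cs → map length S ≡ cs → All (Column n) S → (∀ {c} → c ∈ cs → c ≤ n) → Pointwise _⊒_ S (map (Mcol b) cs) →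
      All (λ C → ∀ i → i < length C → C ‼ suc i ≤ b (suc i)) S
    go [] [] _ _ _ _ = []
    go (C ∷ S) (_ ∷ cs) refl (c ∷ cl) le (p ∷ ps) = bnd ∷ go S cs refl cl (le ∘ there) ps
      where
      k = length C
      bnd : ∀ i → i < k → C ‼ suc i ≤ b (suc i)
      bnd i lt = ≤-trans (zip≤⇒‼ C (Mcol b k) (≤-reflexive (sym (Mcol-length b k)))
          (⊒⇒zip (sorted c) (sorted (Mcol-column up (le (here refl)))) p) i lt)
        (subst (_≤ b (suc i)) (sym (Mcol-‼ b k (s≤s z≤n) lt)) (M≤ up (s≤s z≤n) lt (le (here refl))))

  initial-inS : T (inS lam β (initial cs))
  initial-inS = inS⇔below (initial-SSYT lam) (initial-⊒ (BoundedBy.tableau Mtab-bounded))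

-- Carrels and critical indices

-- The number of entries below i is the place where the sorted list crosses i; this converts the
-- count that defines `carrel` into the two ends of the carrel.
sorted-split : ∀ {L} i → Sorted L → let h = # (_<ᵇ i) L in
  (∀ j → j < h → L ‼ suc j < i) × (∀ j → h ≤ j → j < length L → i ≤ L ‼ suc j)
sorted-split {[]} i _ = (λ _ ()) , (λ _ _ ())
sorted-split {x ∷ L} i (a ∷ s) rewrite #-cons (_<ᵇ i) x L with x <? i
... | yes lt rewrite ind-true (<⇒<ᵇ lt) = lo , hi
  where
  lo : ∀ j → j < suc (# (_<ᵇ i) L) → (x ∷ L) ‼ suc j < i
  lo zero _ = lt
  lo (suc j) p = proj₁ (sorted-split i s) j (≤-pred p)
  hi : ∀ j → suc (# (_<ᵇ i) L) ≤ j → j < suc (length L) → i ≤ (x ∷ L) ‼ suc j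
  hi (suc j) p q = proj₂ (sorted-split i s) j (≤-pred p) (≤-pred q)
... | no ¬lt rewrite ind-false (¬lt ∘ <ᵇ⇒< x i)
  | #-none (_<ᵇ i) L (λ {y} m t → ¬lt (<-trans (All.lookup a m) (<ᵇ⇒< y i t))) = (λ _ ()) , hi
  where
  hi : ∀ j → 0 ≤ j → j < suc (length L) → i ≤ (x ∷ L) ‼ suc j
  hi zero _ _ = ≮⇒≥ ¬lt
  hi (suc j) _ q = ≤-trans (≮⇒≥ ¬lt) (<⇒≤ (All.lookup a (‼-∈ L (≤-pred q))))

‼-last : ∀ xs x → (xs ++ x ∷ []) ‼ suc (length xs) ≡ x
‼-last [] x = refl
‼-last (y ∷ xs) x = ‼-last xs x

foldr-⊓-∈ : ∀ e xs → foldr _⊓_ e xs ∈ e ∷ xs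
foldr-⊓-∈ e [] = here refl
foldr-⊓-∈ e (x ∷ xs) with ⊓-sel x (foldr _⊓_ e xs) | foldr-⊓-∈ e xs
... | inj₁ eq | _ = there (here eq)
... | inj₂ eq | here eq′ = here (trans eq eq′)
... | inj₂ eq | there m = there (there (subst (_∈ xs) (sym eq) m))

foldr-⊓-≤ : ∀ e xs {y} → y ∈ e ∷ xs → foldr _⊓_ e xs ≤ y
foldr-⊓-≤ e [] (here refl) = ≤-refl
foldr-⊓-≤ e (x ∷ xs) (here refl) = ≤-trans (m⊓n≤n x _) (foldr-⊓-≤ e xs (here refl))
foldr-⊓-≤ e (x ∷ xs) (there (here refl)) = m⊓n≤m x _
foldr-⊓-≤ e (x ∷ xs) (there (there m)) = ≤-trans (m⊓n≤n x _) (foldr-⊓-≤ e xs (there m))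

AllPairs-reverse : ∀ {A : Set} {R : A → A → Set} {xs} → AllPairs (λ x y → R y x) xs → AllPairs R (reverse xs)
AllPairs-reverse [] = []
AllPairs-reverse {R = R} {x ∷ xs} (a ∷ p) = subst (AllPairs R) (sym (unfold-reverse x xs))
  (AllPairsₚ.++⁺ (AllPairs-reverse p) ([] ∷ []) (All.tabulate (λ m → All.lookup a (Anyₚ.reverse⁻ m) ∷ [])))

tabulate-! : ∀ {n} (g : ℕ → ℕ) {i} → 1 ≤ i → i ≤ n → tabulate {n = n} (λ k → g (suc (toℕ k))) ! i ≡ g i
tabulate-! {n} g {suc i} _ lt = subst (λ j → tabulate {n = n} (λ k → g (suc (toℕ k))) ! suc j ≡ g (suc j)) (toℕ-fromℕ< lt)
  (!-tabulate (λ k → g (suc (toℕ k))) (fromℕ< lt))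

module Carrels {n} (1≤n : 1 ≤ n) (lam : Vec ℕ n) where
  r = rOf lam
  ends = Rlam lam ++ (n ∷ [])

  ∈Rlam⁻ : ∀ {c} → c ∈ Rlam lam → (1 ≤ c × c ≤ n ∸ 1) × c ∈ colLens lam
  ∈Rlam⁻ {c} m = let a , t = ∈-filter⁻ (T? ∘ (_∈ᵇ colLens lam)) {xs = range 1 (n ∸ 1)} m in
    ∈-range⁻ a , ∈ᵇ⇒∈ {c} {colLens lam} t

  n∸1<n : n ∸ 1 < n
  n∸1<n = ≤-reflexive (trans (+-comm 1 (n ∸ 1)) (m∸n+n≡m 1≤n))

  ends-sorted : Sorted ends
  ends-sorted = AllPairsₚ.++⁺ (AllPairsₚ.filter⁺ (T? ∘ _) (sorted-range (n ∸ 1))) ([] ∷ [])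
    (All.tabulate (λ m → ≤-<-trans (proj₂ (proj₁ (∈Rlam⁻ m))) n∸1<n ∷ []))

  ends-length : length ends ≡ suc r
  ends-length = trans (length-++ (Rlam lam)) (+-comm r 1)

  q-last : q lam (suc r) ≡ n
  q-last = ‼-last (Rlam lam) n

  q-∈ : ∀ {j} → j ≤ r → q lam (suc j) ∈ ends
  q-∈ le = ‼-∈ ends (subst (_ <_) (sym ends-length) (s≤s le))

  ends-bounds : ∀ {c} → c ∈ ends → 1 ≤ c × c ≤ n
  ends-bounds m with ∈-++⁻ (Rlam lam) m
  ... | inj₁ m′ = let (p , q) , _ = ∈Rlam⁻ m′ in p , ≤-trans q (m∸n≤m n 1)
  ... | inj₂ (here refl) = 1≤n , ≤-refl

  1≤q : ∀ {j} → j ≤ r → 1 ≤ q lam (suc j)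
  1≤q le = proj₁ (ends-bounds (q-∈ le))

  q≤n : ∀ {h} → h ≤ suc r → q lam h ≤ n
  q≤n {zero} _ = z≤n
  q≤n {suc j} le = proj₂ (ends-bounds (q-∈ (≤-pred le)))

  q-step : ∀ {j} → j ≤ r → q lam j < q lam (suc j)
  q-step {zero} le = 1≤q le
  q-step {suc j} le = sorted-‼-suc ends-sorted j (subst (suc j <_) (sym ends-length) (s≤s le))

  q-mono : ∀ {g h} → g ≤ h → h ≤ suc r → q lam g ≤ q lam h
  q-mono {zero} _ _ = z≤n
  q-mono {suc g} {suc h} le le′ = sorted-‼-mono ends-sorted (≤-pred le) (subst (h <_) (sym ends-length) le′)

  q∈colLens : ∀ {j} → suc j ≤ r → q lam (suc j) ∈ colLens lam × q lam (suc j) < n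
  q∈colLens {j} le with ∈-++⁻ (Rlam lam) (q-∈ {j} (<⇒≤ le))
  ... | inj₁ m = proj₂ (∈Rlam⁻ m) , ≤-<-trans (proj₂ (proj₁ (∈Rlam⁻ m))) n∸1<n
  ... | inj₂ (here e) = ⊥-elim (<⇒≱ (<-≤-trans (q-step le) (q≤n (s≤s le))) (≤-reflexive (sym e)))

  colLens⇒q : ∀ {c} → c ∈ colLens lam → ∃[ j ] (j ≤ r × c ≡ q lam (suc j))
  colLens⇒q {c} m = result (∈-‼ mem)
    where
    pos : 1 ≤ c
    pos with ∈-map⁻ (colLen lam) m
    ... | j , mj , refl = #-pos⁺ (λ i → j ≤ᵇ lam ! i) (∈-range⁺ {n} ≤-refl 1≤n) (≤⇒≤ᵇ (proj₂ (∈-range⁻ mj)))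
    mem : c ∈ ends
    mem with m≤n⇒m<n∨m≡n (∈colLens⇒≤n lam m)
    ... | inj₂ refl = ∈-++⁺ʳ (Rlam lam) (here refl)
    ... | inj₁ lt = ∈-++⁺ˡ (∈-filter⁺ (T? ∘ (_∈ᵇ colLens lam)) (∈-range⁺ pos (∸-monoˡ-≤ 1 lt)) (∈⇒∈ᵇ m))
    result : ∃[ j ] (j < length ends × ends ‼ suc j ≡ c) → ∃[ j ] (j ≤ r × c ≡ q lam (suc j))
    result (j , lt , e) = j , ≤-pred (subst (j <_) ends-length lt) , sym e

  -- Carrels are indexed here by their left end q_j, so this is carrel j + 1 in the numbering of
  -- `carrel`; no predecessor of an index is needed.
  record InCarrel (i j : ℕ) : Set where
    constructor inCarrel
    field
      j≤r : j ≤ r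
      lo  : q lam j < i
      hi  : i ≤ q lam (suc j)
  open InCarrel public

  locate : ∀ {i} → 1 ≤ i → i ≤ n → ∃[ j ] (InCarrel i j × carrel lam i ≡ suc j)
  locate {i} 1≤i i≤n = j , inCarrel j≤r′ low (proj₂ split j (≤-reflexive (sym j≡)) (subst (j <_) (sym ends-length) (s≤s j≤r′)))
      , trans (#-cons (_<ᵇ i) 0 (Rlam lam)) (cong (_+ j) (ind-true (<⇒<ᵇ 1≤i)))
    where
    j = # (_<ᵇ i) (Rlam lam)
    j≤r′ = #≤length (_<ᵇ i) (Rlam lam)
    -- The final end n is never below i, so appending it leaves the count unchanged; the leading 0
    -- in `carrel` always is, which gives the shift by one.
    j≡ : j ≡ # (_<ᵇ i) ends
    j≡ = sym (trans (#-++ (_<ᵇ i) (Rlam lam) (n ∷ [])) (trans (cong (j +_)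
      (#-none (_<ᵇ i) (n ∷ []) (λ { (here refl) t → <⇒≱ (<ᵇ⇒< n i t) i≤n }))) (+-identityʳ j)))
    split = sorted-split i ends-sorted
    low : q lam j < i
    low = go j ≤-refl
      where
      go : ∀ k → k ≤ j → q lam k < i
      go zero _ = 1≤i
      go (suc k) le = proj₁ split k (subst (suc k ≤_) j≡ le)

  carrel-unique : ∀ {i j k} → InCarrel i j → InCarrel i k → j ≡ k
  carrel-unique {i} {j} {k} a b with <-cmp j k
  ... | tri≈ _ e _ = e
  ... | tri< lt _ _ = ⊥-elim (<⇒≱ (≤-<-trans (q-mono lt (m≤n⇒m≤1+n (j≤r b))) (lo b)) (hi a))
  ... | tri> _ _ gt = ⊥-elim (<⇒≱ (≤-<-trans (q-mono gt (m≤n⇒m≤1+n (j≤r a))) (lo a)) (hi b))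

  InCarrel⇒≥1 : ∀ {i j} → InCarrel i j → 1 ≤ i
  InCarrel⇒≥1 c = ≤-trans (s≤s z≤n) (lo c)

  InCarrel⇒≤n : ∀ {i j} → InCarrel i j → i ≤ n
  InCarrel⇒≤n c = ≤-trans (hi c) (q≤n (s≤s (j≤r c)))

  carrel≡ : ∀ {i j} → InCarrel i j → carrel lam i ≡ suc j
  carrel≡ c with locate (InCarrel⇒≥1 c) (InCarrel⇒≤n c)
  ... | k , c′ , e = trans e (cong suc (carrel-unique c′ c))

-- Critical indices without the recursion: x is critical exactly when b_x - x is strictly smaller
-- than b_k - k for every later k in the carrel, that is, a strict record of this difference read
-- from the right.
record Record (b : ℕ → ℕ) (lo hi x : ℕ) : Set where
  constructor record⁺
  field
    above : lo < x
    below : x ≤ hi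
    least : ∀ k → x < k → k ≤ hi → b x + k < b k + x

Record-≤ : ∀ {b lo hi x} → Record b lo hi x → ∀ k → x ≤ k → k ≤ hi → b x + k ≤ b k + x
Record-≤ rec k le hi with m≤n⇒m<n∨m≡n le
... | inj₁ lt   = <⇒≤ (Record.least rec k lt hi)
... | inj₂ refl = ≤-refl

module _ {n} (β : Vec ℕ n) (lo hi : ℕ) where
  private b = β !_

  -- The invariant says that the last critical index p minimizes b_j - j over the part already
  -- scanned, so an index that beats p beats all of that part.
  critScan-sound : ∀ p k → k < p → (∀ j → k < j → j ≤ hi → b p + j ≤ b j + p) → k ≤ hi →
    ∀ {x} → x ∈ critScan β lo p k → x ≤ k × Record b lo hi x
  critScan-sound p (suc k) k<p inv k≤hi m with lo <ᵇ suc k in e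
  ... | true with b (suc k) + p <ᵇ b p + suc k in e′
  ...   | false = let le , rec = critScan-sound p k (<⇒≤ k<p) inv′ (<⇒≤ k≤hi) m in m≤n⇒m≤1+n le , rec
    where
    inv′ : ∀ j → k < j → j ≤ hi → b p + j ≤ b j + p
    inv′ j lt le with m≤n⇒m<n∨m≡n lt
    ... | inj₁ lt′ = inv j lt′ le
    ... | inj₂ refl = ≮⇒≥ (λ l → subst T e′ (<⇒<ᵇ l))
  ...   | true with m
  ...     | here refl = ≤-refl , record⁺ (<ᵇ⇒< lo (suc k) (≡⇒T e)) k≤hi new
    where
    new : ∀ j → suc k < j → j ≤ hi → b (suc k) + j < b j + suc k
    new j lt le = linear 0 (+-mono-≤ (<ᵇ⇒< (b (suc k) + p) (b p + suc k) (≡⇒T e′)) (inv j lt le)) (shape (b (suc k)) p (b p) k j (b j))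
      where
      shape : ∀ x p y k j z → suc (x + j) + (y + suc k + (z + p)) + 0 ≡ z + suc k + (suc (x + p) + (y + j))
      shape x p y k j z = solve (x L.∷ p L.∷ y L.∷ k L.∷ j L.∷ z L.∷ L.[])
  ...     | there m′ = let le , rec = critScan-sound (suc k) k ≤-refl inv′ (<⇒≤ k≤hi) m′ in m≤n⇒m≤1+n le , rec
    where
    inv′ : ∀ j → k < j → j ≤ hi → b (suc k) + j ≤ b j + suc k
    inv′ j lt le with m≤n⇒m<n∨m≡n lt
    ... | inj₂ refl = ≤-refl
    ... | inj₁ lt′ = linear 1 (+-mono-≤ (<ᵇ⇒< (b (suc k) + p) (b p + suc k) (≡⇒T e′)) (inv j lt′ le)) (shape (b (suc k)) p (b p) k j (b j))
      where
      shape : ∀ x p y k j z → x + j + (y + suc k + (z + p)) + 1 ≡ z + suc k + (suc (x + p) + (y + j))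
      shape x p y k j z = solve (x L.∷ p L.∷ y L.∷ k L.∷ j L.∷ z L.∷ L.[])

  -- A record beats every later index, in particular whichever p is current when the scan reaches
  -- it, so it is never passed over.
  critScan-complete : ∀ p k → k < p → p ≤ hi → ∀ {x} → Record b lo hi x → x ≤ k → x ∈ critScan β lo p k
  critScan-complete p zero _ _ rec x≤k = ⊥-elim (<⇒≱ (Record.above rec) (≤-trans x≤k z≤n))
  critScan-complete p (suc k) k<p p≤hi {x} rec x≤k
    rewrite T⇒≡ (<⇒<ᵇ (<-≤-trans (Record.above rec) x≤k)) with m≤n⇒m<n∨m≡n x≤k
  ... | inj₂ refl rewrite T⇒≡ (<⇒<ᵇ (Record.least rec p k<p p≤hi)) = here refl
  ... | inj₁ x<k with b (suc k) + p <ᵇ b p + suc k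
  ...   | true  = there (critScan-complete (suc k) k ≤-refl (≤-trans (<⇒≤ k<p) p≤hi) rec (≤-pred x<k))
  ...   | false = critScan-complete p k (<⇒≤ k<p) p≤hi rec (≤-pred x<k)

  critScan-decreasing : ∀ p k → k < p → AllPairs _>_ (critScan β lo p k) × (∀ {x} → x ∈ critScan β lo p k → x ≤ k)
  critScan-decreasing p zero _ = [] , λ ()
  critScan-decreasing p (suc k) k<p with lo <ᵇ suc k
  ... | false = [] , λ ()
  ... | true with b (suc k) + p <ᵇ b p + suc k
  ...   | false = let d , f = critScan-decreasing p k (<⇒≤ k<p) in d , m≤n⇒m≤1+n ∘ f
  ...   | true  = let d , f = critScan-decreasing (suc k) k ≤-refl in
    All.tabulate (s≤s ∘ f) ∷ d , λ { (here refl) → ≤-refl ; (there m) → m≤n⇒m≤1+n (f m) }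

module Criticals {n} (1≤n : 1 ≤ n) (lam β : Vec ℕ n) where
  open Carrels 1≤n lam
  private b = β !_

  Critical : ℕ → ℕ → Set
  Critical j = Record b (q lam j) (q lam (suc j))

  q-critical : ∀ {j} → j ≤ r → Critical j (q lam (suc j))
  q-critical le = record⁺ (q-step le) ≤-refl (λ k lt le → ⊥-elim (<⇒≱ lt le))

  private
    q∸1<q : ∀ {j} → j ≤ r → q lam (suc j) ∸ 1 < q lam (suc j)
    q∸1<q le = ≤-reflexive (trans (+-comm 1 _) (m∸n+n≡m (1≤q le)))

  crits-sound : ∀ {j x} → j ≤ r → x ∈ crits lam β (suc j) → Critical j x
  crits-sound le (here refl) = q-critical le
  crits-sound {j} le (there m) = proj₂ (critScan-sound β (q lam j) (q lam (suc j)) _ _ (q∸1<q le) only-q (m∸n≤m _ 1) m)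
    where
    only-q : ∀ k → q lam (suc j) ∸ 1 < k → k ≤ q lam (suc j) → b (q lam (suc j)) + k ≤ b k + q lam (suc j)
    only-q k lt le′ with ≤-antisym le′ (≤-trans (≤-reflexive (trans (sym (m∸n+n≡m (1≤q le))) (+-comm _ 1))) lt)
    ... | refl = ≤-refl

  crits-complete : ∀ {j x} → j ≤ r → Critical j x → x ∈ crits lam β (suc j)
  crits-complete {j} le rec with m≤n⇒m<n∨m≡n (Record.below rec)
  ... | inj₂ refl = here refl
  ... | inj₁ lt   = there (critScan-complete β (q lam j) (q lam (suc j)) _ _ (q∸1<q le) ≤-refl rec (∸-monoˡ-≤ 1 lt))

  crits-decreasing : ∀ {j} → j ≤ r → AllPairs _>_ (crits lam β (suc j))
  crits-decreasing {j} le =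
    let d , f = critScan-decreasing β (q lam j) (q lam (suc j)) (q lam (suc j)) (q lam (suc j) ∸ 1) (q∸1<q le)
    in All.tabulate (λ m → ≤-<-trans (f m) (q∸1<q le)) ∷ d

  Critical-mono : ∀ {j x y} → Critical j x → x ≤ y → y ≤ q lam (suc j) → b x ≤ b y
  Critical-mono {j} {x} {y} rec le hi = +-cancelʳ-≤ x _ _ (≤-trans (+-monoʳ-≤ (b x) le) (Record-≤ rec y le hi))

  record CritAbove (i j x : ℕ) : Set where
    field
      critical : Critical j x
      i≤x      : i ≤ x
      least    : ∀ k → i ≤ k → k ≤ q lam (suc j) → b x + k ≤ b k + x
      first    : ∀ {y} → Critical j y → i ≤ y → x ≤ y

  -- For `least`: the rightmost k beating x would itself be a record, hence not before x by the
  -- choice of x, and from x on the record property of x forbids it. The induction descends from the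
  -- carrel end.
  critAbove-spec : ∀ {i j} → InCarrel i j → CritAbove i j (critAbove lam β i)
  critAbove-spec {i} {j} ic rewrite carrel≡ ic = record
    { critical = crits-sound (j≤r ic) (proj₁ x∈) ; i≤x = proj₂ x∈
    ; least = λ k lo hi → least (H ∸ k) k (m+[n∸m]≡n hi) lo k ≤-refl hi
    ; first = λ rec le → first (crits-complete (j≤r ic) rec) le }
    where
    H  = q lam (suc j)
    cs = crits lam β (suc j)
    xs = filterᵇ (λ x → i ≤ᵇ x) cs
    x  = foldr _⊓_ H xs
    -- The default value of the fold is the carrel end, which is itself critical and not below i.
    x∈ : x ∈ cs × i ≤ x
    x∈ with foldr-⊓-∈ H xs
    ... | here e = subst (_∈ cs) (sym e) (here refl) , subst (i ≤_) (sym e) (hi ic)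
    ... | there m = let p , t = ∈-filter⁻ (T? ∘ (λ x → i ≤ᵇ x)) {xs = cs} m in p , ≤ᵇ⇒≤ i x t
    first : ∀ {y} → y ∈ cs → i ≤ y → x ≤ y
    first m le = foldr-⊓-≤ H xs (there (∈-filter⁺ (T? ∘ (λ x → i ≤ᵇ x)) m (≤⇒≤ᵇ le)))
    least : ∀ d k → k + d ≡ H → i ≤ k → ∀ m → k ≤ m → m ≤ H → b x + m ≤ b m + x
    step : ∀ k → i ≤ k → k ≤ H → (∀ m → k < m → m ≤ H → b x + m ≤ b m + x) → b x + k ≤ b k + x
    least zero k e lo m p hi = step m (≤-trans lo p) hi
      (λ m′ lt le → ⊥-elim (<⇒≱ lt (≤-trans le (≤-trans (≤-reflexive (trans (sym e) (+-identityʳ k))) p))))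
    least (suc d) k e lo m p hi with m≤n⇒m<n∨m≡n p
    ... | inj₁ lt = least d (suc k) (trans (sym (+-suc k d)) e) (m≤n⇒m≤1+n lo) m lt hi
    ... | inj₂ refl = step k lo hi (λ m′ → least d (suc k) (trans (sym (+-suc k d)) e) (m≤n⇒m≤1+n lo) m′)
    step k lo′ k≤H later with b x + k ≤? b k + x
    ... | yes p = p
    ... | no ¬p = ⊥-elim (¬p (Record-≤ (crits-sound (j≤r ic) (proj₁ x∈)) k (first (crits-complete (j≤r ic) new) lo′) k≤H))
      where
      new : Critical j k
      new = record⁺ (<-≤-trans (lo ic) lo′) k≤H (λ m lt le → linear 0 (+-mono-≤ (≰⇒> ¬p) (later m lt le)) (shape (b k) m (b x) (b m) k x))
        where
        shape : ∀ bk m bx bm k x → suc (bk + m) + (bx + k + (bm + x)) + 0 ≡ bm + k + (suc (bk + x) + (bx + m))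
        shape bk m bx bm k x = solve (bk L.∷ m L.∷ bx L.∷ bm L.∷ k L.∷ x L.∷ L.[])

  -- Inside a carrel critical entries increase by themselves, so the condition on all critical
  -- entries reduces to comparing each carrel end with the critical entries of the next carrel.
  record Adjacent : Set where
    constructor adjacent
    field ≤-next : ∀ j → suc j ≤ r → ∀ {y} → Critical (suc j) y → b (q lam (suc j)) ≤ b y

  -- The all-pairs form is proved because it splits along the concatenation into pairs inside one
  -- carrel and pairs across two.
  Adjacent⇒UGC : IsUpper β → Adjacent → InUGC lam β
  Adjacent⇒UGC up (adjacent adj) = up , AllPairs⇒Linked (AllPairsₚ.map⁺ (subst (AllPairs R ∘ concat) (sym (map-range f (suc r)))
      (AllPairsₚ.concat⁺ (Allₚ.applyUpTo⁺₁ (f ∘ suc) (suc r) inside)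
        (AllPairsₚ.applyUpTo⁺₁ (f ∘ suc) (suc r) across))))
    where
    R : ℕ → ℕ → Set
    R x y = b x ≤ b y
    f = λ h → reverse (crits lam β h)
    inside : ∀ {j} → j < suc r → AllPairs R (f (suc j))
    inside {j} lt = AllPairs-reverse (AllPairs-∈ (λ mx my y<x →
      Critical-mono (crits-sound (≤-pred lt) my) (<⇒≤ y<x) (Record.below (crits-sound (≤-pred lt) mx))) (crits-decreasing (≤-pred lt)))
    ends-mono : ∀ j k → suc j ≤ k → k ≤ r → b (q lam (suc j)) ≤ b (q lam k)
    ends-mono j (suc k) le le′ with m≤n⇒m<n∨m≡n le
    ... | inj₂ refl = ≤-refl
    ends-mono j (suc (suc k)) le le′ | inj₁ lt = ≤-trans (ends-mono j (suc k) (≤-pred lt) (<⇒≤ le′))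
      (adj k (<⇒≤ le′) (q-critical {suc k} (<⇒≤ le′)))
    ends-mono j (suc zero) le le′ | inj₁ (s≤s ())
    between : ∀ j k → suc j ≤ k → k ≤ r → ∀ {x y} → Critical j x → Critical k y → b x ≤ b y
    between j (suc k) le le′ cx cy = ≤-trans (Critical-mono cx (Record.below cx) ≤-refl)
      (≤-trans (ends-mono j (suc k) le le′) (adj k le′ cy))
    across : ∀ {j k} → j < k → k < suc r → All (λ x → All (R x) (f (suc k))) (f (suc j))
    across {j} {k} lt lt′ = All.tabulate (λ mx → All.tabulate (λ my →
      between j k lt (≤-pred lt′) (crits-sound (<⇒≤ (<-≤-trans lt (≤-pred lt′))) (Anyₚ.reverse⁻ mx)) (crits-sound (≤-pred lt′) (Anyₚ.reverse⁻ my))))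

  module _ (up : IsUpper β) where

    descend : ℕ → ℕ
    descend i = (β ! critAbove lam β i) ∸ (critAbove lam β i ∸ i)

    -- Upperness gives x ≤ b x at the critical index, so the truncated subtraction in `Δ` is exact.
    descend-+ : ∀ {i j} → InCarrel i j → descend i + critAbove lam β i ≡ b (critAbove lam β i) + i
    descend-+ {i} {j} ic = begin
      (b x ∸ d) + x ≡⟨ cong ((b x ∸ d) +_) (m∸n+n≡m i≤x) ⟨
      (b x ∸ d) + (d + i) ≡⟨ +-assoc (b x ∸ d) d i ⟨
      (b x ∸ d) + d + i ≡⟨ cong (_+ i) (m∸n+n≡m (≤-trans (m∸n≤m x i) x≤b)) ⟩
      b x + i ∎
      where
      open ≡-Reasoning
      x = critAbove lam β i
      d = x ∸ i
      open CritAbove (critAbove-spec ic)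
      x≤b : x ≤ b x
      x≤b = proj₁ (up x (≤-trans (InCarrel⇒≥1 ic) i≤x) (≤-trans (Record.below critical) (q≤n (s≤s (j≤r ic)))))

    Δ-! : ∀ {i} → 1 ≤ i → i ≤ n → Δ lam β ! i ≡ descend i
    Δ-! = tabulate-! descend

    -- The minimum over k in `M` is attained at the first critical index from i on. Thus `Δ` reads,
    -- on each carrel, from the largest bounded column that ends with this carrel.
    descend≡M : ∀ {i j} → InCarrel i j → descend i ≡ M b (q lam (suc j)) i
    descend≡M {i} {j} ic = ≤-antisym
        (M-greatest b (hi ic) (λ k lo hi → linear 0 (+-mono-≤ (≤-reflexive (descend-+ ic)) (least k lo hi)) (shape (descend i) k (b x) i (b k) x)))
        (+-cancelʳ-≤ x _ _ (≤-trans (M-≤ up (InCarrel⇒≥1 ic) (q≤n (s≤s (j≤r ic))) x i≤x (Record.below critical)) (≤-reflexive (sym (descend-+ ic)))))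
      where
      x = critAbove lam β i
      open CritAbove (critAbove-spec ic)
      shape : ∀ v k bx i bk x → v + k + (bx + i + (bk + x)) + 0 ≡ bk + i + (v + x + (bx + k))
      shape v k bx i bk x = solve (v L.∷ k L.∷ bx L.∷ i L.∷ bk L.∷ x L.∷ L.[])

    Δ≡M : ∀ {i j} → InCarrel i j → Δ lam β ! i ≡ M b (q lam (suc j)) i
    Δ≡M ic = trans (Δ-! (InCarrel⇒≥1 ic) (InCarrel⇒≤n ic)) (descend≡M ic)

    Δ-UI : InUI lam (Δ lam β)
    Δ-UI = upper , increasing
      where
      upper : IsUpper (Δ lam β)
      upper i p le with locate p le
      ... | j , ic , _ = subst (λ z → (i ≤ z) × (z ≤ n)) (sym (Δ≡M ic))
        (i≤M up p (hi ic) q≤ , ≤-trans (M≤ up p (hi ic) q≤) (proj₂ (up i p le)))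
        where q≤ = q≤n (s≤s (j≤r ic))
      increasing : ∀ i j → 1 ≤ i → i < j → j ≤ n → carrel lam i ≡ carrel lam j → Δ lam β ! i < Δ lam β ! j
      increasing i j p lt le e with locate p (≤-trans (<⇒≤ lt) le) | locate (≤-trans p (<⇒≤ lt)) le
      ... | g , ic , e₁ | h , jc , e₂ with suc-injective (trans (sym e₁) (trans e e₂))
      ... | refl = subst₂ _<_ (sym (Δ≡M ic)) (sym (Δ≡M jc)) (M-strict up p lt (hi jc) (q≤n (s≤s (j≤r ic))))

    -- A column bounded by β on critical indices is bounded by β, since C_i ≤ C_x − (x − i).
    bounded-transfer : ∀ (τ : Vec ℕ n) → (∀ {i j} → InCarrel i j → τ ! critAbove lam β i ≤ b (critAbove lam β i)) →
      (∀ {i j} → InCarrel i j → descend i ≤ τ ! i) → ∀ S → inS lam β S ≡ inS lam τ S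
    bounded-transfer τ same above S = T-ext (transfer β τ (λ _ → ≤-refl) above) (transfer τ β same below)
      where
      below : ∀ {i j} → InCarrel i j → descend i ≤ b i
      below {i} {j} ic = subst (_≤ b i) (sym (descend≡M ic)) (M≤ up (InCarrel⇒≥1 ic) (hi ic) (q≤n (s≤s (j≤r ic))))
      transfer : ∀ (σ ρ : Vec ℕ n) → (∀ {i j} → InCarrel i j → σ ! critAbove lam β i ≤ b (critAbove lam β i)) →
        (∀ {i j} → InCarrel i j → descend i ≤ ρ ! i) → T (inS lam σ S) → T (inS lam ρ S)
      transfer σ ρ f g t = inS⁺ lam ρ (bounded s (All.tabulate bnd))
        where
        open BoundedBy (inS⁻ lam σ S t) renaming (tableau to s; bounds to bnds)
        bnd : ∀ {C} → C ∈ S → ∀ i → i < length C → C ‼ suc i ≤ ρ ! suc i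
        bnd {C} m i lt with colLens⇒q (subst (length C ∈_) (SSYT.lens s) (∈-map⁺ length m))
                          | locate {suc i} (s≤s z≤n) (≤-trans lt (All.lookup (lengths≤ (∈colLens⇒≤n lam) s) m))
        ... | h , h≤r , e | j , ic , _ = go (critAbove lam β (suc i)) refl
          where
          go : ∀ x → x ≡ critAbove lam β (suc i) → C ‼ suc i ≤ ρ ! suc i
          go x refl with m≤n⇒∃[o]m+o≡n (CritAbove.i≤x (critAbove-spec ic))
          ... | d , e′ = ≤-trans (+-cancelʳ-≤ x _ _ (≤-trans C≤ (≤-reflexive (sym (descend-+ ic))))) (g ic)
            where
            open CritAbove (critAbove-spec ic)
            -- Column lengths are carrel ends, so a column that reaches row i + 1 runs through the
            -- whole carrel of that row and contains row x.
            x≤ : suc (i + d) ≤ length C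
            x≤ = subst (_≤ length C) (sym e′) (≤-trans (Record.below critical)
              (subst (q lam (suc j) ≤_) (sym e) (q-mono (s≤s j≤h) (s≤s h≤r))))
              where
              j≤h : j ≤ h
              j≤h with j ≤? h
              ... | yes p = p
              ... | no ¬p = ⊥-elim (<⇒≱ (<-≤-trans (lo ic) (≤-trans lt (≤-reflexive e))) (q-mono (≰⇒> ¬p) (m≤n⇒m≤1+n (j≤r ic))))
            Cx≤ : C ‼ suc (i + d) ≤ b x
            Cx≤ = ≤-trans (All.lookup bnds m (i + d) x≤) (subst (λ z → σ ! z ≤ b x) (sym e′) (f ic))
            C≤ : C ‼ suc i + x ≤ b x + suc i
            C≤ = subst (λ z → C ‼ suc i + z ≤ b x + suc i) e′
              (linear 0 (≤-trans (sorted-‼-gap (sorted (All.lookup (SSYT.cols s) m)) i d x≤) Cx≤) (shape (C ‼ suc i) i d (b x)))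
              where
              shape : ∀ c i d y → c + suc (i + d) + y + 0 ≡ y + suc i + (c + d)
              shape c i d y = solve (c L.∷ i L.∷ d L.∷ y L.∷ L.[])

-- The flag Φ

module Flag {n} (1≤n : 1 ≤ n) (lam γ : Vec ℕ n) (up : IsUpper γ) (adj : Criticals.Adjacent 1≤n lam γ) where
  open Carrels 1≤n lam
  open Criticals 1≤n lam γ
  private g = γ !_

  raised : ℕ → ℕ → ℕ → ℕ
  raised h x v = if (2 ≤ᵇ h) ∧ (x ≡ᵇ foldr _⊓_ (q lam h) (crits lam γ h)) then (γ ! q lam (h ∸ 1)) ⊔ v else v

  τ : ℕ → ℕ
  τ i = if i ∈ᵇ crits lam γ (carrel lam i) then γ ! i else raised (carrel lam i) (critAbove lam γ i) (descend up i)

  Φ-! : ∀ {i} → 1 ≤ i → i ≤ n → Φ lam γ ! i ≡ τ i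
  Φ-! = tabulate-! τ

  critical⇒InCarrel : ∀ {i j} → j ≤ r → Critical j i → InCarrel i j
  critical⇒InCarrel le c = inCarrel le (Record.above c) (Record.below c)

  critical? : ∀ {i j} → InCarrel i j → Dec (Critical j i)
  critical? {i} {j} ic with T? (i ∈ᵇ crits lam γ (suc j))
  ... | yes t = yes (crits-sound (j≤r ic) (∈ᵇ⇒∈ t))
  ... | no ¬t = no (λ c → ¬t (∈⇒∈ᵇ (crits-complete (j≤r ic) c)))

  τ-critical : ∀ {i j} → j ≤ r → Critical j i → τ i ≡ g i
  τ-critical {i} {j} le c
    rewrite carrel≡ (critical⇒InCarrel le c) | T⇒≡ (∈⇒∈ᵇ (crits-complete le c)) = refl

  τ-noncritical : ∀ {i j} → InCarrel i j → ¬ Critical j i → τ i ≡ raised (suc j) (critAbove lam γ i) (descend up i)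
  τ-noncritical {i} {j} ic ¬c rewrite carrel≡ ic with i ∈ᵇ crits lam γ (suc j) in e
  ... | false = refl
  ... | true = ⊥-elim (¬c (crits-sound (j≤r ic) (∈ᵇ⇒∈ (≡⇒T e))))

  raised-≥ : ∀ h x v → v ≤ raised h x v
  raised-≥ h x v with (2 ≤ᵇ h) ∧ (x ≡ᵇ foldr _⊓_ (q lam h) (crits lam γ h))
  ... | true  = m≤n⊔m _ v
  ... | false = ≤-refl

  raised-mono : ∀ h x {v w} → v ≤ w → raised h x v ≤ raised h x w
  raised-mono h x le with (2 ≤ᵇ h) ∧ (x ≡ᵇ foldr _⊓_ (q lam h) (crits lam γ h))
  ... | true  = ⊔-monoʳ-≤ (γ ! q lam (h ∸ 1)) le
  ... | false = le

  -- Raising to the entry at the previous carrel end stays below γ_x because `adj` puts that entry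
  -- below every critical entry of this carrel; in the first carrel nothing is raised.
  raised-≤ : ∀ {j x v} → j ≤ r → Critical j x → v ≤ g x → raised (suc j) x v ≤ g x
  raised-≤ {zero} _ _ le = le
  raised-≤ {suc j} {x} j≤ c le with x ≡ᵇ foldr _⊓_ (q lam (suc (suc j))) (crits lam γ (suc (suc j)))
  ... | true  = ⊔-lub (Adjacent.≤-next adj j j≤ c) le
  ... | false = le

  descend≤ : ∀ {i j} → InCarrel i j → descend up i ≤ g i
  descend≤ {i} ic = subst (_≤ g i) (sym (descend≡M up ic)) (M≤ up (InCarrel⇒≥1 ic) (hi ic) (q≤n (s≤s (j≤r ic))))

  critAbove-critical : ∀ {i j} → InCarrel i j → Critical j i → critAbove lam γ i ≡ i
  critAbove-critical ic c = ≤-antisym (first c ≤-refl) i≤x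
    where open CritAbove (critAbove-spec ic)

  descend≤τ : ∀ {i j} → InCarrel i j → descend up i ≤ τ i
  descend≤τ {i} {j} ic with critical? ic
  ... | yes c = subst (descend up i ≤_) (sym (τ-critical (j≤r ic) c)) (descend≤ ic)
  ... | no ¬c = subst (descend up i ≤_) (sym (τ-noncritical ic ¬c)) (raised-≥ (suc j) (critAbove lam γ i) (descend up i))

  τ≤critAbove : ∀ {i j} → InCarrel i j → τ i ≤ g (critAbove lam γ i)
  τ≤critAbove {i} ic with critical? ic
  ... | yes c = ≤-reflexive (trans (τ-critical (j≤r ic) c) (cong g (sym (critAbove-critical ic c))))
  ... | no ¬c = subst (_≤ g (critAbove lam γ i)) (sym (τ-noncritical ic ¬c))
    (raised-≤ (j≤r ic) (CritAbove.critical (critAbove-spec ic)) (m∸n≤m _ (critAbove lam γ i ∸ i)))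

  same-carrel : ∀ {i j} → InCarrel i j → i < q lam (suc j) → InCarrel (suc i) j
  same-carrel ic lt = inCarrel (j≤r ic) (m≤n⇒m≤1+n (lo ic)) lt

  τ-step-critical : ∀ {i j} → InCarrel i j → Critical j i → i < q lam (suc j) → g i ≤ τ (suc i)
  -- Slack 2: one unit from the strict record inequality at i, one from moving to i + 1.
  τ-step-critical {i} ic c lt = ≤-trans (+-cancelʳ-≤ x _ _ (≤-trans (linear 2 (Record.least c x i≤x (Record.below critical)) (shape (g i) x (g x) i))
      (≤-reflexive (sym (descend-+ up ic′))))) (descend≤τ ic′)
    where
    ic′ = same-carrel ic lt
    x = critAbove lam γ (suc i)
    open CritAbove (critAbove-spec ic′)
    shape : ∀ y x z i → y + x + (z + i) + 2 ≡ z + suc i + suc (y + x)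
    shape y x z i = solve (y L.∷ x L.∷ z L.∷ i L.∷ L.[])

  -- A noncritical i has the same critical index x above it as i + 1, so the same raising is applied
  -- to a larger value; if i + 1 is x, the bound `τ≤critAbove` suffices.
  τ-step-noncritical : ∀ {i j} → InCarrel i j → ¬ Critical j i → τ i ≤ τ (suc i)
  τ-step-noncritical {i} {j} ic ¬c with m≤n⇒m<n∨m≡n (CritAbove.i≤x (critAbove-spec ic))
  ... | inj₂ e = ⊥-elim (¬c (subst (Critical j) (sym e) (CritAbove.critical (critAbove-spec ic))))
  ... | inj₁ i<x = next (critical? ic′)
    where
    x = critAbove lam γ i
    open CritAbove (critAbove-spec ic)
    ic′ = same-carrel ic (<-≤-trans i<x (Record.below critical))
    module N = CritAbove (critAbove-spec ic′)
    x≡ : x ≡ critAbove lam γ (suc i)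
    x≡ = ≤-antisym (first N.critical (<⇒≤ N.i≤x)) (N.first critical i<x)
    next : Dec (Critical j (suc i)) → τ i ≤ τ (suc i)
    next (yes c′) = subst (τ i ≤_) (trans (cong g (trans x≡ (critAbove-critical ic′ c′))) (sym (τ-critical (j≤r ic) c′))) (τ≤critAbove ic)
    next (no ¬c′) = subst₂ _≤_ (sym (τ-noncritical ic ¬c)) (trans (cong (λ y → raised (suc j) y (descend up (suc i))) x≡) (sym (τ-noncritical ic′ ¬c′)))
      (raised-mono (suc j) x (subst (λ y → descend up i ≤ g y ∸ (y ∸ suc i)) x≡ (∸-monoʳ-≤ (g x) (∸-monoʳ-≤ x (n≤1+n i)))))

  -- The purpose of the maximum in `Φ`: above the first index of a carrel lies the smallest critical
  -- index of that carrel, so the value is raised to the previous end unless that first index is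
  -- itself critical, where `adj` applies.
  τ-step-end : ∀ {j} → suc j ≤ r → g (q lam (suc j)) ≤ τ (suc (q lam (suc j)))
  τ-step-end {j} le = next (critical? ic)
    where
    i = suc (q lam (suc j))
    H = q lam (suc (suc j))
    cs = crits lam γ (suc (suc j))
    ic : InCarrel i (suc j)
    ic = inCarrel le ≤-refl (q-step le)
    open CritAbove (critAbove-spec ic)
    x = critAbove lam γ i
    min-∈ : foldr _⊓_ H cs ∈ cs
    min-∈ with foldr-⊓-∈ H cs
    ... | here e = subst (_∈ cs) (sym e) (here refl)
    ... | there m = m
    x≡min : x ≡ foldr _⊓_ H cs
    x≡min = ≤-antisym (first min-critical (Record.above min-critical)) (foldr-⊓-≤ H cs (there (crits-complete le critical)))
      where min-critical = crits-sound le min-∈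
    raised-end : ∀ v → g (q lam (suc j)) ≤ raised (suc (suc j)) x v
    raised-end v rewrite T⇒≡ (≡⇒≡ᵇ x (foldr _⊓_ H cs) x≡min) = m≤m⊔n _ v
    next : Dec (Critical (suc j) i) → g (q lam (suc j)) ≤ τ i
    next (yes c) = subst (g (q lam (suc j)) ≤_) (sym (τ-critical le c)) (Adjacent.≤-next adj j le c)
    next (no ¬c) = subst (g (q lam (suc j)) ≤_) (sym (τ-noncritical ic ¬c)) (raised-end (descend up i))

  τ-mono : ∀ {i} → 1 ≤ i → i < n → τ i ≤ τ (suc i)
  τ-mono {i} p lt with locate p (<⇒≤ lt)
  ... | j , ic , _ with critical? ic
  ... | no ¬c = τ-step-noncritical ic ¬c
  ... | yes c with m≤n⇒m<n∨m≡n (hi ic)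
  ...   | inj₁ i<q = subst (_≤ τ (suc i)) (sym (τ-critical (j≤r ic) c)) (τ-step-critical ic c i<q)
  ...   | inj₂ refl = subst (_≤ τ (suc i)) (sym (τ-critical (j≤r ic) c)) (τ-step-end j<r)
    where
    j<r : j < r
    j<r with m≤n⇒m<n∨m≡n (j≤r ic)
    ... | inj₁ p = p
    ... | inj₂ refl = ⊥-elim (<⇒≢ lt q-last)

  Φ-flag : IsUpperFlag (Φ lam γ)
  Φ-flag = upper , (λ i p lt → subst₂ _≤_ (sym (Φ-! p (<⇒≤ lt))) (sym (Φ-! (s≤s z≤n) lt)) (τ-mono p lt))
    where
    upper : IsUpper (Φ lam γ)
    upper i p le with locate p le
    ... | j , ic , _ = subst (λ z → (i ≤ z) × (z ≤ n)) (sym (Φ-! p le))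
      ( ≤-trans (subst (i ≤_) (sym (descend≡M up ic)) (i≤M up p (hi ic) q≤)) (descend≤τ ic)
      , ≤-trans (τ≤critAbove ic) (proj₂ (up _ (≤-trans p i≤x) (≤-trans (Record.below critical) q≤))))
      where
      q≤ = q≤n (s≤s (j≤r ic))
      open CritAbove (critAbove-spec ic)

  Φ-inS : ∀ S → inS lam γ S ≡ inS lam (Φ lam γ) S
  Φ-inS = bounded-transfer up (Φ lam γ)
      (λ {i} {j} ic → let open CritAbove (critAbove-spec ic) ; ic′ = critical⇒InCarrel (j≤r ic) critical in
        ≤-reflexive (trans (Φ-! (InCarrel⇒≥1 ic′) (InCarrel⇒≤n ic′)) (τ-critical (j≤r ic) critical)))
      (λ {i} ic → subst (descend up i ≤_) (sym (Φ-! (InCarrel⇒≥1 ic) (InCarrel⇒≤n ic))) (descend≤τ ic))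

Δ-inS : ∀ {n} → 1 ≤ n → (lam β : Vec ℕ n) → IsUpper β → ∀ S → inS lam β S ≡ inS lam (Δ lam β) S
Δ-inS 1≤n lam β up = bounded-transfer up (Δ lam β)
    (λ {i} {j} ic → let open CritAbove (critAbove-spec ic) ; ic′ = inCarrel (j≤r ic) (Record.above critical) (Record.below critical) in
      subst (_≤ _) (sym (Δ≡M up ic′)) (M≤ up (InCarrel⇒≥1 ic′) (hi ic′) (q≤n (s≤s (j≤r ic′)))))
    (λ ic → ≤-reflexive (sym (Δ-! up (InCarrel⇒≥1 ic) (InCarrel⇒≤n ic))))
  where
  open Carrels 1≤n lam
  open Criticals 1≤n lam β

-- 312-avoidance

unique-∷ : ∀ {n u C} → Column n C → u ∉ C → Unique (u ∷ C)
unique-∷ c u∉ = All.tabulate (λ m e → u∉ (subst (_∈ _) (sym e) m)) ∷ sorted⇒unique (sorted c)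

insert-↭ : ∀ {n u C} → Column n C → 1 ≤ u → u ≤ n → u ∉ C → sortedSet n (u ∷ C) ↭ u ∷ C
insert-↭ c p q u∉ = sortedSet-↭ (unique-∷ c u∉) (λ { (here refl) → p , q ; (there m) → within c m })

-- D is C with x exchanged for w; `count` carries the removed element on the left to avoid
-- subtraction.
record Replaced (n : ℕ) (C : List ℕ) (x w : ℕ) (D : List ℕ) : Set where
  field
    col   : Column n D
    len   : length D ≡ length C
    new   : w ∈ D
    count : ∀ v → ind (x ≤ᵇ v) + # (_≤ᵇ v) D ≡ ind (w ≤ᵇ v) + # (_≤ᵇ v) C

replace : ∀ {n C x w} → Column n C → x ∈ C → 1 ≤ w → w ≤ n → w ∉ C → ∃ (Replaced n C x w)
replace {n} {C} {x} {w} c x∈ 1≤w w≤n w∉ with ∈-∃++ x∈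
... | as , bs , refl = sortedSet n (w ∷ as ++ bs) , record
  { col = sortedSet-column n (w ∷ as ++ bs)
  ; len = trans (↭-length ↭D) (sym (↭-length (shift x as bs)))
  ; new = ∈-sortedSet⁺ {xs = w ∷ as ++ bs} 1≤w w≤n (here refl)
  ; count = λ v → begin
      ind (x ≤ᵇ v) + # (_≤ᵇ v) (sortedSet n (w ∷ as ++ bs))
        ≡⟨ cong (ind (x ≤ᵇ v) +_) (trans (#-↭ (_≤ᵇ v) ↭D) (#-cons (_≤ᵇ v) w (as ++ bs))) ⟩
      ind (x ≤ᵇ v) + (ind (w ≤ᵇ v) + # (_≤ᵇ v) (as ++ bs)) ≡⟨ swap-+ (ind (x ≤ᵇ v)) (ind (w ≤ᵇ v)) (# (_≤ᵇ v) (as ++ bs)) ⟩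
      ind (w ≤ᵇ v) + (ind (x ≤ᵇ v) + # (_≤ᵇ v) (as ++ bs))
        ≡⟨ cong (ind (w ≤ᵇ v) +_) (trans (#-↭ (_≤ᵇ v) (shift x as bs)) (#-cons (_≤ᵇ v) x (as ++ bs))) ⟨
      ind (w ≤ᵇ v) + # (_≤ᵇ v) (as ++ x ∷ bs) ∎ }
  where
  open ≡-Reasoning
  swap-+ : ∀ x y z → x + (y + z) ≡ y + (x + z)
  swap-+ x y z = solve (x L.∷ y L.∷ z L.∷ L.[])
  widen : ∀ as {y} → y ∈ as ++ bs → y ∈ as ++ x ∷ bs
  widen as m with ∈-++⁻ as m
  ... | inj₁ m′ = ∈-++⁺ˡ m′
  ... | inj₂ m′ = ∈-++⁺ʳ as (there m′)
  drop-mid : ∀ as → Sorted (as ++ x ∷ bs) → Sorted (as ++ bs)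
  drop-mid [] (_ ∷ s) = s
  drop-mid (a ∷ as) (h ∷ s) = All.tabulate (λ m → All.lookup h (widen as m)) ∷ drop-mid as s
  rest : Column n (as ++ bs)
  rest = column (drop-mid as (sorted c)) (λ m → within c (widen as m))
  ↭D : sortedSet n (w ∷ as ++ bs) ↭ w ∷ as ++ bs
  ↭D = insert-↭ rest 1≤w w≤n (w∉ ∘ widen as)

‼-++ˡ : ∀ xs {ys} j → j < length xs → (xs ++ ys) ‼ suc j ≡ xs ‼ suc j
‼-++ˡ (x ∷ xs) zero _ = refl
‼-++ˡ (x ∷ xs) (suc j) lt = ‼-++ˡ xs j (≤-pred lt)

-- `Ψ` selects by rank from the top; this converts such a rank into a row of the increasing column.
reverse-‼ : ∀ C i → i < length C → reverse C ‼ (length C ∸ i) ≡ C ‼ suc i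
reverse-‼ (x ∷ C) zero _ rewrite unfold-reverse x C =
  trans (cong (λ k → (reverse C ++ x ∷ []) ‼ suc k) (sym (length-reverse C))) (‼-last (reverse C) x)
reverse-‼ (x ∷ C) (suc i) lt with m≤n⇒∃[o]m+o≡n (≤-pred lt)
... | d , e rewrite unfold-reverse x C = trans (cong ((reverse C ++ x ∷ []) ‼_) (sym e′))
    (trans (‼-++ˡ (reverse C) d d<) (trans (cong (reverse C ‼_) e′) (reverse-‼ C i (≤-pred lt))))
  where
  e′ : suc d ≡ length C ∸ i
  e′ = trans (sym (m+n∸m≡n i (suc d))) (cong (_∸ i) (trans (+-suc i d) e))
  d< : d < length (reverse C)
  d< = subst (d <_) (sym (length-reverse C)) (≤-trans (s≤s (m≤n+m d i)) (≤-reflexive e))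

module _ (p : ℕ) (D : List ℕ) (G : ℕ → List ℕ) where

  update : ℕ → List ℕ
  update d = if d ≡ᵇ p then D else G d

  -- Keeps the boolean test out of later arguments, which treat the altered column and the others
  -- separately.
  update-elim : ∀ (P : ℕ → List ℕ → Set) → P p D → (∀ d → d ≢ p → P d (G d)) → ∀ d → P d (update d)
  update-elim P at off d with d ≡ᵇ p in eq
  ... | true with ≡ᵇ⇒≡ d p (≡⇒T eq)
  ...   | refl = at
  update-elim P at off d | false = off d (λ e → subst T eq (≡⇒≡ᵇ d p e))

  update-≡ : update p ≡ D
  update-≡ = update-elim (λ d C → d ≡ p → C ≡ D) (λ _ → refl) (λ d ne e → ⊥-elim (ne e)) p refl

  update-≢ : ∀ {d} → d ≢ p → update d ≡ G d
  update-≢ {d} = update-elim (λ d C → d ≢ p → C ≡ G d) (λ ne → ⊥-elim (ne refl)) (λ _ _ _ → refl) d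

module Coincidence {n} (1≤n : 1 ≤ n) (lam π : Vec ℕ n) (perm : InSnλ lam π) where
  open Carrels 1≤n lam
  open Permutation π (proj₁ perm) (proj₁ (proj₂ perm))
  private cs = colLens lam

  module _ (β : Vec ℕ n) (up : IsUpper β) (Q≡ : Q lam β ≡ map Bcol cs) where
    open Criticals 1≤n lam β
    open RowBound lam β up
    private b = β !_

    Mcol≡Bcol : ∀ {j} → j ≤ r → Mcol b (q lam (suc j)) ≡ Bcol (q lam (suc j))
    Mcol≡Bcol {j} le with m≤n⇒m<n∨m≡n le
    ... | inj₁ lt = agree cs (trans (sym Q≡Mtab) Q≡) (proj₁ (q∈colLens lt))
      where
      agree : ∀ {f g : ℕ → List ℕ} xs → map f xs ≡ map g xs → ∀ {x} → x ∈ xs → f x ≡ g x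
      agree (x ∷ xs) e (here refl) = proj₁ (∷-injective e)
      agree (x ∷ xs) e (there m)   = agree xs (proj₂ (∷-injective e)) m
    -- The last carrel end n need not be a column length, but both columns of length n are all of
    -- [n].
    ... | inj₂ refl = subst (λ c → Mcol b c ≡ Bcol c) (sym q-last)
      (trans (full-column (Mcol-column up ≤-refl) (Mcol-length b n)) (sym Bcol-n))

    Δ≡Ψ : Δ lam β ≡ Ψ lam π
    Δ≡Ψ = !-ext (Δ lam β) (Ψ lam π) (λ i lt → same (s≤s z≤n) lt)
      where
      ψ : ℕ → ℕ
      ψ i = reverse (sortedSet n (Bset lam π (carrel lam i))) ‼ (suc (q lam (carrel lam i)) ∸ i)
      same : ∀ {i} → 1 ≤ i → i ≤ n → Δ lam β ! i ≡ Ψ lam π ! i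
      same {suc i} p le with locate p le
      ... | j , ic , e = begin
        Δ lam β ! suc i ≡⟨ Δ≡M up ic ⟩
        M b c (suc i) ≡⟨ Mcol-‼ b c (s≤s z≤n) (hi ic) ⟨
        Mcol b c ‼ suc i ≡⟨ cong (_‼ suc i) (Mcol≡Bcol (j≤r ic)) ⟩
        Bcol c ‼ suc i ≡⟨ reverse-‼ (Bcol c) i (subst (i <_) (sym len) (hi ic)) ⟨
        reverse (Bcol c) ‼ (length (Bcol c) ∸ i) ≡⟨ cong (λ l → reverse (Bcol c) ‼ (l ∸ i)) len ⟩
        reverse (Bcol c) ‼ (c ∸ i) ≡⟨ cong (λ h → reverse (sortedSet n (Bset lam π h)) ‼ (q lam h ∸ i)) e ⟨
        ψ (suc i) ≡⟨ tabulate-! ψ p le ⟨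
        Ψ lam π ! suc i ∎
        where
        open ≡-Reasoning
        c = q lam (suc j)
        len = Bcol-length (q≤n (s≤s (j≤r ic)))

    -- If b y < b (q_h) with y critical in the next carrel, then b y + 1 is missing from the column
    -- of length q_{h+1}, and by counting some entry ≤ b y of that column is missing from the
    -- column of length q_h: a 312 pattern.
    avoids⇒Adjacent : Avoids312 lam π → Adjacent
    Adjacent.≤-next (avoids⇒Adjacent avoid) j j<r {y} crit with b (q lam (suc j)) ≤? b y
    ... | yes le = le
    ... | no ¬le with m≤n⇒m<n∨m≡n j<r
    -- If the next carrel is the last one, it ends at n, where b_k - k is already 0. No earlier
    -- index can go lower, so y = n and b y ≥ n.
    ...   | inj₂ e = ⊥-elim (¬le (≤-trans (proj₂ (up p 1≤p p≤n)) n≤by))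
      where
      p = q lam (suc j)
      1≤p = 1≤q {j} (<⇒≤ j<r)
      p≤n = q≤n {suc j} (m≤n⇒m≤1+n j<r)
      qn : q lam (suc (suc j)) ≡ n
      qn = trans (cong (λ k → q lam (suc k)) e) q-last
      y≤n : y ≤ n
      y≤n = subst (y ≤_) qn (Record.below crit)
      1≤y = ≤-trans 1≤p (<⇒≤ (Record.above crit))
      n≤by : n ≤ b y
      n≤by with m≤n⇒m<n∨m≡n y≤n
      ... | inj₂ refl = proj₁ (up n 1≤n ≤-refl)
      ... | inj₁ y<n = ⊥-elim (<⇒≱ (Record.least crit n y<n (≤-reflexive (sym qn)))
        (≤-trans (+-monoˡ-≤ y (proj₂ (up n 1≤n ≤-refl))) (≤-trans (≤-reflexive (+-comm n y)) (+-monoˡ-≤ n (proj₁ (up y 1≤y y≤n))))))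
    ...   | inj₁ j+1<r = ⊥-elim (contradict (∈-Bcol⁻ p top∈) (∈-Bcol-n (s≤s z≤n) v≤n) witness)
      where
      p = q lam (suc j)
      c = q lam (suc (suc j))
      p≤c = <⇒≤ (q-step j<r)
      c≤n = q≤n {suc (suc j)} (m≤n⇒m≤1+n j+1<r)
      1≤p = 1≤q {j} (<⇒≤ j<r)
      1≤y = ≤-trans 1≤p (<⇒≤ (Record.above crit))
      v = suc (b y)
      v≤top : v ≤ b p
      v≤top = ≰⇒> ¬le
      v≤n : v ≤ n
      v≤n = ≤-trans v≤top (proj₂ (up p 1≤p (≤-trans p≤c c≤n)))
      Mp≡ = Mcol≡Bcol {j} (<⇒≤ j<r)
      Mc≡ = Mcol≡Bcol {suc j} j<r

      top∈ : b p ∈ Bcol p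
      top∈ = subst (b p ∈_) Mp≡ (subst (_∈ Mcol b p) (cong (minFrom b p) (n∸n≡0 p)) (∈-map⁺ (M b p) (∈-range⁺ 1≤p ≤-refl)))

      M≤by : ∀ {i} → 1 ≤ i → i ≤ y → M b c i ≤ b y
      M≤by {i} 1≤i i≤y = +-cancelʳ-≤ y _ _ (≤-trans (M-≤ up 1≤i c≤n y i≤y (Record.below crit)) (+-monoʳ-≤ (b y) i≤y))

      -- Rows up to y hold at most b y, and strictness of the record at y pushes the later rows to
      -- at least b y + 2.
      v∉ : v ∉ Bcol c
      v∉ m with ∈-map⁻ (M b c) (subst (v ∈_) (sym Mc≡) m)
      ... | i , mi , e with i ≤? y
      ...   | yes i≤y = 1+n≰n (≤-trans (≤-reflexive e) (M≤by (proj₁ (∈-range⁻ mi)) i≤y))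
      ...   | no i≰y = 1+n≰n (≤-trans (M-greatest b (proj₂ (∈-range⁻ mi)) gap) (≤-reflexive (sym e)))
        where
        gap : ∀ k → i ≤ k → k ≤ c → suc v + k ≤ b k + i
        gap k lo hi = linear 0 (+-mono-≤ (Record.least crit k (<-≤-trans (≰⇒> i≰y) lo) hi) (≰⇒> i≰y)) (shape (b y) k (b k) i y)
          where
          shape : ∀ z k w i y → suc (suc z) + k + (w + y + i) + 0 ≡ w + i + (suc (z + k) + suc y)
          shape z k w i y = solve (z L.∷ k L.∷ w L.∷ i L.∷ y L.∷ L.[])

      inside : ℕ → Bool
      inside x = (x ∈ᵇ Bcol c) ∧ (x ≤ᵇ b y)

      -- The first y rows of the column of length c hold entries at most b y, and y > p is more than
      -- B_p can accommodate.
      many : y ≤ # inside (range 1 n)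
      many = begin
        y ≡⟨ #≤-range (Record.below crit) ⟨
        # (_≤ᵇ y) (range 1 c) ≤⟨ #-mono (_≤ᵇ y) (λ i → M b c i ≤ᵇ b y) (range 1 c)
          (λ {i} m t → ≤⇒≤ᵇ (M≤by (proj₁ (∈-range⁻ m)) (≤ᵇ⇒≤ i y t))) ⟩
        # (λ i → M b c i ≤ᵇ b y) (range 1 c) ≡⟨ #-map (_≤ᵇ b y) (M b c) (range 1 c) ⟨
        # (_≤ᵇ b y) (Mcol b c) ≡⟨ cong (# (_≤ᵇ b y)) (trans Mc≡ (sym (sortedSet-id (Bcol-column c)))) ⟩
        # (_≤ᵇ b y) (sortedSet n (Bcol c)) ≡⟨ #-filter (_≤ᵇ b y) (_∈ᵇ Bcol c) (range 1 n) ⟩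
        # inside (range 1 n) ∎
        where open ≤-Reasoning

      few : # (_∈ᵇ Bcol p) (range 1 n) ≡ p
      few = trans (cong length (sortedSet-id (Bcol-column p))) (Bcol-length (≤-trans p≤c c≤n))

      witness : ∃[ x ] (x ∈ Bcol c × x ≤ b y × x ∉ Bcol p)
      witness with #-witness inside (_∈ᵇ Bcol p) (range 1 n) (<-≤-trans (subst (_< y) (sym few) (Record.above crit)) many)
      ... | x , _ , t , ¬t = x , ∈ᵇ⇒∈ {x} {Bcol c} (proj₁ (∧⁻ t)) , ≤ᵇ⇒≤ x (b y) (proj₂ (∧⁻ {x ∈ᵇ Bcol c} t)) , ¬t ∘ ∈⇒∈ᵇ

      contradict : ∃[ i ] (1 ≤ i × i ≤ p × b p ≡ π ! i) → ∃[ k ] (1 ≤ k × k ≤ n × v ≡ π ! k) →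
        ∃[ x ] (x ∈ Bcol c × x ≤ b y × x ∉ Bcol p) → ⊥
      -- The pattern: b p sits at or before p, the witness x between p and c, and v after c, with b
      -- p > v > x. The first inequality is strict because b p lies in B_c and v does not.
      contradict (i , 1≤i , i≤p , ei) (k , 1≤k , k≤n , ek) (x , x∈ , x≤ , x∉) with ∈-Bcol⁻ c x∈
      ... | l , 1≤l , l≤c , refl = avoid (suc j) i l k (s≤s z≤n) (∸-monoˡ-≤ 1 j+1<r) 1≤i i≤p
          (≰⇒> (λ l≤p → x∉ (∈-Bcol⁺ (≤-trans p≤c c≤n) 1≤l l≤p))) l≤c
          (≰⇒> (λ k≤c → v∉ (subst (_∈ Bcol c) (sym ek) (∈-Bcol⁺ c≤n 1≤k k≤c)))) k≤n
          (subst₂ _<_ ek ei (≤∧≢⇒< v≤top (λ e → v∉ (subst (_∈ Bcol c) (sym e) (Bcol-mono c p p≤c c≤n top∈)))))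
          (subst (π ! l <_) ek (s≤s x≤))

  -- From a 312 pattern a, b, c at h, replace π_a by π_c in every column of length q_h of the key:
  -- the result lies below the key, but its right key has π_c in its columns of length q_{h+1}.
  ideal⇒avoids : (∀ {S} → SSYT n cs S → Pointwise _⊒_ S (map Bcol cs) → T (inD lam π S)) → Avoids312 lam π
  ideal⇒avoids ideal (suc j) a b c _ h≤ 1≤a a≤p p<b b≤e e<c c≤n πc<πa πb<πc =
      <⇒≱ e<c (∈-Bcol-position 1≤c c≤n e≤n (subst (π ! c ∈_) (F-other e≢p) absorbed))
    where
    h<r : suc (suc j) ≤ r
    h<r = ≤-trans (s≤s h≤) (≤-reflexive (trans (+-comm 1 (r ∸ 1)) (m∸n+n≡m 1≤r)))
      where 1≤r = ≤-trans (s≤s z≤n) (≤-trans h≤ (m∸n≤m r 1))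
    p = q lam (suc j)
    e = q lam (suc (suc j))
    p∈ = proj₁ (q∈colLens {j} (<⇒≤ h<r))
    e∈ = proj₁ (q∈colLens {suc j} h<r)
    p<e = q-step {suc j} (<⇒≤ h<r)
    e≤n = q≤n {suc (suc j)} (m≤n⇒m≤1+n h<r)
    p≤n = ≤-trans (<⇒≤ p<e) e≤n
    1≤b = ≤-trans (s≤s z≤n) p<b
    1≤c = ≤-trans (s≤s z≤n) e<c
    b≤n = ≤-trans b≤e e≤n
    πb-bounds = proj₁ perm b 1≤b b≤n
    πc-bounds = proj₁ perm c 1≤c c≤n
    πb∉ : π ! b ∉ Bcol p
    πb∉ m = <⇒≱ p<b (∈-Bcol-position 1≤b b≤n p≤n m)
    πc∉ : π ! c ∉ Bcol p
    πc∉ m = <⇒≱ (<-trans p<e e<c) (∈-Bcol-position 1≤c c≤n p≤n m)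
    replaced = replace (Bcol-column p) (∈-Bcol⁺ p≤n 1≤a a≤p) (proj₁ πc-bounds) (proj₂ πc-bounds) πc∉
    D = proj₁ replaced
    module D = Replaced (proj₂ replaced)

    ≤ᵇ-anti : ∀ {x y} v → x < y → ind (y ≤ᵇ v) ≤ ind (x ≤ᵇ v)
    ≤ᵇ-anti {x} {y} v lt = ind-mono (λ t → ≤⇒≤ᵇ (≤-trans (<⇒≤ lt) (≤ᵇ⇒≤ y v t)))

    D⊒B : D ⊒ Bcol p
    D⊒B = ⊒⁺ λ v → +-cancelˡ-≤ (ind (π ! c ≤ᵇ v)) _ _
      (≤-trans (≤-reflexive (sym (D.count v))) (+-monoˡ-≤ (# (_≤ᵇ v) D) (≤ᵇ-anti v πc<πa)))

    -- A longer key column contains B_p together with π_b. Since π_b < π_c, the extra entry π_b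
    -- compensates for the π_c inserted into D, so the rows stay weakly increasing.
    larger⊒D : ∀ {d} → d ∈ cs → p < d → Bcol d ⊒ D
    larger⊒D {d} d∈ p<d = ⊒-trans (⊇⇒⊒ (Bcol-column d) (sortedSet-column n (π ! b ∷ Bcol p)) sub) (⊒⁺ dom)
      where
      d≤n = ∈colLens⇒≤n lam d∈
      e≤d : e ≤ d
      e≤d with colLens⇒q d∈
      ... | k , k≤r , refl = q-mono (s≤s (≰⇒> (λ k≤j → <⇒≱ p<d (q-mono (s≤s k≤j) (m≤n⇒m≤1+n (<⇒≤ h<r)))))) (s≤s k≤r)
      sub : ∀ {x} → x ∈ sortedSet n (π ! b ∷ Bcol p) → x ∈ Bcol d
      sub m with ∈-sortedSet⁻ {n} {xs = π ! b ∷ Bcol p} m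
      ... | here refl = ∈-Bcol⁺ d≤n 1≤b (≤-trans b≤e e≤d)
      ... | there m′  = Bcol-mono d p (<⇒≤ p<d) d≤n m′
      dom : ∀ v → # (_≤ᵇ v) D ≤ # (_≤ᵇ v) (sortedSet n (π ! b ∷ Bcol p))
      dom v = begin
        # (_≤ᵇ v) D ≤⟨ m≤n+m _ (ind (π ! a ≤ᵇ v)) ⟩
        ind (π ! a ≤ᵇ v) + # (_≤ᵇ v) D ≡⟨ D.count v ⟩
        ind (π ! c ≤ᵇ v) + # (_≤ᵇ v) (Bcol p) ≤⟨ +-monoˡ-≤ _ (≤ᵇ-anti v πb<πc) ⟩
        ind (π ! b ≤ᵇ v) + # (_≤ᵇ v) (Bcol p) ≡⟨ #-cons (_≤ᵇ v) (π ! b) (Bcol p) ⟨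
        # (_≤ᵇ v) (π ! b ∷ Bcol p) ≡⟨ #-↭ (_≤ᵇ v) (insert-↭ (Bcol-column p) (proj₁ πb-bounds) (proj₂ πb-bounds) πb∉) ⟨
        # (_≤ᵇ v) (sortedSet n (π ! b ∷ Bcol p)) ∎
        where open ≤-Reasoning

    F : ℕ → List ℕ
    F = update p D Bcol
    F-p : F p ≡ D
    F-p = update-≡ p D Bcol
    F-other : ∀ {d} → d ≢ p → F d ≡ Bcol d
    F-other = update-≢ p D Bcol
    e≢p : e ≢ p
    e≢p eq = <⇒≢ p<e (sym eq)

    F-column : ∀ {d} → d ∈ cs → Column n (F d)
    F-column {d} _ = update-elim p D Bcol (λ _ C → Column n C) D.col (λ d _ → Bcol-column d) d
    F-length : ∀ {d} → d ∈ cs → length (F d) ≡ d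
    F-length {d} = update-elim p D Bcol (λ d C → d ∈ cs → length C ≡ d)
      (λ _ → trans D.len (Bcol-length p≤n)) (λ d _ d∈ → Bcol-length (∈colLens⇒≤n lam d∈)) d
    F⊒B : ∀ d → F d ⊒ Bcol d
    F⊒B = update-elim p D Bcol (λ d C → C ⊒ Bcol d) D⊒B (λ d _ → ⊒-refl)
    F⊒D : ∀ {d} → d ∈ cs → p < d ⊎ p ≡ d → F d ⊒ D
    F⊒D d∈ (inj₁ lt) = subst (_⊒ D) (sym (F-other (λ e → <⇒≢ lt (sym e)))) (larger⊒D d∈ lt)
    F⊒D d∈ (inj₂ eq) = subst (_⊒ D) (sym (trans (cong F (sym eq)) F-p)) ⊒-refl
    F-dominates : ∀ {d d′} → d ∈ cs → d′ ∈ cs → d′ ≤ d → F d ⊒ F d′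
    F-dominates {d} {d′} d∈ _ = update-elim p D Bcol (λ d′ C → d′ ≤ d → F d ⊒ C)
      (λ le → F⊒D d∈ (m≤n⇒m<n∨m≡n le)) (λ d′ _ le → ⊒-trans (F⊒B d) (Bcol-⊒ le (∈colLens⇒≤n lam d∈))) d′

    F-SSYT : SSYT n cs (map F cs)
    F-SSYT = map-SSYT F (colLens-decreasing lam) F-column F-length F-dominates

    absorbed : π ! c ∈ F e
    absorbed = Kplus-absorb F Bcol cs (colLens-decreasing lam) (SSYT.cols F-SSYT) (SSYT.chain F-SSYT)
      (proj₂ (inD⁻ lam (map F cs) (ideal F-SSYT (below cs)))) e∈ p∈ p<e (F-other e≢p) (subst (π ! c ∈_) (sym F-p) D.new)
      where
      below : ∀ xs → Pointwise _⊒_ (map F xs) (map Bcol xs)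
      below [] = []
      below (x ∷ xs) = F⊒B x ∷ below xs

-- The theorem

module SameShape {n} (1≤n : 1 ≤ n) (lam β π : Vec ℕ n) (up : IsUpper β) (perm : InSnλ lam π)
  (same : SamePoly lam β lam π) where
  open Permutation π (proj₁ perm) (proj₁ (proj₂ perm))
  open RowBound lam β up
  open Coincidence 1≤n lam π perm
  open Criticals 1≤n lam using (module Adjacent; Adjacent; Adjacent⇒UGC; Δ-UI)
  private
    cs  = colLens lam
    key = map Bcol cs

  Mtab-SSYT : SSYT n cs Mtab
  Mtab-SSYT = BoundedBy.tableau Mtab-bounded

  inS-⊒ : ∀ S → T (inS lam β S) → Pointwise _⊒_ S Mtab
  inS-⊒ S t = PW.map Pointwise⇒⊒ (inS-below S t)

  counts-≤ : ∀ {S R} → SSYT n cs S → SSYT n cs R → content n R ≡ content n S →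
    ∀ {L} → Pointwise _⊒_ R L → ∀ k → # (_≤ᵇ k) (concat L) ≤ # (_≤ᵇ k) (concat S)
  counts-≤ s r e pw k = ≤-trans (⊒-count pw k) (≤-reflexive (content⇒# (SSYT.cols r) (SSYT.cols s) e (_≤ᵇ k)))

  -- Some Demazure tableau has the content of `Mtab` and lies below the key. The symmetric choice
  -- gives the reverse inequality.
  key≤Mtab : ∀ k → # (_≤ᵇ k) (concat key) ≤ # (_≤ᵇ k) (concat Mtab)
  key≤Mtab = let S , t , e = coeff-transfer lam lam (inS lam β) (inD lam π) same Mtab-SSYT Mtab-inS in
    counts-≤ Mtab-SSYT (proj₁ (inD⁻ lam S t)) e (inD-below lam S t)

  Mtab≤key : ∀ k → # (_≤ᵇ k) (concat Mtab) ≤ # (_≤ᵇ k) (concat key)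
  Mtab≤key = let S , t , e = coeff-transfer lam lam (inD lam π) (inS lam β) (λ θ → sym (same θ)) (key-SSYT lam) (key-inD lam) in
    counts-≤ (key-SSYT lam) (BoundedBy.tableau (inS⁻ lam β S t)) e (inS-⊒ S t)

  Mtab≡key : Mtab ≡ key
  Mtab≡key = key-unique lam Mtab-SSYT (#⇒content n {Mtab} {key}
    (#≤-determines-#≡ (concat Mtab) (concat key) (λ k → ≤-antisym (Mtab≤key k) (key≤Mtab k))))

  Q≡key : Q lam β ≡ key
  Q≡key = trans Q≡Mtab Mtab≡key

  inD⇒inS : ∀ S → T (inD lam π S) → T (inS lam β S)
  inD⇒inS S t = inS⇔below (proj₁ (inD⁻ lam S t)) (subst (Pointwise _⊒_ S) (sym Mtab≡key) (inD-below lam S t))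

  inS⇒inD : ∀ {S} → SSYT n cs S → T (inS lam β S) → T (inD lam π S)
  inS⇒inD = coeff-saturated lam (inS lam β) (inD lam π) same inD⇒inS

  inS≡inD : ∀ S → inS lam β S ≡ inD lam π S
  inS≡inD S = T-ext (λ t → inS⇒inD (BoundedBy.tableau (inS⁻ lam β S t)) t) (inD⇒inS S)

  avoids : Avoids312 lam π
  avoids = ideal⇒avoids (λ {S} s pw → inS⇒inD s (inS⇔below s (subst (Pointwise _⊒_ S) (sym Mtab≡key) pw)))

  γ : Vec ℕ n
  γ = Δ lam β

  γ-UI : InUI lam γ
  γ-UI = Δ-UI β up

  γ-inS : ∀ S → inS lam β S ≡ inS lam γ S
  γ-inS = Δ-inS 1≤n lam β up

  β-adjacent : Adjacent β
  β-adjacent = avoids⇒Adjacent β up Q≡key avoids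

  -- `Δ` does not change the set of bounded tableaux, hence not its join `Q`, so the argument for β
  -- applies to γ as well.
  γ-adjacent : Adjacent γ
  γ-adjacent = avoids⇒Adjacent γ (proj₁ γ-UI) (trans (cong (foldr maxTab _)
    (sym (filterᵇ-cong (inS lam β) (inS lam γ) (fillings lam) (λ {S} _ → γ-inS S)))) Q≡key) avoids

  open Flag 1≤n lam γ (proj₁ γ-UI) γ-adjacent using (Φ-flag; Φ-inS)

  conclusion : (Q lam β ≡ Y lam π) × (Δ lam β ≡ Ψ lam π) × Avoids312 lam π × InUG lam γ × InUGC lam β ×
    (∀ S → inS lam β S ≡ inD lam π S) × IsUpperFlag (Φ lam γ) × (∀ S → inS lam β S ≡ inS lam (Φ lam γ) S)
  conclusion = trans Q≡key (sym (Y≡ lam)) , Δ≡Ψ β up Q≡key , avoids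
    , (Adjacent⇒UGC γ (proj₁ γ-UI) γ-adjacent , γ-UI) , Adjacent⇒UGC β up β-adjacent
    , inS≡inD , Φ-flag , (λ S → trans (γ-inS S) (Φ-inS S))

-- The least tableau of each shape belongs to the set on its own side, so its content also occurs in
-- the other shape.
same-shape : ∀ {n} (lam lam′ : Vec ℕ n) → IsPartition lam → IsPartition lam′ → (β : Vec ℕ n) → IsUpper β →
  (π : Vec ℕ n) → InSnλ lam′ π → SamePoly lam β lam′ π → lam ≡ lam′
same-shape {n} lam lam′ part part′ β up π (bound , inj , _) same = shape-determined lam lam′ part part′ fromS fromD
  where
  open Permutation π bound inj
  fromS : ∃[ S ] (SSYT n (colLens lam′) S × content n S ≡ content n (initial (colLens lam)))
  fromS = let S , t , e = coeff-transfer lam lam′ (inS lam β) (inD lam′ π) same (initial-SSYT lam) (RowBound.initial-inS lam β up)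
    in S , proj₁ (inD⁻ lam′ S t) , e
  fromD : ∃[ S ] (SSYT n (colLens lam) S × content n S ≡ content n (initial (colLens lam′)))
  fromD = let S , t , e = coeff-transfer lam′ lam (inD lam′ π) (inS lam β) (λ θ → sym (same θ)) (initial-SSYT lam′) (initial-inD lam′)
    in S , BoundedBy.tableau (inS⁻ lam β S t) , e

-- The equality of shapes is taken as an argument so that matching on it identifies the two shapes
-- in all hypotheses at once.
conclusion-for-same-shape : ∀ {n} → 1 ≤ n → (lam lam' β π : Vec ℕ n) → IsUpper β → lam ≡ lam' → InSnλ lam' π → SamePoly lam β lam' π →
    (Q lam β ≡ Y lam' π) ×
    (lam ≡ lam') ×
    (Δ lam β ≡ Ψ lam π) ×
    Avoids312 lam π ×
    InUG lam (Δ lam β) ×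
    InUGC lam β ×
    (∀ T → inS lam β T ≡ inD lam' π T) ×
    IsUpperFlag (Φ lam (Δ lam β)) ×
    (∀ T → inS lam β T ≡ inS lam (Φ lam (Δ lam β)) T)
conclusion-for-same-shape 1≤n lam lam' β π up refl perm same = proj₁ c , refl , proj₂ c
  where c = SameShape.conclusion 1≤n lam β π up perm same

theorem10p3 : (n : ℕ) → 1 ≤ n →
    (lam lam' : Vec ℕ n) → IsPartition lam → IsPartition lam' →
    (β : Vec ℕ n) → IsUpper β →
    (π : Vec ℕ n) → InSnλ lam' π →
    SamePoly lam β lam' π →
    (Q lam β ≡ Y lam' π) ×
    (lam ≡ lam') ×
    (Δ lam β ≡ Ψ lam π) ×
    Avoids312 lam π ×
    InUG lam (Δ lam β) ×
    InUGC lam β ×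
    (∀ T → inS lam β T ≡ inD lam' π T) ×
    IsUpperFlag (Φ lam (Δ lam β)) ×
    (∀ T → inS lam β T ≡ inS lam (Φ lam (Δ lam β)) T)
theorem10p3 n 1≤n lam lam' part part' β up π perm same =
  conclusion-for-same-shape 1≤n lam lam' β π up (same-shape lam lam' part part' β up π perm same) perm same
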